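{- The following two statements are equivalent. (DCC) Every cyclically $4$-edge connected cubic graph has a dominating cycle. (NWC*) For every $4$-regular $4$-connected graph $H$ and every transition system $T$ of $H$, the graph $H$ is $T$-hamiltonian.
   Context: All graphs are finite and loopless (multiple edges are allowed). Cubic means $3$-regular. A graph $G$ is $k$-connected if $|V(G)|>k$ and $G-X$ is connected for every $X\subseteq V(G)$ with $|X|<k$. An edge cut of a connected graph $G$ is a set $E'\subseteq E(G)$ such that $G-E'$ is disconnected; it is a cyclic edge cut if at least two components of $G-E'$ are not trees. If $G$ contains two vertex-disjoint cycles, $\lambda_c(G)$ denotes the minimum size of a cyclic edge cut of $G$. A connected cubic graph $G$ is cyclically $4$-edge connected if $\lambda_c(G)\ge 4$. A dominating cycle of a graph $G$ is a cycle of $G$ which contains at least one endvertex of every edge of $G$. For a vertex $v$, $E_v$ denotes the set of edges incident with $v$. A transition system $T$ of a $4$-regular graph $H$ is a collection $T=\bigcup_{v\in V(H)}\{P_v\}$ where, for each $v$, $P_v$ is a partition of the four edges in $E_v$ into two sets of size $2$; each of these two sets is called a transition of $v$. A closed trail is a closed walk in which all edges are distinct. A trail follows a transition if the two edges of the transition are consecutive edges of the trail. $H$ is $T$-hamiltonian if it contains a $T$-trail, that is, a spanning closed trail $C$ of $H$ (one visiting every vertex) such that for each $v\in V(H)$ one of the following holds: (a) $|E(C)\cap E_v|=2$ (in this case there is no requirement that $C$ follow a transition of $v$); or (b) $C$ follows both transitions of $v$ (in this case $|E(C)\cap E_v|=4$). -}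

module Defs where

open import Data.Fin using (Fin)
open import Data.Fin.Properties using (_≟_)
open import Data.Fin.Subset using (Subset; _∩_; _∪_; ∣_∣; ⁅_⁆; ⋃; Empty) renaming (_∈_ to _∈ₛ_; _∉_ to _∉ₛ_)
open import Data.List using (List; []; _∷_; _++_; map; zip)
open import Data.List.Membership.Propositional using (_∈_)
open import Data.List.Relation.Unary.Unique.Propositional using (Unique)
open import Data.Nat using (ℕ; _≤_; _<_)
open import Data.Product using (Σ; ∃; ∃₂; ∃-syntax; _×_; _,_; proj₁; proj₂)
open import Data.Sum using (_⊎_)
open import Data.Unit using (⊤; tt)
open import Data.Vec using (tabulate)
open import Relation.Binary.PropositionalEquality using (_≡_; _≢_)
open import Relation.Nullary using (¬_; Dec; does)
open import Relation.Nullary.Decidable using (_⊎-dec_)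

-- Parallel edges are distinct edge labels with the same ends.  The order
-- within an edge's pair of ends carries no meaning: every notion below is
-- symmetric in it.
record Graph : Set where
  field
    ∣V∣      : ℕ
    ∣E∣      : ℕ
    ends     : Fin ∣E∣ → Fin ∣V∣ × Fin ∣V∣
    loopless : ∀ e → proj₁ (ends e) ≢ proj₂ (ends e)

  Vertex : Set
  Vertex = Fin ∣V∣

  Edge : Set
  Edge = Fin ∣E∣

  end₁ end₂ : Edge → Vertex
  end₁ e = proj₁ (ends e)
  end₂ e = proj₂ (ends e)

  Incident : Vertex → Edge → Set
  Incident v e = v ≡ end₁ e ⊎ v ≡ end₂ e

  incident? : ∀ v e → Dec (Incident v e)
  incident? v e = (v ≟ end₁ e) ⊎-dec (v ≟ end₂ e)

  Joins : Edge → Vertex → Vertex → Set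
  Joins e u v = ends e ≡ (u , v) ⊎ ends e ≡ (v , u)

  E[_] : Vertex → Subset ∣E∣
  E[ v ] = tabulate λ e → does (incident? v e)

  degree : Vertex → ℕ
  degree v = ∣ E[ v ] ∣

open Graph public

Regular : ℕ → Graph → Set
Regular d G = ∀ v → degree G v ≡ d

Cubic : Graph → Set
Cubic = Regular 3

record Subgraph (G : Graph) : Set₁ where
  field
    V      : Vertex G → Set
    E      : Edge G → Set
    closed : ∀ e → E e → V (end₁ G e) × V (end₂ G e)

open Subgraph public

module _ {G : Graph} where

  induced : (H : Subgraph G) → (Vertex G → Set) → Subgraph G
  induced H P .V v = V H v × P v
  induced H P .E e = E H e × P (end₁ G e) × P (end₂ G e)
  induced H P .closed e (e∈H , p₁ , p₂) with closed H e e∈H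
  ... | v₁ , v₂ = (v₁ , p₁) , (v₂ , p₂)

  data Walk (H : Subgraph G) : Vertex G → Vertex G → Set where
    []   : ∀ {v} → Walk H v v
    step : ∀ {u v w} (e : Edge G) → E H e → Joins G e u v → Walk H v w → Walk H u w

  edges : ∀ {H u v} → Walk H u v → List (Edge G)
  edges []               = []
  edges (step e _ _ w) = e ∷ edges w

  -- The final vertex is left out, so that in a closed walk of positive length
  -- the base vertex is not listed twice on account of closing up.
  vertices : ∀ {H u v} → Walk H u v → List (Vertex G)
  vertices []                       = []
  vertices (step {u = u} _ _ _ w) = u ∷ vertices w

  -- A subgraph without vertices does not count as connected.
  Connected : Subgraph G → Set
  Connected H = ∃ (V H) × (∀ u v → V H u → V H v → Walk H u v)

  -- Two parallel edges form a cycle of length 2; distinctness of the edges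
  -- excludes running back and forth along a single edge.
  IsCycle : ∀ {H v} → Walk H v v → Set
  IsCycle w = edges w ≢ [] × Unique (edges w) × Unique (vertices w)

  Tree : Subgraph G → Set
  Tree H = Connected H × ¬ (∃[ v ] Σ (Walk H v v) IsCycle)

  component : (H : Subgraph G) → Vertex G → Subgraph G
  component H v = induced H (Walk H v)

module _ (G : Graph) where

  whole : Subgraph G
  whole .V _        = ⊤
  whole .E _        = ⊤
  whole .closed _ _ = tt , tt

  deleteVertices : Subset (∣V∣ G) → Subgraph G
  deleteVertices X = induced whole (_∉ₛ X)

  deleteEdges : Subset (∣E∣ G) → Subgraph G
  deleteEdges F .V _        = ⊤
  deleteEdges F .E e        = e ∉ₛ F
  deleteEdges F .closed _ _ = tt , tt

  KConnected : ℕ → Set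
  KConnected k = k < ∣V∣ G × (∀ X → ∣ X ∣ < k → Connected (deleteVertices X))

  IsEdgeCut : Subset (∣E∣ G) → Set
  IsEdgeCut F = ¬ Connected (deleteEdges F)

  -- The two components are given by representatives u and v; they are distinct
  -- because no walk joins u to v.
  IsCyclicEdgeCut : Subset (∣E∣ G) → Set
  IsCyclicEdgeCut F = IsEdgeCut F × ∃₂ λ u v →
    ¬ Walk (deleteEdges F) u v
    × ¬ Tree (component (deleteEdges F) u)
    × ¬ Tree (component (deleteEdges F) v)

  -- λc as a relation, since the minimum need not exist: it exists for a
  -- connected graph exactly when there are two vertex-disjoint cycles.
  λc≡_ : ℕ → Set
  λc≡ k = (∃[ F ] IsCyclicEdgeCut F × ∣ F ∣ ≡ k)
        × (∀ F → IsCyclicEdgeCut F → k ≤ ∣ F ∣)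

  -- With no cyclic edge cut at all (such as in K₄ and K₃,₃) the condition on
  -- λc holds, in line with the minimum of the empty set being ∞.
  CyclicallyEdgeConnected : ℕ → Set
  CyclicallyEdgeConnected k = Connected whole × (∀ l → λc≡ l → k ≤ l)

  HasDominatingCycle : Set
  HasDominatingCycle = ∃[ v ] Σ (Walk whole v v) λ C →
    IsCycle C × (∀ e → ∃[ u ] u ∈ vertices C × Incident G u e)

  -- The two parts are named, but everything below is symmetric in them.
  record TransitionsAt (v : Vertex G) : Set where
    field
      P₁ P₂    : Subset (∣E∣ G)
      size₁    : ∣ P₁ ∣ ≡ 2
      size₂    : ∣ P₂ ∣ ≡ 2
      disjoint : Empty (P₁ ∩ P₂)
      cover    : P₁ ∪ P₂ ≡ E[_] G v

  open TransitionsAt public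

  TransitionSystem : Set
  TransitionSystem = ∀ v → TransitionsAt v

cyclicPairs : {A : Set} → List A → List (A × A)
cyclicPairs []       = []
cyclicPairs (x ∷ xs) = zip (x ∷ xs) (xs ++ x ∷ [])

module _ {G : Graph} where

  edgeSet : ∀ {v} → Walk (whole G) v v → Subset (∣E∣ G)
  edgeSet C = ⋃ (map ⁅_⁆ (edges C))

  -- Consecutive in the cyclic order of the closed trail.  That C passes through
  -- the transition's own vertex between e and f could only fail if e and f were
  -- parallel, and 4-regular 4-connected graphs have no parallel edges.
  Follows : ∀ {v} → Walk (whole G) v v → Subset (∣E∣ G) → Set
  Follows C P = ∃₂ λ e f → (e , f) ∈ cyclicPairs (edges C) × P ≡ ⁅ e ⁆ ∪ ⁅ f ⁆

  IsTTrail : TransitionSystem G → ∀ {v} → Walk (whole G) v v → Set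
  IsTTrail T C =
    Unique (edges C)
    × (∀ v → v ∈ vertices C)
    × (∀ v → ∣ edgeSet C ∩ E[_] G v ∣ ≡ 2
           ⊎ (Follows C (P₁ (T v)) × Follows C (P₂ (T v))))

THamiltonian : (H : Graph) → TransitionSystem H → Set
THamiltonian H T = ∃[ v ] Σ (Walk (whole H) v v) (IsTTrail T)

DCC : Set
DCC = ∀ G → Cubic G → CyclicallyEdgeConnected G 4 → HasDominatingCycle G

NWC* : Set
NWC* = ∀ H → Regular 4 H → KConnected H 4 → (T : TransitionSystem H) → THamiltonian H T

{-# OPTIONS --safe #-}
module Submission where

-- DCC ⇒ NWC*: split every vertex of H into two ports, one for each transition, joined by a new
-- edge, and contract the triangles made of transitions.  The result is cubic.  Given an edge cut
-- with at most three edges and cycles on both sides, each side has a vertex of H with both ports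
-- on that side: otherwise a cycle there avoids the new edges, so it has length at least 4 (H has
-- no parallel edges and triangles are contracted) and the new edges at its ports all lie in the
-- cut.  Counting gives two such vertices p and q that are not adjacent, and choosing an end
-- other than p and q of every cut edge separates p from q by at most three vertices of H.  So
-- the contracted graph is cyclically 4-edge connected.  A dominating cycle of it, led through
-- all three ports of every triangle it meets, projects to a T-trail of H.
--
-- NWC* ⇒ DCC: take for H the line graph of G; each vertex of G is a triangle of H, and the
-- transitions at an edge of G pair the edges of H by triangle.  H is 4-connected, because a
-- component of G minus at most three edges that has an edge but no cycle would have two leaves,
-- from which four deleted edges leave.  The edges of G at which a T-trail passes from one
-- triangle to another form a closed trail of G, which is a cycle since G is cubic, and
-- dominating since the T-trail is spanning.

open import Defs
open import Data.Bool using (Bool; true; false; not)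
import Data.Bool.Properties as Bool
open import Data.Empty using (⊥; ⊥-elim)
open import Data.Fin using (Fin; zero; suc; remQuot; combine)
import Data.Fin.Properties as Fin
open import Data.Fin.Subset using (Subset; _∩_; _∪_; ∣_∣; ⁅_⁆; ⋃) renaming (_∈_ to _∈ₛ_; _∉_ to _∉ₛ_)
import Data.Fin.Subset.Properties as Subset
open import Data.List using (List; []; _∷_; _++_; map; zip; length; filter; concatMap; mapMaybe; allFin; lookup; reverse; cartesianProduct)
import Data.List.Properties as List
open import Data.List.Membership.Propositional using (_∈_; _∉_; find; lose)
open import Data.List.Membership.Propositional.Properties using (∈-map⁺; ∈-map⁻; ∈-++⁺ˡ; ∈-++⁺ʳ; ∈-++⁻; ∈-∃++; ∈-concat⁺′; ∈-concat⁻′; ∈-filter⁺; ∈-filter⁻; ∈-lookup; ∈-allFin; ∈-cartesianProduct⁺)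
open import Data.List.Relation.Unary.All using (All; []; _∷_)
import Data.List.Relation.Unary.All as All
import Data.List.Relation.Unary.All.Properties as All
open import Data.List.Relation.Unary.AllPairs using (AllPairs; []; _∷_)
import Data.List.Relation.Unary.AllPairs as AllPairs
open import Data.List.Relation.Unary.Any using (here; there; index; any?)
import Data.List.Relation.Unary.Any.Properties as Any
open import Data.List.Relation.Unary.Unique.Propositional using (Unique)
import Data.List.Relation.Unary.Unique.Propositional.Properties as Unique
open import Data.Maybe using (Maybe; just; nothing)
open import Data.Nat using (ℕ; zero; suc; _+_; _*_; _≤_; _<_; z≤n; s≤s)
import Data.Nat.Properties as ℕ
import Data.Nat.Induction as ℕ
open import Data.Product using (Σ; ∃; ∃₂; _×_; _,_; proj₁; proj₂)
import Data.Product.Properties as Product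
open import Data.Sum using (_⊎_; inj₁; inj₂; [_,_]′)
import Data.Sum.Properties as Sum
open import Data.Unit using (tt)
open import Data.Vec using (tabulate) renaming ([] to []ᵥ; _∷_ to _∷ᵥ_)
import Data.Vec.Properties as Vec
open import Function using (_∘_; id; case_of_)
open import Function.Bundles using (_⇔_; mk⇔)
open import Relation.Binary.PropositionalEquality using (_≡_; _≢_; refl; sym; trans; cong; cong₂; subst)
open import Relation.Nullary using (¬_; Dec; yes; no; does)
open import Relation.Nullary.Decidable using (_⊎-dec_; _×-dec_; ¬?; decidable-stable; map′)
open import Relation.Binary.Definitions using (DecidableEquality)
open import Relation.Unary using (Decidable)

-- Lists, cyclic pairs and cardinalities of subsets

-- Ports translate the two alternatives of a T-trail into the ways in which a cycle passes the two
-- ends of one edge of a cubic graph: (a) arises when the new edge at `v` is used or only one port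
-- of `v` is met, (b) when both ports are passed without it. Dominating the new edge at `v` then
-- amounts to visiting `v`.
--
-- The obstacle is a triangle formed by three transitions: the three new edges at its ports cut it
-- off, so a dominating cycle need not be available before contraction. Parallel edges of `H` would
-- cause the same trouble, and 4-connectivity excludes them.
--
-- In the line graph, an edge of `G` is a vertex shared by two triangles. The transitions are chosen
-- so that a trail passing it twice must stay in its triangle both times; a change of triangle can
-- therefore happen at most once at each edge of `G`, which makes the recorded changes a trail.
--
-- Components and cycles are only available up to double negation. Reachability is decided, and the
-- inequalities to be proved are decidable, so this is enough.

module _ {A : Set} where

  -- The pigeonhole principle to which every count below is reduced, by listing the sets concerned
  -- without repetition.
  unique-⊆-length : {xs ys : List A} → Unique xs → (∀ {x} → x ∈ xs → x ∈ ys) → length xs ≤ length ys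
  unique-⊆-length {[]} _ _ = z≤n
  unique-⊆-length {x ∷ xs} {ys} (x∉xs ∷ u) sub with ∈-∃++ (sub (here refl))
  ... | as , bs , refl = subst (suc (length xs) ≤_) (sym (List.length-++-sucʳ as x bs)) (s≤s (unique-⊆-length u sub′))
    where
    sub′ : ∀ {z} → z ∈ xs → z ∈ as ++ bs
    sub′ z∈xs with ∈-++⁻ as (sub (there z∈xs))
    ... | inj₁ z∈as          = ∈-++⁺ˡ z∈as
    ... | inj₂ (here refl)   = ⊥-elim (All.lookup x∉xs z∈xs refl)
    ... | inj₂ (there z∈bs)  = ∈-++⁺ʳ as z∈bs

  unique-head : {x : A} {xs : List A} → Unique (x ∷ xs) → x ∉ xs
  unique-head = Unique.Unique[x∷xs]⇒x∉xs

  unique-lookup-injective : {xs : List A} → Unique xs → ∀ i j → lookup xs i ≡ lookup xs j → i ≡ j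
  unique-lookup-injective (_ ∷ _) zero zero _ = refl
  unique-lookup-injective {_ ∷ xs} (x∉ ∷ _) zero (suc j) eq = ⊥-elim (All.lookup x∉ (∈-lookup j) eq)
  unique-lookup-injective (x∉ ∷ _) (suc i) zero eq = ⊥-elim (All.lookup x∉ (∈-lookup i) (sym eq))
  unique-lookup-injective (_ ∷ u) (suc i) (suc j) eq = cong suc (unique-lookup-injective u i j eq)

  unique-rotate : {x : A} {xs : List A} → Unique (x ∷ xs) → Unique (xs ++ x ∷ [])
  unique-rotate (x∉ ∷ u) = Unique.++⁺ u ([] ∷ []) λ { (v∈ , here refl) → All.lookup x∉ v∈ refl }

  -- The cyclic pairs of `x ∷ xs` are the consecutive pairs of the open list `x ∷ xs ++ x ∷ []`. In
  -- this form they are easily followed through a deletion of elements.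
  Consecutive : A → A → List A → Set
  Consecutive a b xs = ∃₂ λ as bs → xs ≡ as ++ a ∷ b ∷ bs

  unique-consecutive : ∀ as {a b : A} {bs} → Unique (as ++ a ∷ b ∷ bs) → a ≢ b
  unique-consecutive [] ((a≢b ∷ _) ∷ _) = a≢b
  unique-consecutive (_ ∷ as) (_ ∷ u) = unique-consecutive as u

  zip-consecutive : ∀ x ys z {a b : A} → (a , b) ∈ zip (x ∷ ys) (ys ++ z ∷ []) → Consecutive a b (x ∷ ys ++ z ∷ [])
  zip-consecutive x [] z (here refl) = [] , [] , refl
  zip-consecutive x (y ∷ ys) z (here refl) = [] , ys ++ z ∷ [] , refl
  zip-consecutive x (y ∷ ys) z (there p) with zip-consecutive y ys z p
  ... | as , bs , eq = x ∷ as , bs , cong (x ∷_) eq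

  consecutive-zip : ∀ x ys z {a b : A} → Consecutive a b (x ∷ ys ++ z ∷ []) → (a , b) ∈ zip (x ∷ ys) (ys ++ z ∷ [])
  consecutive-zip x [] z ([] , [] , refl) = here refl
  consecutive-zip x [] z (_ ∷ [] , bs , ())
  consecutive-zip x [] z (_ ∷ _ ∷ [] , bs , ())
  consecutive-zip x [] z (_ ∷ _ ∷ _ ∷ as , bs , ())
  consecutive-zip x (y ∷ ys) z ([] , bs , refl) = here refl
  consecutive-zip x (y ∷ ys) z (_ ∷ as , bs , eq) = there (consecutive-zip y ys z (as , bs , List.∷-injectiveʳ eq))

  zip-proj₁ : ∀ (x : A) ys z → map proj₁ (zip (x ∷ ys) (ys ++ z ∷ [])) ≡ x ∷ ys
  zip-proj₁ x [] z = refl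
  zip-proj₁ x (y ∷ ys) z = cong (x ∷_) (zip-proj₁ y ys z)

  zip-proj₂ : ∀ (x : A) ys z → map proj₂ (zip (x ∷ ys) (ys ++ z ∷ [])) ≡ ys ++ z ∷ []
  zip-proj₂ x [] z = refl
  zip-proj₂ x (y ∷ ys) z = cong (y ∷_) (zip-proj₂ y ys z)

  cyclicPairs-proj₁ : (xs : List A) → map proj₁ (cyclicPairs xs) ≡ xs
  cyclicPairs-proj₁ [] = refl
  cyclicPairs-proj₁ (x ∷ xs) = zip-proj₁ x xs x

  cyclicPairs-proj₂-∈ : {xs : List A} {x : A} → x ∈ xs → x ∈ map proj₂ (cyclicPairs xs)
  cyclicPairs-proj₂-∈ {y ∷ ys} {x} x∈ rewrite zip-proj₂ y ys y with x∈
  ... | here refl = ∈-++⁺ʳ ys (here refl)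
  ... | there p   = ∈-++⁺ˡ p

  cyclicPairs-proj₂-unique : {xs : List A} → Unique xs → Unique (map proj₂ (cyclicPairs xs))
  cyclicPairs-proj₂-unique {[]} _ = []
  cyclicPairs-proj₂-unique {x ∷ xs} u rewrite zip-proj₂ x xs x = unique-rotate u

  cyclicPairs-succ : {xs : List A} {x : A} → x ∈ xs → ∃ λ y → (x , y) ∈ cyclicPairs xs
  cyclicPairs-succ {xs} x∈ with ∈-map⁻ proj₁ (subst (_ ∈_) (sym (cyclicPairs-proj₁ xs)) x∈)
  ... | (_ , y) , p , refl = y , p

  cyclicPairs-pred : {xs : List A} {y : A} → y ∈ xs → ∃ λ x → (x , y) ∈ cyclicPairs xs
  cyclicPairs-pred y∈ with ∈-map⁻ proj₂ (cyclicPairs-proj₂-∈ y∈)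
  ... | (x , _) , p , refl = x , p

  cyclicPairs-∈₁ : {xs : List A} {x y : A} → (x , y) ∈ cyclicPairs xs → x ∈ xs
  cyclicPairs-∈₁ {xs} p = subst (_ ∈_) (cyclicPairs-proj₁ xs) (∈-map⁺ proj₁ p)

  cyclicPairs-∈₂ : {xs : List A} {x y : A} → (x , y) ∈ cyclicPairs xs → y ∈ xs
  cyclicPairs-∈₂ {z ∷ zs} p with ∈-++⁻ zs (subst (_ ∈_) (zip-proj₂ z zs z) (∈-map⁺ proj₂ p))
  ... | inj₁ q           = there q
  ... | inj₂ (here refl) = here refl

module _ {A B : Set} where

  zip-map : (f : A → B) → ∀ xs ys → zip (map f xs) (map f ys) ≡ map (λ p → f (proj₁ p) , f (proj₂ p)) (zip xs ys)
  zip-map f [] ys = refl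
  zip-map f (x ∷ xs) [] = refl
  zip-map f (x ∷ xs) (y ∷ ys) = cong (_ ∷_) (zip-map f xs ys)

  cyclicPairs-map : (f : A → B) → ∀ xs → cyclicPairs (map f xs) ≡ map (λ p → f (proj₁ p) , f (proj₂ p)) (cyclicPairs xs)
  cyclicPairs-map f [] = refl
  cyclicPairs-map f (x ∷ xs) = trans (cong (zip (f x ∷ map f xs)) (sym (List.map-++ f xs (x ∷ []))))
      (zip-map f (x ∷ xs) (xs ++ x ∷ []))

  unique-map-on : (f : A → B) {xs : List A} → (∀ {x y} → x ∈ xs → y ∈ xs → f x ≡ f y → x ≡ y) →
                  Unique xs → Unique (map f xs)
  unique-map-on f inj [] = []
  unique-map-on f {x ∷ xs} inj (x∉ ∷ u) =
    All.map⁺ (All.tabulate λ y∈ eq → All.lookup x∉ y∈ (inj (here refl) (there y∈) eq))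
    ∷ unique-map-on f (λ p q → inj (there p) (there q)) u

  unique-map-injective : (f : A → B) {xs : List A} → Unique (map f xs) → ∀ {x y} → x ∈ xs → y ∈ xs → f x ≡ f y → x ≡ y
  unique-map-injective f (_ ∷ u) (here refl) (here refl) eq = refl
  unique-map-injective f (x∉ ∷ u) (here refl) (there q) eq = ⊥-elim (All.lookup x∉ (∈-map⁺ f q) eq)
  unique-map-injective f (x∉ ∷ u) (there p) (here refl) eq = ⊥-elim (All.lookup x∉ (∈-map⁺ f p) (sym eq))
  unique-map-injective f (_ ∷ u) (there p) (there q) eq = unique-map-injective f u p q eq

  ∈-mapMaybe : (f : A → Maybe B) {xs : List A} {x : A} {b : B} → x ∈ xs → f x ≡ just b → b ∈ mapMaybe f xs
  ∈-mapMaybe f {x ∷ xs} (here refl) eq with f x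
  ∈-mapMaybe f {x ∷ xs} (here refl) refl | just b = here refl
  ∈-mapMaybe f {x ∷ xs} (there p) eq with f x
  ... | just _  = there (∈-mapMaybe f p eq)
  ... | nothing = ∈-mapMaybe f p eq

  ∈-mapMaybe⁻ : (f : A → Maybe B) {xs : List A} {b : B} → b ∈ mapMaybe f xs → ∃ λ x → x ∈ xs × f x ≡ just b
  ∈-mapMaybe⁻ f {x ∷ xs} p with f x in eq
  ∈-mapMaybe⁻ f {x ∷ xs} (here refl) | just _ = x , here refl , eq
  ∈-mapMaybe⁻ f {x ∷ xs} (there p) | just _ with ∈-mapMaybe⁻ f p
  ... | y , y∈ , e = y , there y∈ , e
  ∈-mapMaybe⁻ f {x ∷ xs} p | nothing with ∈-mapMaybe⁻ f p
  ... | y , y∈ , e = y , there y∈ , e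

  unique-mapMaybe : (f : A → Maybe B) → (∀ {x y b} → f x ≡ just b → f y ≡ just b → x ≡ y) →
                    {xs : List A} → Unique xs → Unique (mapMaybe f xs)
  unique-mapMaybe f inj {[]} _ = []
  unique-mapMaybe f inj {x ∷ xs} (x∉ ∷ u) with f x in eq
  ... | nothing = unique-mapMaybe f inj u
  ... | just b  = All.tabulate (λ {c} c∈ b≡c → let y , y∈ , e = ∈-mapMaybe⁻ f c∈ in
                    All.lookup x∉ y∈ (inj eq (trans e (cong just (sym b≡c)))))
                  ∷ unique-mapMaybe f inj u

  mapMaybe-consecutive : (f : A → Maybe B) {xs : List A} {x y : A} {a b : B} → f x ≡ just a → f y ≡ just b →
                         Consecutive x y xs → Consecutive a b (mapMaybe f xs)
  mapMaybe-consecutive f {x = x} {y} {a} {b} ex ey (as , bs , refl) =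
    mapMaybe f as , mapMaybe f bs , trans (List.mapMaybe-++ f as (x ∷ y ∷ bs)) (cong (mapMaybe f as ++_) tail≡)
    where
    tail≡ : mapMaybe f (x ∷ y ∷ bs) ≡ a ∷ b ∷ mapMaybe f bs
    tail≡ rewrite ex | ey = refl

  cyclicPairs-mapMaybe : (f : A → Maybe B) {xs : List A} {x y : A} {a b : B} → f x ≡ just a → f y ≡ just b →
                         (x , y) ∈ cyclicPairs xs → (a , b) ∈ cyclicPairs (mapMaybe f xs)
  cyclicPairs-mapMaybe f {z ∷ zs} {x} {y} {a} {b} ex ey p with mapMaybe-consecutive f ex ey
      (zip-consecutive z zs z p) | f z in ez
  ... | c | just d  = consecutive-zip d (mapMaybe f zs) d (subst (Consecutive a b) split c)
    where
    split : mapMaybe f (z ∷ zs ++ z ∷ []) ≡ d ∷ mapMaybe f zs ++ d ∷ []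
    split rewrite ez | List.mapMaybe-++ f zs (z ∷ []) | ez = refl
  -- The base element is dropped at both ends, so an open list remains, and a consecutive pair of it
  -- is in particular a cyclic pair.
  ... | c | nothing = closeUp (mapMaybe f zs) (subst (Consecutive a b) split c)
    where
    split : mapMaybe f (z ∷ zs ++ z ∷ []) ≡ mapMaybe f zs
    split rewrite ez | List.mapMaybe-++ f zs (z ∷ []) | ez = List.++-identityʳ _
    closeUp : ∀ ws → Consecutive a b ws → (a , b) ∈ cyclicPairs ws
    closeUp [] ([] , _ , ())
    closeUp [] (_ ∷ _ , _ , ())
    closeUp (w ∷ ws) (as , bs , eq) =
      consecutive-zip w ws w (as , bs ++ w ∷ [] , trans (cong (_++ w ∷ []) eq) (List.++-assoc as (a ∷ b ∷ bs) (w ∷ [])))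

module _ {A : Set} {xs : List A} (u : Unique xs) where

  cyclicPairs-unique : Unique (cyclicPairs xs)
  cyclicPairs-unique = Unique.map⁻ (subst Unique (sym (cyclicPairs-proj₁ xs)) u)

  cyclicPairs-succ-unique : ∀ {x y y′} → (x , y) ∈ cyclicPairs xs → (x , y′) ∈ cyclicPairs xs → y ≡ y′
  cyclicPairs-succ-unique p q =
    cong proj₂ (unique-map-injective proj₁ (subst Unique (sym (cyclicPairs-proj₁ xs)) u) p q refl)

  cyclicPairs-pred-unique : ∀ {x x′ y} → (x , y) ∈ cyclicPairs xs → (x′ , y) ∈ cyclicPairs xs → x ≡ x′
  cyclicPairs-pred-unique p q =
    cong proj₁ (unique-map-injective proj₂ (cyclicPairs-proj₂-unique u) p q refl)

elements : ∀ {n} → Subset n → List (Fin n)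
elements S = filter (Subset._∈? S) (allFin _)

elements-unique : ∀ {n} (S : Subset n) → Unique (elements S)
elements-unique S = Unique.filter⁺ (Subset._∈? S) (Unique.allFin⁺ _)

∈-elements⁺ : ∀ {n} {S : Subset n} {x} → x ∈ₛ S → x ∈ elements S
∈-elements⁺ {S = S} = ∈-filter⁺ (Subset._∈? S) (∈-allFin _)

∈-elements⁻ : ∀ {n} {S : Subset n} {x} → x ∈ elements S → x ∈ₛ S
∈-elements⁻ {S = S} p = proj₂ (∈-filter⁻ (Subset._∈? S) {xs = allFin _} p)

∣∣-enumerated : ∀ {n} (S : Subset n) → ∃ λ l → length l ≡ ∣ S ∣ × Unique l × (∀ {x} → x ∈ₛ S → x ∈ l)
    × (∀ {x} → x ∈ l → x ∈ₛ S)
∣∣-enumerated []ᵥ = [] , refl , [] , (λ ()) , λ ()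
∣∣-enumerated (s ∷ᵥ S) with ∣∣-enumerated S
... | l , len , u , to , from with s
... | false = map suc l , trans (List.length-map suc l) len , Unique.map⁺ Fin.suc-injective u
            , (λ { {suc x} p → ∈-map⁺ suc (to (Subset.drop-there p)) })
            , λ p → case ∈-map⁻ suc p of λ { (y , q , refl) → Data.Vec.there (from q) }
... | true  = zero ∷ map suc l , cong suc (trans (List.length-map suc l) len)
            , All.tabulate (λ p → case ∈-map⁻ suc p of λ { (y , q , refl) () }) ∷ Unique.map⁺ Fin.suc-injective u
            , (λ { {zero} p → here refl ; {suc x} p → there (∈-map⁺ suc (to (Subset.drop-there p))) })
            , λ { (here refl) → Data.Vec.here ; (there p) → case ∈-map⁻ suc p of
                λ { (y , q , refl) → Data.Vec.there (from q) } }

module _ {n} {S : Subset n} where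

  length≤∣∣ : {l : List (Fin n)} → Unique l → (∀ {x} → x ∈ l → x ∈ₛ S) → length l ≤ ∣ S ∣
  length≤∣∣ u sub with ∣∣-enumerated S
  ... | l , len , _ , to , _ = subst (_ ≤_) len (unique-⊆-length u (to ∘ sub))

  ∣∣≤length : {l : List (Fin n)} → (∀ {x} → x ∈ₛ S → x ∈ l) → ∣ S ∣ ≤ length l
  ∣∣≤length sub with ∣∣-enumerated S
  ... | l , len , u , _ , from = subst (_≤ _) len (unique-⊆-length u (sub ∘ from))

  ∣∣≡length : {l : List (Fin n)} → Unique l → (∀ {x} → x ∈ l → x ∈ₛ S) → (∀ {x} → x ∈ₛ S → x ∈ l) → ∣ S ∣ ≡ length l
  ∣∣≡length u from to = ℕ.≤-antisym (∣∣≤length to) (length≤∣∣ u from)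

  length-elements : length (elements S) ≡ ∣ S ∣
  length-elements = sym (∣∣≡length (elements-unique S) ∈-elements⁻ ∈-elements⁺)

fromList : ∀ {n} → List (Fin n) → Subset n
fromList l = ⋃ (map ⁅_⁆ l)

∈-fromList⁺ : ∀ {n} {l : List (Fin n)} {x} → x ∈ l → x ∈ₛ fromList l
∈-fromList⁺ {l = y ∷ l} (here refl) = Subset.x∈p∪q⁺ (inj₁ (Subset.x∈⁅x⁆ y))
∈-fromList⁺ (there p) = Subset.x∈p∪q⁺ (inj₂ (∈-fromList⁺ p))

∈-fromList⁻ : ∀ {n} {l : List (Fin n)} {x} → x ∈ₛ fromList l → x ∈ l
∈-fromList⁻ {l = []} p = ⊥-elim (Subset.∉⊥ p)
∈-fromList⁻ {l = y ∷ l} p with Subset.x∈p∪q⁻ ⁅ y ⁆ (fromList l) p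
... | inj₁ q = here (Subset.x∈⁅y⁆⇒x≡y y q)
... | inj₂ q = there (∈-fromList⁻ q)

∣fromList∣≤length : ∀ {n} (l : List (Fin n)) → ∣ fromList l ∣ ≤ length l
∣fromList∣≤length l = ∣∣≤length {l = l} ∈-fromList⁻

fromDecidable : ∀ {n} {P : Fin n → Set} → Decidable P → Subset n
fromDecidable P? = tabulate λ i → does (P? i)

module _ {n} {P : Fin n → Set} (P? : Decidable P) where

  ∈-fromDecidable⁺ : ∀ {i} → P i → i ∈ₛ fromDecidable P?
  ∈-fromDecidable⁺ {i} p = Vec.lookup⇒[]= i _ (trans (Vec.lookup∘tabulate _ i) (lemma (P? i)))
    where
    lemma : (d : Dec (P i)) → does d ≡ true
    lemma (yes _) = refl
    lemma (no ¬p) = ⊥-elim (¬p p)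

  ∈-fromDecidable⁻ : ∀ {i} → i ∈ₛ fromDecidable P? → P i
  ∈-fromDecidable⁻ {i} i∈ = lemma (P? i) (trans (sym (Vec.lookup∘tabulate (λ i → does (P? i)) i)) (Vec.[]=⇒lookup i∈))
    where
    lemma : (d : Dec (P i)) → does d ≡ true → P i
    lemma (yes p) _ = p

∈-pair⁻ : ∀ {n} {x y z : Fin n} → z ∈ₛ ⁅ x ⁆ ∪ ⁅ y ⁆ → z ≡ x ⊎ z ≡ y
∈-pair⁻ {x = x} {y} p with Subset.x∈p∪q⁻ ⁅ x ⁆ ⁅ y ⁆ p
... | inj₁ q = inj₁ (Subset.x∈⁅y⁆⇒x≡y x q)
... | inj₂ q = inj₂ (Subset.x∈⁅y⁆⇒x≡y y q)

∈-pair⁺ : ∀ {n} {x y z : Fin n} → z ≡ x ⊎ z ≡ y → z ∈ₛ ⁅ x ⁆ ∪ ⁅ y ⁆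
∈-pair⁺ (inj₁ refl) = Subset.x∈p∪q⁺ (inj₁ (Subset.x∈⁅x⁆ _))
∈-pair⁺ (inj₂ refl) = Subset.x∈p∪q⁺ (inj₂ (Subset.x∈⁅x⁆ _))

pair-≡ : ∀ {n} {S : Subset n} {x y} → x ∈ₛ S → y ∈ₛ S → (∀ {z} → z ∈ₛ S → z ≡ x ⊎ z ≡ y) → S ≡ ⁅ x ⁆ ∪ ⁅ y ⁆
pair-≡ x∈ y∈ only = Subset.⊆-antisym (∈-pair⁺ ∘ only) λ p → case ∈-pair⁻ p of λ { (inj₁ refl) → x∈ ; (inj₂ refl) → y∈ }

two-elements : ∀ {n} (S : Subset n) → ∣ S ∣ ≡ 2 → ∃₂ λ x y → x ≢ y × x ∈ₛ S × y ∈ₛ S × (∀ {z} → z ∈ₛ S → z ≡ x ⊎ z ≡ y)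
two-elements S eq with ∣∣-enumerated S
... | x ∷ y ∷ [] , _ , (x≢y ∷ []) ∷ _ , to , from = x , y , x≢y , from (here refl) , from (there (here refl)) ,
  λ p → case to p of λ { (here q) → inj₁ q ; (there (here q)) → inj₂ q }
... | [] , len , _ = case trans len eq of λ ()
... | _ ∷ [] , len , _ = case trans len eq of λ ()
... | _ ∷ _ ∷ _ ∷ _ , len , _ = case trans len eq of λ ()

-- A bijection between `Fin size` and a subset of `A`. Quotients and edge deletions are first
-- described on convenient types and then numbered this way, since a `Graph` has numbered vertices
-- and edges.
record Enumeration {A : Set} (P : A → Set) : Set where
  field
    size         : ℕ
    at           : Fin size → A
    at-sound     : ∀ i → P (at i)
    at-injective : ∀ {i j} → at i ≡ at j → i ≡ j
    indexOf      : ∀ a → P a → Fin size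
    at-indexOf   : ∀ a p → at (indexOf a p) ≡ a

  indexOf-cong : ∀ {a b} p q → a ≡ b → indexOf a p ≡ indexOf b q
  indexOf-cong p q refl = at-injective (trans (at-indexOf _ p) (sym (at-indexOf _ q)))

  indexOf-injective : ∀ {a b} p q → indexOf a p ≡ indexOf b q → a ≡ b
  indexOf-injective p q eq = trans (sym (at-indexOf _ p)) (trans (cong at eq) (at-indexOf _ q))

enumerate : {A : Set} {xs : List A} → Unique xs → (∀ a → a ∈ xs) → {P : A → Set} → Decidable P → Enumeration P
enumerate {A} {xs} u all {P} P? = record
  { size = length ys
  ; at = lookup ys
  ; at-sound = λ i → proj₂ (∈-filter⁻ P? {xs = xs} (∈-lookup i))
  ; at-injective = λ {i} {j} → unique-lookup-injective (Unique.filter⁺ P? u) i j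
  ; indexOf = λ a p → index (∈-filter⁺ P? (all a) p)
  ; at-indexOf = λ a p → sym (Any.lookup-index (∈-filter⁺ P? (all a) p))
  }
  where
  ys : List A
  ys = filter P? xs

-- The representative of a class is its first member in the list xs: equal classes give equal filtered lists.
module Representative {A : Set} {xs : List A} (all : ∀ a → a ∈ xs)
  {_≈_ : A → A → Set} (_≈?_ : ∀ a b → Dec (a ≈ b))
  (≈-refl : ∀ {a} → a ≈ a) (≈-sym : ∀ {a b} → a ≈ b → b ≈ a) (≈-trans : ∀ {a b c} → a ≈ b → b ≈ c → a ≈ c) where

  private
    first : (ys : List A) {a : A} → a ∈ ys → A
    first (y ∷ _) _ = y

    first-∈ : (ys : List A) {a : A} (p : a ∈ ys) → first ys p ∈ ys
    first-∈ (y ∷ _) _ = here refl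

    first-≡ : {ys zs : List A} → ys ≡ zs → ∀ {a b} (p : a ∈ ys) (q : b ∈ zs) → first ys p ≡ first zs q
    first-≡ {y ∷ _} refl _ _ = refl

  self-∈ : ∀ a → a ∈ filter (a ≈?_) xs
  self-∈ a = ∈-filter⁺ (a ≈?_) (all a) ≈-refl

  rep : A → A
  rep a = first (filter (a ≈?_) xs) (self-∈ a)

  rep-≈ : ∀ a → a ≈ rep a
  rep-≈ a = proj₂ (∈-filter⁻ (a ≈?_) {xs = xs} (first-∈ (filter (a ≈?_) xs) (self-∈ a)))

  rep-≡ : ∀ {a b} → a ≈ b → rep a ≡ rep b
  rep-≡ {a} {b} p = first-≡ (List.filter-≐ (a ≈?_) (b ≈?_) (≈-trans (≈-sym p) , ≈-trans p) xs) (self-∈ a) (self-∈ b)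

-- Closed trails as lists of darts

module Darts {Vtx Edg : Set} (src tgt : Edg → Vtx) where

  -- An edge with a direction, where `true` means from `src` to `tgt`. Vertex and edge types are
  -- arbitrary, so that trails of the port graph, with pairs as vertices and a sum as edge type, are
  -- treated together with those of a `Graph`.
  Dart : Set
  Dart = Edg × Bool

  edge : Dart → Edg
  edge = proj₁

  tail head : Dart → Vtx
  tail (e , true)  = src e
  tail (e , false) = tgt e
  head (e , true)  = tgt e
  head (e , false) = src e

  flip : Dart → Dart
  flip (e , b) = e , not b

  tail-flip : ∀ d → tail (flip d) ≡ head d
  tail-flip (e , true)  = refl
  tail-flip (e , false) = refl

  head-flip : ∀ d → head (flip d) ≡ tail d
  head-flip (e , true)  = refl
  head-flip (e , false) = refl

  At : Vtx → Edg → Set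
  At x e = x ≡ src e ⊎ x ≡ tgt e

  tail-at : ∀ {x} d → tail d ≡ x → At x (edge d)
  tail-at (e , true)  eq = inj₁ (sym eq)
  tail-at (e , false) eq = inj₂ (sym eq)

  head-at : ∀ {x} d → head d ≡ x → At x (edge d)
  head-at (e , true)  eq = inj₂ (sym eq)
  head-at (e , false) eq = inj₁ (sym eq)

  at-dart : ∀ {x} d → At x (edge d) → tail d ≡ x ⊎ head d ≡ x
  at-dart (e , true)  (inj₁ eq) = inj₁ (sym eq)
  at-dart (e , true)  (inj₂ eq) = inj₂ (sym eq)
  at-dart (e , false) (inj₁ eq) = inj₂ (sym eq)
  at-dart (e , false) (inj₂ eq) = inj₁ (sym eq)

  at-out : ∀ {x e} → At x e → ∃ λ d → edge d ≡ e × tail d ≡ x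
  at-out {e = e} (inj₁ eq) = (e , true) , refl , sym eq
  at-out {e = e} (inj₂ eq) = (e , false) , refl , sym eq

  Chain : Vtx → List Dart → Vtx → Set
  Chain u []       v = u ≡ v
  Chain u (d ∷ ds) v = tail d ≡ u × Chain (head d) ds v

  chain-++ : ∀ {u v w} xs {ys} → Chain u xs v → Chain v ys w → Chain u (xs ++ ys) w
  chain-++ [] refl c = c
  chain-++ (d ∷ xs) (eq , c) c′ = eq , chain-++ xs c c′

  chain-++⁻ : ∀ {u w} xs {ys} → Chain u (xs ++ ys) w → ∃ λ v → Chain u xs v × Chain v ys w
  chain-++⁻ [] c = _ , refl , c
  chain-++⁻ (d ∷ xs) (eq , c) with chain-++⁻ xs c
  ... | v , c₁ , c₂ = v , (eq , c₁) , c₂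

  -- Both sides list all vertices of the chain including its two ends. Paths are recorded by heads,
  -- while `vertices` of a walk lists tails.
  tails-heads : ∀ {u v} ds → Chain u ds v → u ∷ map head ds ≡ map tail ds ++ v ∷ []
  tails-heads [] refl = refl
  tails-heads (d ∷ ds) (refl , c) = cong (tail d ∷_) (tails-heads ds c)

  private
    -- The closing dart `z` is kept apart from the first dart `x` to make the induction possible;
    -- only its tail matters.
    linked : ∀ x ys z {w} → Chain (head x) ys w → tail z ≡ w →
             ∀ {a b} → (a , b) ∈ zip (x ∷ ys) (ys ++ z ∷ []) → head a ≡ tail b
    linked x [] z eq eq′ (here refl) = trans eq (sym eq′)
    linked x (y ∷ ys) z (eq , c) eq′ (here refl) = sym eq
    linked x (y ∷ ys) z (eq , c) eq′ (there p) = linked y ys z c eq′ p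

  reverseChain : ∀ {u v} ds → Chain u ds v → ∃ λ ds′ → Chain v ds′ u ×
                 map edge ds′ ≡ reverse (map edge ds) × v ∷ map head ds′ ≡ reverse (u ∷ map head ds)
  reverseChain [] refl = [] , refl , refl , refl
  reverseChain {u} {v} (d ∷ ds) (refl , c) with reverseChain ds c
  ... | ds′ , c′ , eqₑ , eqᵥ = ds′ ++ flip d ∷ [] , chain-++ ds′ c′ (tail-flip d , head-flip d)
      , trans (List.map-++ edge ds′ _)
          (trans (cong (_++ edge d ∷ []) eqₑ) (sym (List.unfold-reverse (edge d) (map edge ds))))
      , trans (cong (v ∷_) (List.map-++ head ds′ _)) (trans (cong₂ (λ xs y → xs ++ y ∷ []) eqᵥ (head-flip d))
          (sym (List.unfold-reverse (tail d) (head d ∷ map head ds))))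

  module Closed {u ds} (chain : Chain u ds u) where

    closed-linked : ∀ {a b} → (a , b) ∈ cyclicPairs ds → head a ≡ tail b
    closed-linked = go ds chain
      where
      go : ∀ ds → Chain u ds u → ∀ {a b} → (a , b) ∈ cyclicPairs ds → head a ≡ tail b
      go (x ∷ xs) (eq , c) = linked x xs x c eq

    head∈tails : ∀ {d} → d ∈ ds → head d ∈ map tail ds
    head∈tails d∈ with cyclicPairs-succ d∈
    ... | d′ , p = subst (_∈ map tail ds) (sym (closed-linked p)) (∈-map⁺ tail (cyclicPairs-∈₂ p))

    at∈tails : ∀ {d x} → d ∈ ds → At x (edge d) → x ∈ map tail ds
    at∈tails {d} d∈ x-at with at-dart d x-at
    ... | inj₁ refl = ∈-map⁺ tail d∈
    ... | inj₂ refl = head∈tails d∈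

    predecessor : ∀ {d} → d ∈ ds → ∃ λ d′ → (d′ , d) ∈ cyclicPairs ds × head d′ ≡ tail d
    predecessor d∈ with cyclicPairs-pred d∈
    ... | d′ , p = d′ , p , closed-linked p

    passage : ∀ {x} → x ∈ map tail ds → ∃₂ λ d d′ → (d , d′) ∈ cyclicPairs ds × head d ≡ x × tail d′ ≡ x
    passage x∈ with ∈-map⁻ tail x∈
    ... | d′ , d′∈ , refl with predecessor d′∈
    ...   | d , p , eq = d , d′ , p , eq , refl

  module Loopless (loopless : ∀ e → src e ≢ tgt e) where

    tail≢head : ∀ d → tail d ≢ head d
    tail≢head (e , true)  eq = loopless e eq
    tail≢head (e , false) eq = loopless e (sym eq)

    module Trail {u ds} (chain : Chain u ds u) (unique : Unique (map edge ds)) where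

      open Closed chain public

      unique-darts : Unique ds
      unique-darts = Unique.map⁻ unique

      edge-injective : ∀ {d d′} → d ∈ ds → d′ ∈ ds → edge d ≡ edge d′ → d ≡ d′
      edge-injective = unique-map-injective edge unique

      -- A trail has only one dart on each edge, and a dart that both enters and leaves `x` would be
      -- a loop.
      in≢out : ∀ {d d′ x} → d ∈ ds → d′ ∈ ds → head d ≡ x → tail d′ ≡ x → edge d ≢ edge d′
      in≢out {d} d∈ d′∈ refl eq e with edge-injective d∈ d′∈ e
      ... | refl = tail≢head d eq

      passage-≢ : ∀ {d d′} → (d , d′) ∈ cyclicPairs ds → edge d ≢ edge d′
      passage-≢ p = in≢out (cyclicPairs-∈₁ p) (cyclicPairs-∈₂ p) refl (sym (closed-linked p))

      module DegreeThree (_≟ₑ_ : DecidableEquality Edg) where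

        -- Two passages through x would use four different edges at x.
        passes-once : ∀ {x} star → length star ≤ 3 → (∀ {e} → At x e → e ∈ star) →
                      ∀ {d d′} → d ∈ ds → d′ ∈ ds → tail d ≡ x → tail d′ ≡ x → d ≡ d′
        passes-once {x} star ≤3 cover {d} {d′} d∈ d′∈ eq eq′ with edge d ≟ₑ edge d′
        ... | yes e = edge-injective d∈ d′∈ e
        ... | no d≢d′ with predecessor d∈ | predecessor d′∈
        ...   | p , pd , hp | p′ , pd′ , hp′ = ⊥-elim (ℕ.<⇒≱ (s≤s ≤3) (unique-⊆-length four inStar))
          where
          p∈ : p ∈ ds
          p∈ = cyclicPairs-∈₁ pd
          p′∈ : p′ ∈ ds
          p′∈ = cyclicPairs-∈₁ pd′
          hpx : head p ≡ x
          hpx = trans hp eq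
          hpx′ : head p′ ≡ x
          hpx′ = trans hp′ eq′
          p≢p′ : edge p ≢ edge p′
          p≢p′ e with edge-injective p∈ p′∈ e
          ... | refl = d≢d′ (cong edge (cyclicPairs-succ-unique unique-darts pd pd′))
          four : Unique (edge p ∷ edge p′ ∷ edge d ∷ edge d′ ∷ [])
          four = (p≢p′ ∷ in≢out p∈ d∈ hpx eq ∷ in≢out p∈ d′∈ hpx eq′ ∷ [])
               ∷ (in≢out p′∈ d∈ hpx′ eq ∷ in≢out p′∈ d′∈ hpx′ eq′ ∷ [])
               ∷ (d≢d′ ∷ []) ∷ [] ∷ []
          inStar : ∀ {e} → e ∈ edge p ∷ edge p′ ∷ edge d ∷ edge d′ ∷ [] → e ∈ star
          inStar (here refl) = cover (head-at p hpx)
          inStar (there (here refl)) = cover (head-at p′ hpx′)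
          inStar (there (there (here refl))) = cover (tail-at d eq)
          inStar (there (there (there (here refl)))) = cover (tail-at d′ eq′)

        unique-tails : (star : ∀ x → ∃ λ l → length l ≤ 3 × (∀ {e} → At x e → e ∈ l)) → Unique (map tail ds)
        unique-tails star = unique-map-on tail
          (λ {d} {d′} d∈ d′∈ eq → let l , ≤3 , cover = star (tail d) in passes-once l ≤3 cover d∈ d′∈ refl (sym eq))
          unique-darts

      -- A dart leaving `x` must be `d′`, because tails are distinct; a dart entering `x` is
      -- followed by one leaving it, that is by `d′`, and so it is `d`.
      edges-at : Unique (map tail ds) → ∀ {d d′ x} → (d , d′) ∈ cyclicPairs ds → head d ≡ x → tail d′ ≡ x →
                 ∀ {d″} → d″ ∈ ds → At x (edge d″) → d″ ≡ d ⊎ d″ ≡ d′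
      edges-at ut {d} {d′} p hd td′ {d″} d″∈ x-at with at-dart d″ x-at
      ... | inj₁ eq = inj₂ (unique-map-injective tail ut d″∈ (cyclicPairs-∈₂ p) (trans eq (sym td′)))
      ... | inj₂ eq with cyclicPairs-succ d″∈
      ...   | d‴ , q = inj₁ (cyclicPairs-pred-unique unique-darts
                (subst (λ z → (d″ , z) ∈ cyclicPairs ds)
                  (unique-map-injective tail ut (cyclicPairs-∈₂ q) (cyclicPairs-∈₂ p)
                      (trans (sym (closed-linked q)) (trans eq (sym td′)))) q) p)

  -- Both translations of trails have this shape: a cyclic sequence is replaced by chains between
  -- the points attached to its members. The chains may be empty, so a point need not be the start
  -- of its own chain.
  module Expansion {X : Set} (pt : X → Vtx) (piece : X × X → List Dart) where

    private
      Pieces : List (X × X) → Set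
      Pieces ps = ∀ {a b} → (a , b) ∈ ps → Chain (pt a) (piece (a , b)) (pt b)

    expand : ∀ x ys z → Pieces (zip (x ∷ ys) (ys ++ z ∷ [])) →
             Chain (pt x) (concatMap piece (zip (x ∷ ys) (ys ++ z ∷ []))) (pt z)
    expand x [] z ok = chain-++ (piece (x , z)) (ok (here refl)) refl
    expand x (y ∷ ys) z ok = chain-++ (piece (x , y)) (ok (here refl)) (expand y ys z (ok ∘ there))

    expand-split : ∀ x ys z → Pieces (zip (x ∷ ys) (ys ++ z ∷ [])) → ∀ {a} → a ∈ x ∷ ys →
                   ∃₂ λ ps qs → concatMap piece (zip (x ∷ ys) (ys ++ z ∷ [])) ≡ ps ++ qs
                              × Chain (pt x) ps (pt a) × Chain (pt a) qs (pt z)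
    expand-split x ys z ok (here refl) = [] , _ , refl , refl , expand x ys z ok
    expand-split x (y ∷ ys) z ok (there a∈) with expand-split y ys z (ok ∘ there) a∈
    ... | ps , qs , eq , c₁ , c₂ = piece (x , y) ++ ps , qs
      , trans (cong (piece (x , y) ++_) eq) (sym (List.++-assoc (piece (x , y)) ps qs))
      , chain-++ (piece (x , y)) (ok (here refl)) c₁ , c₂

    private
      -- If no dart follows `v`, the chain closes there, and its first dart starts at `v`.
      closed-visits : ∀ {u v} ps qs → Chain u ps v → Chain v qs u → ps ++ qs ≢ [] → v ∈ map tail (ps ++ qs)
      closed-visits ps (q ∷ qs) c (refl , _) _ rewrite List.map-++ tail ps (q ∷ qs) = ∈-++⁺ʳ (map tail ps) (here refl)
      closed-visits [] [] c c′ ne = ⊥-elim (ne refl)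
      closed-visits (p ∷ ps) [] (eq , c) c′ _ = here (trans c′ (sym eq))

    module _ {x xs} (ok : Pieces (cyclicPairs (x ∷ xs))) where

      expand-closed : Chain (pt x) (concatMap piece (cyclicPairs (x ∷ xs))) (pt x)
      expand-closed = expand x xs x ok

      point-visited : concatMap piece (cyclicPairs (x ∷ xs)) ≢ [] → ∀ {a} → a ∈ x ∷ xs →
                      pt a ∈ map tail (concatMap piece (cyclicPairs (x ∷ xs)))
      point-visited ne a∈ with expand-split x xs x ok a∈
      ... | ps , qs , eq , c₁ , c₂ rewrite eq = closed-visits ps qs c₁ c₂ ne

      point-constant : concatMap piece (cyclicPairs (x ∷ xs)) ≡ [] → ∀ {a} → a ∈ x ∷ xs → pt a ≡ pt x
      point-constant empty a∈ with expand-split x xs x ok a∈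
      ... | [] , qs , eq , pt≡ , _ = sym pt≡
      ... | p ∷ ps , qs , eq , _ , _ = case trans (sym empty) eq of λ ()

unique-concatMap : {A B : Set} (f : A → List B) {xs : List A} → Unique xs →
  (∀ {x} → x ∈ xs → Unique (f x)) →
  (∀ {x y b} → x ∈ xs → y ∈ xs → b ∈ f x → b ∈ f y → x ≡ y) → Unique (concatMap f xs)
unique-concatMap f [] _ _ = []
unique-concatMap f {x ∷ xs} (x∉ ∷ u) each apart =
  Unique.++⁺ (each (here refl)) (unique-concatMap f u (each ∘ there) (λ p q → apart (there p) (there q)))
    λ { (b∈ , b∈′) → case ∈-concat⁻′ (map f xs) b∈′ of λ { (ys , b∈ys , ys∈) → case ∈-map⁻ f ys∈ of λ { (y , y∈ , refl) →
        All.lookup x∉ y∈ (apart (here refl) (there y∈) b∈ b∈ys) } } }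

∈-concatMap⁺ : {A B : Set} (f : A → List B) {xs : List A} {x : A} {b : B} → x ∈ xs → b ∈ f x → b ∈ concatMap f xs
∈-concatMap⁺ f x∈ b∈ = ∈-concat⁺′ b∈ (∈-map⁺ f x∈)

map-concatMap : {A B C : Set} (g : B → C) (f : A → List B) → ∀ xs → map g (concatMap f xs) ≡ concatMap (map g ∘ f) xs
map-concatMap g f [] = refl
map-concatMap g f (x ∷ xs) = trans (List.map-++ g (f x) (concatMap f xs)) (cong (map g (f x) ++_) (map-concatMap g f xs))

-- Walks of a graph as chains of darts, and decidable reachability

module GraphDarts (G : Graph) where

  open Darts (end₁ G) (end₂ G) public
  open Loopless (loopless G) public

  ∈-star⁺ : ∀ {v e} → Incident G v e → e ∈ₛ E[_] G v
  ∈-star⁺ {v} = ∈-fromDecidable⁺ (incident? G v)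

  ∈-star⁻ : ∀ {v e} → e ∈ₛ E[_] G v → Incident G v e
  ∈-star⁻ {v} = ∈-fromDecidable⁻ (incident? G v)

  degree-star : ∀ v → ∃ λ l → length l ≡ degree G v × Unique l × (∀ {e} → Incident G v e → e ∈ l)
      × (∀ {e} → e ∈ l → Incident G v e)
  degree-star v with ∣∣-enumerated (E[_] G v)
  ... | l , len , u , to , from = l , len , u , (λ i → to (∈-star⁺ i)) , λ p → ∈-star⁻ (from p)

  degree-≡ : ∀ {v} l → Unique l → (∀ {e} → e ∈ l → Incident G v e) → (∀ {e} → Incident G v e → e ∈ l) → degree G v ≡ length l
  degree-≡ l u from to = ∣∣≡length u (λ p → ∈-star⁺ (from p)) λ p → to (∈-star⁻ p)

  joins-dart : ∀ {e u v} → Joins G e u v → ∃ λ d → edge d ≡ e × tail d ≡ u × head d ≡ v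
  joins-dart {e} (inj₁ refl) = (e , true) , refl , refl , refl
  joins-dart {e} (inj₂ refl) = (e , false) , refl , refl , refl

  dart-joins : ∀ d → Joins G (edge d) (tail d) (head d)
  dart-joins (e , true)  = inj₁ refl
  dart-joins (e , false) = inj₂ refl

  walk-chain : ∀ {H : Subgraph G} {u v} (w : Walk H u v) → ∃ λ ds → Chain u ds v × map edge ds ≡ edges w
      × map tail ds ≡ vertices w × All (E H ∘ edge) ds
  walk-chain [] = [] , refl , refl , refl , []
  walk-chain (step e ok j w) with joins-dart j | walk-chain w
  ... | d , refl , refl , refl | ds , c , eqₑ , eqᵥ , oks = d ∷ ds , (refl , c) , cong (edge d ∷_) eqₑ
      , cong (tail d ∷_) eqᵥ , ok ∷ oks

  chain-walk : ∀ {H : Subgraph G} {u v} ds → Chain u ds v → All (E H ∘ edge) ds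
      → Σ (Walk H u v) λ w → edges w ≡ map edge ds × vertices w ≡ map tail ds
  chain-walk [] refl [] = [] , refl , refl
  chain-walk (d ∷ ds) (refl , c) (ok ∷ oks) with chain-walk ds c oks
  ... | w , eqₑ , eqᵥ = step (edge d) ok (dart-joins d) w , cong (edge d ∷_) eqₑ , cong (tail d ∷_) eqᵥ

  module _ {H : Subgraph G} where

    walk-++ : ∀ {u v w} → Walk H u v → Walk H v w → Walk H u w
    walk-++ [] q = q
    walk-++ (step e ok j p) q = step e ok j (walk-++ p q)

    joins-sym : ∀ {e u v} → Joins G e u v → Joins G e v u
    joins-sym (inj₁ eq) = inj₂ eq
    joins-sym (inj₂ eq) = inj₁ eq

    walk-reverse : ∀ {u v} → Walk H u v → Walk H v u
    walk-reverse [] = []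
    walk-reverse (step e ok j p) = walk-++ (walk-reverse p) (step e ok (joins-sym j) [])

    walk-along : ∀ {e u v} → E H e → Incident G u e → Incident G v e → Walk H u v
    walk-along ok (inj₁ refl) (inj₁ refl) = []
    walk-along {e} ok (inj₁ refl) (inj₂ refl) = step e ok (inj₁ refl) []
    walk-along {e} ok (inj₂ refl) (inj₁ refl) = step e ok (inj₂ refl) []
    walk-along ok (inj₂ refl) (inj₂ refl) = []

    walk-invariant : (P : Vertex G → Set) → (∀ {e u v} → E H e → Joins G e u v → P u → P v) → ∀ {u v} → Walk H u v
        → P u → P v
    walk-invariant P next [] p = p
    walk-invariant P next (step e ok j w) p = walk-invariant P next w (next ok j p)

  walk-mono : ∀ {H K : Subgraph G} → (∀ {e} → E H e → E K e) → ∀ {u v} → Walk H u v → Walk K u v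
  walk-mono f [] = []
  walk-mono f (step e ok j w) = step e (f ok) j (walk-mono f w)

  -- Adding one edge e: a walk either avoids e or splits at its first and last use of e.
  Reach : List (Edge G) → Vertex G → Vertex G → Set
  Reach [] u v = u ≡ v
  Reach (e ∷ es) u v = Reach es u v ⊎ (Reach es u (end₁ G e) × Reach es (end₂ G e) v) ⊎ (Reach es u (end₂ G e)
      × Reach es (end₁ G e) v)

  reach? : ∀ es u v → Dec (Reach es u v)
  reach? [] u v = u Fin.≟ v
  reach? (e ∷ es) u v = reach? es u v ⊎-dec
      ((reach? es u (end₁ G e) ×-dec reach? es (end₂ G e) v) ⊎-dec (reach? es u (end₂ G e) ×-dec reach? es (end₁ G e) v))

  reach-refl : ∀ es {v} → Reach es v v
  reach-refl [] = refl
  reach-refl (e ∷ es) = inj₁ (reach-refl es)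

  reach-step : ∀ es {e u v w} → e ∈ es → Joins G e u v → Reach es v w → Reach es u w
  reach-step (e ∷ es) (here refl) (inj₁ refl) (inj₁ r) = inj₂ (inj₁ (reach-refl es , r))
  reach-step (e ∷ es) (here refl) (inj₁ refl) (inj₂ (inj₁ (_ , r))) = inj₂ (inj₁ (reach-refl es , r))
  reach-step (e ∷ es) (here refl) (inj₁ refl) (inj₂ (inj₂ (_ , r))) = inj₁ r
  reach-step (e ∷ es) (here refl) (inj₂ refl) (inj₁ r) = inj₂ (inj₂ (reach-refl es , r))
  reach-step (e ∷ es) (here refl) (inj₂ refl) (inj₂ (inj₁ (_ , r))) = inj₁ r
  reach-step (e ∷ es) (here refl) (inj₂ refl) (inj₂ (inj₂ (_ , r))) = inj₂ (inj₂ (reach-refl es , r))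
  reach-step (e ∷ es) (there p) j (inj₁ r) = inj₁ (reach-step es p j r)
  reach-step (e ∷ es) (there p) j (inj₂ (inj₁ (r , r′))) = inj₂ (inj₁ (reach-step es p j r , r′))
  reach-step (e ∷ es) (there p) j (inj₂ (inj₂ (r , r′))) = inj₂ (inj₂ (reach-step es p j r , r′))

  module _ {H : Subgraph G} where

    reach-walk : ∀ es → (∀ {e} → e ∈ es → E H e) → ∀ {u v} → Reach es u v → Walk H u v
    reach-walk [] ok refl = []
    reach-walk (e ∷ es) ok (inj₁ r) = reach-walk es (ok ∘ there) r
    reach-walk (e ∷ es) ok (inj₂ (inj₁ (r , r′))) =
      walk-++ (reach-walk es (ok ∘ there) r) (step e (ok (here refl)) (inj₁ refl) (reach-walk es (ok ∘ there) r′))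
    reach-walk (e ∷ es) ok (inj₂ (inj₂ (r , r′))) =
      walk-++ (reach-walk es (ok ∘ there) r) (step e (ok (here refl)) (inj₂ refl) (reach-walk es (ok ∘ there) r′))

    walk-reach : ∀ es → (∀ {e} → E H e → e ∈ es) → ∀ {u v} → Walk H u v → Reach es u v
    walk-reach es all [] = reach-refl es
    walk-reach es all (step e ok j w) = reach-step es (all ok) j (walk-reach es all w)

    walk? : Decidable (E H) → ∀ u v → Dec (Walk H u v)
    walk? E? u v = map′ (reach-walk es (λ p → proj₂ (∈-filter⁻ E? {xs = allFin _} p)))
        (walk-reach es (∈-filter⁺ E? (∈-allFin _))) (reach? es u v)
      where
      es : List (Edge G)
      es = filter E? (allFin _)

-- The contracted port graph

-- `CyclicallyEdgeConnected` speaks only of an attained minimum. By induction on the size, a cut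
-- smaller than a counterexample would already have four edges; so a counterexample is itself
-- minimum, and its size is bounded by the hypothesis.
four≤cyclic-cut : (G : Graph) → CyclicallyEdgeConnected G 4 → ∀ F → IsCyclicEdgeCut G F → 4 ≤ ∣ F ∣
four≤cyclic-cut G (_ , λc≥4) F cut = go (ℕ.<-wellFounded ∣ F ∣) F refl cut
  where
  go : ∀ {n} → ℕ.Acc _<_ n → ∀ F → ∣ F ∣ ≡ n → IsCyclicEdgeCut G F → 4 ≤ n
  go {n} (ℕ.acc rec) F refl cut = decidable-stable (4 ℕ.≤? n) λ n≱4 →
    n≱4 (λc≥4 n ((F , cut , refl) , λ F′ cut′ → case ∣ F′ ∣ ℕ.<? n of λ
      { (yes lt) → ⊥-elim (n≱4 (ℕ.≤-trans (go (rec lt) F′ refl cut′) (ℕ.<⇒≤ lt)))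
      ; (no ≮)  → ℕ.≮⇒≥ ≮ }))

∃-decidable : {A : Set} {xs : List A} → (∀ a → a ∈ xs) → {P : A → Set} → Decidable P → Dec (∃ P)
∃-decidable {xs = xs} all P? = map′ (λ p → let a , _ , q = find p in a , q) (λ (a , q) → lose (all a) q) (any? P? xs)

module Ports (H : Graph) (T : TransitionSystem H) where

  private
    module H = GraphDarts H

  -- Splitting v into the ports (v , false) and (v , true), joined by an edge inj₁ v and
  -- carrying the two transitions of v, turns H into a cubic graph.
  Port : Set
  Port = Vertex H × Bool

  Link : Set
  Link = Vertex H ⊎ Edge H

  transition : Port → Subset (∣E∣ H)
  transition (v , false) = P₁ (T v)
  transition (v , true)  = P₂ (T v)

  abstract
   -- Defaults to `false` for an edge that is not incident with `v`; the facts about `port` below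
   -- are stated for incident edges.
   side : Vertex H → Edge H → Bool
   side v e = does (e Subset.∈? P₂ (T v))

  port : Vertex H → Edge H → Port
  port v e = v , side v e

  ∣transition∣ : ∀ x → ∣ transition x ∣ ≡ 2
  ∣transition∣ (v , false) = size₁ (T v)
  ∣transition∣ (v , true)  = size₂ (T v)

  transition-incident : ∀ x {e} → e ∈ₛ transition x → Incident H (proj₁ x) e
  transition-incident (v , false) e∈ = H.∈-star⁻ (subst (_ ∈ₛ_) (cover (T v)) (Subset.x∈p∪q⁺ (inj₁ e∈)))
  transition-incident (v , true)  e∈ = H.∈-star⁻ (subst (_ ∈ₛ_) (cover (T v)) (Subset.x∈p∪q⁺ (inj₂ e∈)))

  abstract
   port-transition : ∀ {v e} → Incident H v e → e ∈ₛ transition (port v e)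
   port-transition {v} {e} inc with e Subset.∈? P₂ (T v)
   ... | yes e∈ = e∈
   ... | no  e∉ with Subset.x∈p∪q⁻ (P₁ (T v)) (P₂ (T v)) (subst (e ∈ₛ_) (sym (cover (T v))) (H.∈-star⁺ inc))
   ...   | inj₁ e∈ = e∈
   ...   | inj₂ e∈ = ⊥-elim (e∉ e∈)

   transition-port : ∀ {v b e} → e ∈ₛ transition (v , b) → port v e ≡ (v , b)
   transition-port {v} {false} {e} e∈ with e Subset.∈? P₂ (T v)
   ... | yes e∈′ = ⊥-elim (disjoint (T v) (e , Subset.x∈p∩q⁺ (e∈ , e∈′)))
   ... | no _    = refl
   transition-port {v} {true} {e} e∈ with e Subset.∈? P₂ (T v)
   ... | yes _   = refl
   ... | no e∉   = ⊥-elim (e∉ e∈)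

  src tgt : Link → Port
  src (inj₁ v) = v , false
  src (inj₂ e) = port (end₁ H e) e
  tgt (inj₁ v) = v , true
  tgt (inj₂ e) = port (end₂ H e) e

  src≢tgt : ∀ k → src k ≢ tgt k
  src≢tgt (inj₁ v) ()
  src≢tgt (inj₂ e) eq = loopless H e (cong proj₁ eq)

  module K = Darts src tgt
  open K using (At) public

  _≟ₚ_ : DecidableEquality Port
  _≟ₚ_ = Product.≡-dec Fin._≟_ Bool._≟_

  _≟ₖ_ : DecidableEquality Link
  _≟ₖ_ = Sum.≡-dec Fin._≟_ Fin._≟_

  at? : ∀ x k → Dec (At x k)
  at? x k = (x ≟ₚ src k) ⊎-dec (x ≟ₚ tgt k)

  at-transition : ∀ {x e} → At x (inj₂ e) → e ∈ₛ transition x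
  at-transition (inj₁ refl) = port-transition (inj₁ refl)
  at-transition (inj₂ refl) = port-transition (inj₂ refl)

  at-incident : ∀ {x e} → At x (inj₂ e) → Incident H (proj₁ x) e
  at-incident {x} a = transition-incident x (at-transition a)

  transition-at : ∀ {x e} → e ∈ₛ transition x → At x (inj₂ e)
  transition-at {x} e∈ with transition-incident x e∈
  ... | inj₁ refl = inj₁ (sym (transition-port e∈))
  ... | inj₂ refl = inj₂ (sym (transition-port e∈))

  incident-at : ∀ {v e} → Incident H v e → At (port v e) (inj₂ e)
  incident-at inc = transition-at (port-transition inc)

  at-vertex : ∀ {x v} → At x (inj₁ v) → proj₁ x ≡ v
  at-vertex (inj₁ refl) = refl
  at-vertex (inj₂ refl) = refl

  at-own : ∀ x → At x (inj₁ (proj₁ x))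
  at-own (v , false) = inj₁ refl
  at-own (v , true)  = inj₂ refl

  -- The two transitions of a vertex are disjoint, so an edge of `H` meets only one of its ports.
  at-same-vertex : ∀ {x y e} → At x (inj₂ e) → At y (inj₂ e) → proj₁ x ≡ proj₁ y → x ≡ y
  at-same-vertex a a′ refl = trans (sym (transition-port (at-transition a))) (transition-port (at-transition a′))

  at-two : ∀ {x y z} k → At x k → At y k → At z k → x ≢ y → x ≢ z → y ≡ z
  at-two _ (inj₁ p) (inj₁ q) _ x≢y _ = ⊥-elim (x≢y (trans p (sym q)))
  at-two _ (inj₁ p) (inj₂ q) (inj₁ r) _ x≢z = ⊥-elim (x≢z (trans p (sym r)))
  at-two _ (inj₁ p) (inj₂ q) (inj₂ r) _ _ = trans q (sym r)
  at-two _ (inj₂ p) (inj₂ q) _ x≢y _ = ⊥-elim (x≢y (trans p (sym q)))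
  at-two _ (inj₂ p) (inj₁ q) (inj₂ r) _ x≢z = ⊥-elim (x≢z (trans p (sym r)))
  at-two _ (inj₂ p) (inj₁ q) (inj₁ r) _ _ = trans q (sym r)

  other-end : ∀ {x} k → At x k → ∃ λ y → At y k × x ≢ y
  other-end k (inj₁ refl) = tgt k , inj₂ refl , src≢tgt k
  other-end k (inj₂ refl) = src k , inj₁ refl , src≢tgt k ∘ sym

  port-edges : ∀ x → ∃₂ λ a b → a ≢ b × At x (inj₂ a) × At x (inj₂ b) × (∀ {e} → At x (inj₂ e) → e ≡ a ⊎ e ≡ b)
  port-edges x with two-elements (transition x) (∣transition∣ x)
  ... | a , b , a≢b , a∈ , b∈ , only = a , b , a≢b , transition-at a∈ , transition-at b∈ , only ∘ at-transition

  at-third : ∀ {x a b e} → a ≢ b → At x (inj₂ a) → At x (inj₂ b) → At x (inj₂ e) → e ≡ a ⊎ e ≡ b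
  at-third {x} a≢b p q r with port-edges x
  ... | _ , _ , _ , _ , _ , only with only p | only q | only r
  ... | inj₁ refl | inj₁ refl | _ = ⊥-elim (a≢b refl)
  ... | inj₂ refl | inj₂ refl | _ = ⊥-elim (a≢b refl)
  ... | inj₁ refl | inj₂ refl | s = s
  ... | inj₂ refl | inj₁ refl | inj₁ s = inj₂ s
  ... | inj₂ refl | inj₁ refl | inj₂ s = inj₁ s

  port-star : ∀ x → ∃ λ l → length l ≤ 3 × (∀ {k} → At x k → k ∈ l)
  port-star x with port-edges x
  ... | a , b , _ , _ , _ , only = inj₁ (proj₁ x) ∷ inj₂ a ∷ inj₂ b ∷ [] , ℕ.≤-refl
      , λ { {inj₁ v} p → here (cong inj₁ (sym (at-vertex p)))
          ; {inj₂ e} p → case only p of λ { (inj₁ refl) → there (here refl) ; (inj₂ refl) → there (there (here refl)) } }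

  -- Adjacency along edges of `H`, without the own links `inj₁ v`. A port lies on just the two edges
  -- of its transition, so it has at most two neighbours in this sense.
  _~_ : Port → Port → Set
  x ~ y = ∃ λ e → At x (inj₂ e) × At y (inj₂ e) × x ≢ y

  ~-sym : ∀ {x y} → x ~ y → y ~ x
  ~-sym (e , p , q , ne) = e , q , p , ne ∘ sym

  ~-≢ : ∀ {x y} → x ~ y → x ≢ y
  ~-≢ (_ , _ , _ , ne) = ne

  ~-vertex : ∀ {x y} → x ~ y → proj₁ x ≢ proj₁ y
  ~-vertex (e , p , q , ne) eq = ne (at-same-vertex p q eq)

  ~-two : ∀ {x y z w} → x ~ y → x ~ z → x ~ w → y ≢ z → w ≡ y ⊎ w ≡ z
  ~-two (e , p , p′ , n) (f , q , q′ , n′) (g , r , r′ , n″) y≢z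
    with at-third (λ { refl → y≢z (at-two (inj₂ _) p p′ q′ n n′) }) p q r
  ... | inj₁ refl = inj₁ (at-two (inj₂ e) p r′ p′ n″ n)
  ... | inj₂ refl = inj₂ (at-two (inj₂ f) q r′ q′ n″ n′)

  Triangle : Port → Port → Port → Set
  Triangle x y z = x ~ y × x ~ z × y ~ z

  _≈_ : Port → Port → Set
  x ≈ y = x ≡ y ⊎ ∃ (Triangle x y)

  ≈-refl : ∀ {x} → x ≈ x
  ≈-refl = inj₁ refl

  ≈-sym : ∀ {x y} → x ≈ y → y ≈ x
  ≈-sym (inj₁ eq) = inj₁ (sym eq)
  ≈-sym (inj₂ (z , p , q , r)) = inj₂ (z , ~-sym p , r , q)

  -- Since a port has at most two neighbours, triangles with a common port have the same three
  -- ports.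
  ≈-trans : ∀ {x y w} → x ≈ y → y ≈ w → x ≈ w
  ≈-trans (inj₁ refl) q = q
  ≈-trans p@(inj₂ _) (inj₁ refl) = p
  ≈-trans (inj₂ (z , xy , xz , yz)) (inj₂ (_ , yw , _)) with ~-two (~-sym xy) yz yw (~-≢ xz)
  ... | inj₁ refl = inj₁ refl
  ... | inj₂ refl = inj₂ (_ , xz , xy , ~-sym yz)

  triangle-class : ∀ {x y z w} → Triangle x y z → x ≈ w → w ≡ x ⊎ w ≡ y ⊎ w ≡ z
  triangle-class _ (inj₁ refl) = inj₁ refl
  triangle-class (xy , xz , yz) (inj₂ (_ , xw , _)) = inj₂ (~-two xy xz xw (~-≢ yz))

  bools : List Bool
  bools = false ∷ true ∷ []

  allPorts : List Port
  allPorts = cartesianProduct (allFin (∣V∣ H)) bools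

  ∈-allPorts : ∀ x → x ∈ allPorts
  ∈-allPorts (v , false) = ∈-cartesianProduct⁺ (∈-allFin v) (here refl)
  ∈-allPorts (v , true)  = ∈-cartesianProduct⁺ (∈-allFin v) (there (here refl))

  allPorts-unique : Unique allPorts
  allPorts-unique = Unique.cartesianProduct⁺ (Unique.allFin⁺ (∣V∣ H)) (((λ ()) ∷ []) ∷ [] ∷ [])

  allLinks : List Link
  allLinks = map inj₁ (allFin (∣V∣ H)) ++ map inj₂ (allFin (∣E∣ H))

  ∈-allLinks : ∀ k → k ∈ allLinks
  ∈-allLinks (inj₁ v) = ∈-++⁺ˡ (∈-map⁺ inj₁ (∈-allFin v))
  ∈-allLinks (inj₂ e) = ∈-++⁺ʳ (map inj₁ (allFin (∣V∣ H))) (∈-map⁺ inj₂ (∈-allFin e))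

  allLinks-unique : Unique allLinks
  allLinks-unique = Unique.++⁺ (Unique.map⁺ Sum.inj₁-injective (Unique.allFin⁺ _))
      (Unique.map⁺ Sum.inj₂-injective (Unique.allFin⁺ _))
    λ (p , q) → case ∈-map⁻ inj₁ p , ∈-map⁻ inj₂ q of λ { ((_ , _ , refl) , (_ , _ , ())) }

  _~?_ : ∀ x y → Dec (x ~ y)
  x ~? y = Fin.any? λ e → at? x (inj₂ e) ×-dec (at? y (inj₂ e) ×-dec ¬? (x ≟ₚ y))

  triangle? : ∀ x y → Dec (∃ (Triangle x y))
  triangle? x y = ∃-decidable ∈-allPorts λ z → (x ~? y) ×-dec ((x ~? z) ×-dec (y ~? z))

  _≈?_ : ∀ x y → Dec (x ≈ y)
  x ≈? y = (x ≟ₚ y) ⊎-dec triangle? x y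

  ends≈ : ∀ {x y} k → At x k → At y k → x ≢ y → x ≈ y → src k ≈ tgt k
  ends≈ _ (inj₁ refl) (inj₁ refl) ne _ = ⊥-elim (ne refl)
  ends≈ _ (inj₁ refl) (inj₂ refl) _ p = p
  ends≈ _ (inj₂ refl) (inj₁ refl) _ p = ≈-sym p
  ends≈ _ (inj₂ refl) (inj₂ refl) ne _ = ⊥-elim (ne refl)

  -- At a port of a triangle both edges of `H` lead to the other two ports, hence are contracted. A
  -- port on an edge that survives is therefore alone in its class.
  outer-singleton : ∀ {x y e} → At x (inj₂ e) → ¬ (src (inj₂ e) ≈ tgt (inj₂ e)) → x ≈ y → x ≡ y
  outer-singleton _ _ (inj₁ eq) = eq
  outer-singleton {e = e} a outer (inj₂ (z , xy , xz , yz)) with other-end (inj₂ e) a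
  ... | w , a′ , x≢w with ~-two xy xz (e , a , a′ , x≢w) (~-≢ yz)
  ...   | inj₁ refl = ⊥-elim (outer (ends≈ (inj₂ e) a a′ x≢w (inj₂ (z , xy , xz , yz))))
  ...   | inj₂ refl = ⊥-elim (outer (ends≈ (inj₂ e) a a′ x≢w (inj₂ (_ , xz , xy , ~-sym yz))))

  own-links-≢ : ∀ v → ¬ ((v , false) ≈ (v , true))
  own-links-≢ v (inj₂ (_ , p , _)) = ~-vertex p refl

  private module Rep = Representative ∈-allPorts _≈?_ ≈-refl ≈-sym ≈-trans

  abstract
   rep : Port → Port
   rep = Rep.rep

   rep-≈ : ∀ x → x ≈ rep x
   rep-≈ = Rep.rep-≈

   rep-≡ : ∀ {x y} → x ≈ y → rep x ≡ rep y
   rep-≡ = Rep.rep-≡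

  rep-idem : ∀ x → rep (rep x) ≡ rep x
  rep-idem x = sym (rep-≡ (rep-≈ x))

  abstract
   reps : Enumeration (λ x → rep x ≡ x)
   reps = enumerate allPorts-unique ∈-allPorts (λ x → rep x ≟ₚ x)

  module Reps = Enumeration reps

  class : Port → Fin Reps.size
  class x = Reps.indexOf (rep x) (rep-idem x)

  class-≡ : ∀ {x y} → x ≈ y → class x ≡ class y
  class-≡ p = Reps.indexOf-cong _ _ (rep-≡ p)

  class-≈ : ∀ {x y} → class x ≡ class y → x ≈ y
  class-≈ {x} {y} eq = ≈-trans (rep-≈ x)
      (≈-trans (inj₁ (Reps.indexOf-injective (rep-idem x) (rep-idem y) eq)) (≈-sym (rep-≈ y)))

  class-at : ∀ c → class (Reps.at c) ≡ c
  class-at c = Reps.at-injective (trans (Reps.at-indexOf _ _) (Reps.at-sound c))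

  abstract
   outers : Enumeration (λ k → class (src k) ≢ class (tgt k))
   outers = enumerate allLinks-unique ∈-allLinks (λ k → ¬? (class (src k) Fin.≟ class (tgt k)))

  module Outers = Enumeration outers

  contracted : Graph
  contracted = record
    { ∣V∣ = Reps.size
    ; ∣E∣ = Outers.size
    ; ends = λ g → class (src (Outers.at g)) , class (tgt (Outers.at g))
    ; loopless = Outers.at-sound
    }

  module C = GraphDarts contracted

  own : Vertex H → Edge contracted
  own v = Outers.indexOf (inj₁ v) (own-links-≢ v ∘ class-≈)

  at-outer : ∀ {x y} k → At x k → At y k → class x ≢ class y → class (src k) ≢ class (tgt k)
  at-outer _ (inj₁ refl) (inj₁ refl) ne = ⊥-elim (ne refl)
  at-outer _ (inj₁ refl) (inj₂ refl) ne = ne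
  at-outer _ (inj₂ refl) (inj₁ refl) ne = ne ∘ sym
  at-outer _ (inj₂ refl) (inj₂ refl) ne = ⊥-elim (ne refl)

  incident-class : ∀ {c g} → Incident contracted c g → ∃ λ x → class x ≡ c × At x (Outers.at g)
  incident-class (inj₁ refl) = _ , refl , inj₁ refl
  incident-class (inj₂ refl) = _ , refl , inj₂ refl

  class-incident : ∀ {x g} → At x (Outers.at g) → Incident contracted (class x) g
  class-incident (inj₁ refl) = inj₁ refl
  class-incident (inj₂ refl) = inj₂ refl

  raise : C.Dart → K.Dart
  raise (g , b) = Outers.at g , b

  tail-raise : ∀ d → C.tail d ≡ class (K.tail (raise d))
  tail-raise (g , true)  = refl
  tail-raise (g , false) = refl

  head-raise : ∀ d → C.head d ≡ class (K.head (raise d))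
  head-raise (g , true)  = refl
  head-raise (g , false) = refl

  outer-≉ : ∀ {g e} → Outers.at g ≡ inj₂ e → ¬ (src (inj₂ e) ≈ tgt (inj₂ e))
  outer-≉ {g} eq p = subst (λ k → class (src k) ≢ class (tgt k)) eq (Outers.at-sound g) (class-≡ p)

  contracted-degree : ∀ {c} ks → Unique ks → (∀ {k} → k ∈ ks → class (src k) ≢ class (tgt k)) →
    (∀ {k} → k ∈ ks → ∃ λ x → class x ≡ c × At x k) →
    (∀ {k} → class (src k) ≢ class (tgt k) → (∃ λ x → class x ≡ c × At x k) → k ∈ ks) →
    degree contracted c ≡ length ks
  contracted-degree {c} ks u outer inc complete with C.degree-star c
  ... | gs , len , gs-unique , to-gs , from-gs = trans (sym len) (trans (sym (List.length-map Outers.at gs)) (ℕ.≤-antisym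
      (unique-⊆-length (Unique.map⁺ Outers.at-injective gs-unique) to)
      (unique-⊆-length u from)))
    where
    to : ∀ {k} → k ∈ map Outers.at gs → k ∈ ks
    to p with ∈-map⁻ Outers.at p
    ... | g , g∈ , refl = complete (Outers.at-sound g) (incident-class {c} {g} (from-gs g∈))
    from : ∀ {k} → k ∈ ks → k ∈ map Outers.at gs
    from {k} k∈ with inc k∈ | Outers.at-indexOf k (outer k∈)
    ... | x , refl , a | eq = subst (_∈ map Outers.at gs) eq (∈-map⁺ Outers.at
      (to-gs (class-incident {x} {Outers.indexOf k (outer k∈)} (subst (At x) (sym eq) a))))

  -- A contracted triangle keeps the own links of its three ports; a port that is alone keeps its
  -- own link and the two edges of its transition.
  contracted-cubic : Cubic contracted
  contracted-cubic c with ∃-decidable ∈-allPorts (triangle? (Reps.at c))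
  ... | yes (y , z , t@(ry , rz , yz)) = contracted-degree (inj₁ (proj₁ r) ∷ inj₁ (proj₁ y) ∷ inj₁ (proj₁ z) ∷ [])
      (((λ { eq → ~-vertex ry (Sum.inj₁-injective eq) }) ∷ (λ { eq → ~-vertex rz (Sum.inj₁-injective eq) }) ∷ [])
        ∷ ((λ { eq → ~-vertex yz (Sum.inj₁-injective eq) }) ∷ []) ∷ [] ∷ [])
      (λ { (here refl) → own-links-≢ _ ∘ class-≈ ; (there (here refl)) → own-links-≢ _ ∘ class-≈
         ; (there (there (here refl))) → own-links-≢ _ ∘ class-≈ })
      (λ { (here refl) → r , class-at c , at-own r
         ; (there (here refl)) → y , trans (class-≡ (≈-sym r≈y)) (class-at c) , at-own y
         ; (there (there (here refl))) → z , trans (class-≡ (≈-sym r≈z)) (class-at c) , at-own z })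
      complete
    where
    r : Port
    r = Reps.at c
    r≈y : r ≈ y
    r≈y = inj₂ (z , t)
    r≈z : r ≈ z
    r≈z = inj₂ (y , rz , ry , ~-sym yz)
    complete : ∀ {k} → class (src k) ≢ class (tgt k) → (∃ λ x → class x ≡ c × At x k)
        → k ∈ inj₁ (proj₁ r) ∷ inj₁ (proj₁ y) ∷ inj₁ (proj₁ z) ∷ []
    -- A surviving edge of `H` at this class would make the class a singleton, although it contains
    -- both `r` and `y`.
    complete {inj₂ e} outer (x , eq , a) = ⊥-elim (~-≢ ry (trans (sym (single r x≈r)) (single y (≈-trans x≈r r≈y))))
      where
      x≈r : x ≈ r
      x≈r = class-≈ (trans eq (sym (class-at c)))
      single : ∀ w → x ≈ w → x ≡ w
      single w = outer-singleton a (outer ∘ class-≡)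
    complete {inj₁ v} outer (x , eq , a) with at-vertex a | triangle-class t (class-≈ (trans (class-at c) (sym eq)))
    ... | refl | inj₁ refl = here refl
    ... | refl | inj₂ (inj₁ refl) = there (here refl)
    ... | refl | inj₂ (inj₂ refl) = there (there (here refl))
  ... | no none with port-edges (Reps.at c)
  ...   | a , b , a≢b , a-at , b-at , only = contracted-degree (inj₁ (proj₁ r) ∷ inj₂ a ∷ inj₂ b ∷ [])
      (((λ ()) ∷ (λ ()) ∷ []) ∷ ((λ eq → a≢b (Sum.inj₂-injective eq)) ∷ []) ∷ [] ∷ [])
      (λ { (here refl) → own-links-≢ _ ∘ class-≈ ; (there (here refl)) → outer a-at ;
          (there (there (here refl))) → outer b-at })
      (λ { (here refl) → r , class-at c , at-own r ; (there (here refl)) → r , class-at c , a-at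
         ; (there (there (here refl))) → r , class-at c , b-at })
      complete
    where
    r : Port
    r = Reps.at c
    single : ∀ {x} → r ≈ x → r ≡ x
    single (inj₁ eq) = eq
    single (inj₂ t) = ⊥-elim (none (_ , t))
    outer : ∀ {e} → At r (inj₂ e) → class (src (inj₂ e)) ≢ class (tgt (inj₂ e))
    outer {e} at with other-end (inj₂ _) at
    ... | w , at′ , r≢w = at-outer (inj₂ _) at at′ (r≢w ∘ single ∘ class-≈)
    complete : ∀ {k} → class (src k) ≢ class (tgt k) → (∃ λ x → class x ≡ c × At x k)
        → k ∈ inj₁ (proj₁ r) ∷ inj₂ a ∷ inj₂ b ∷ []
    complete {k} _ (x , eq , at) with single (class-≈ (trans (class-at c) (sym eq)))
    complete {inj₁ v} _ (x , eq , at) | refl = here (cong inj₁ (sym (at-vertex at)))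
    complete {inj₂ e} _ (x , eq , at) | refl with only at
    ... | inj₁ refl = there (here refl)
    ... | inj₂ refl = there (there (here refl))

  module _ {S : Subgraph contracted} where

    -- The condition on edges is vacuous for a link inside a class, whose two end classes coincide,
    -- so that the empty walk will do.
    link-walk : ∀ {x y} k → At x k → At y k → (∀ g → Outers.at g ≡ k → E S g) → Walk S (class x) (class y)
    link-walk {x} {y} k p q ok with class (src k) Fin.≟ class (tgt k)
    ... | no outer = C.walk-along (ok g eq) (class-incident (subst (At x) (sym eq) p))
        (class-incident (subst (At y) (sym eq) q))
      where
      g : Edge contracted
      g = Outers.indexOf k outer
      eq : Outers.at g ≡ k
      eq = Outers.at-indexOf k outer
    ... | yes same = subst (Walk S (class x)) (trans (collapse p) (sym (collapse q))) []
      where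
      collapse : ∀ {x} → At x k → class x ≡ class (tgt k)
      collapse (inj₁ refl) = same
      collapse (inj₂ refl) = refl

  contracted-connected : Connected (whole H) → Connected (whole contracted)
  contracted-connected ((v , _) , walk) = (class (v , false) , tt) , λ c c′ _ _ →
    let p = Reps.at c ; q = Reps.at c′ in
    subst (λ z → Walk (whole contracted) z c′) (class-at c) (subst (Walk (whole contracted) (class p)) (class-at c′)
      (lift (walk (proj₁ p) (proj₁ q) tt tt) refl refl))
    where
    within : ∀ {x y} → proj₁ x ≡ proj₁ y → Walk (whole contracted) (class x) (class y)
    within {x} {y} refl = link-walk (inj₁ _) (at-own x) (at-own y) (λ _ _ → tt)
    lift : ∀ {u w} → Walk (whole H) u w → ∀ {x y} → proj₁ x ≡ u → proj₁ y ≡ w → Walk (whole contracted) (class x) (class y)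
    lift [] refl eq = within (sym eq)
    lift (step {u} {v} e _ j w) {x} {y} refl eq = C.walk-++ (within refl) (C.walk-++ (across j) (lift w refl eq))
      where
      across : Joins H e u v → Walk (whole contracted) (class (port u e)) (class (port v e))
      across (inj₁ refl) = link-walk (inj₂ e) (inj₁ refl) (inj₂ refl) (λ _ _ → tt)
      across (inj₂ refl) = link-walk (inj₂ e) (inj₂ refl) (inj₁ refl) (λ _ _ → tt)

-- Small cuts of the contracted port graph

fresh : ∀ {n} (l : List (Fin n)) → length l < n → ∃ λ v → v ∉ l
fresh {n} l lt with Fin.any? (λ v → ¬? (any? (v Fin.≟_) l))
... | yes found = found
... | no none   = ⊥-elim (ℕ.<⇒≱ lt (subst (_≤ length l) (List.length-tabulate {n = n} id)
      (unique-⊆-length (Unique.allFin⁺ n) λ {v} _ → decidable-stable (any? (v Fin.≟_) l) λ v∉ → none (v , v∉))))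

two-ends : (G : Graph) → ∀ {x y z e} → Incident G x e → Incident G y e → Incident G z e → x ≢ y → x ≢ z → y ≡ z
two-ends G (inj₁ p) (inj₁ q) _ x≢y _ = ⊥-elim (x≢y (trans p (sym q)))
two-ends G (inj₁ p) (inj₂ q) (inj₁ r) _ x≢z = ⊥-elim (x≢z (trans p (sym r)))
two-ends G (inj₁ p) (inj₂ q) (inj₂ r) _ _ = trans q (sym r)
two-ends G (inj₂ p) (inj₂ q) _ x≢y _ = ⊥-elim (x≢y (trans p (sym q)))
two-ends G (inj₂ p) (inj₁ q) (inj₂ r) _ x≢z = ⊥-elim (x≢z (trans p (sym r)))
two-ends G (inj₂ p) (inj₁ q) (inj₁ r) _ _ = trans q (sym r)

joins-incident : (G : Graph) → ∀ {e u v} → Joins G e u v → Incident G u e × Incident G v e × u ≢ v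
joins-incident G {e} (inj₁ refl) = inj₁ refl , inj₂ refl , loopless G e
joins-incident G {e} (inj₂ refl) = inj₂ refl , inj₁ refl , loopless G e ∘ sym

component-connected : (G : Graph) (S : Subgraph G) → ∀ {u} → V S u → Connected (component S u)
component-connected G S {u} u∈ = (u , u∈ , [])
    , λ a b (_ , ua) (_ , ub) → GD.walk-++ (GD.walk-reverse (inside-component [] ua)) (inside-component [] ub)
  where
  module GD = GraphDarts G
  inside-component : ∀ {a b} → Walk S u a → Walk S a b → Walk (component S u) a b
  inside-component _ [] = []
  inside-component {a} ua (step {v = c} e ok j w) = step e (ok , ends-reached j) j (inside-component uc w)
    where
    uc : Walk S u c
    uc = GD.walk-++ ua (step e ok j [])
    ends-reached : Joins G e a c → Walk S u (end₁ G e) × Walk S u (end₂ G e)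
    ends-reached (inj₁ refl) = ua , uc
    ends-reached (inj₂ refl) = uc , ua

module FourConnected (H : Graph) (regular : Regular 4 H) (connected : KConnected H 4) where

  private
    module H = GraphDarts H

  -- Separation is phrased by an invariant, so that no component has to be described. The list may
  -- contain repetitions, as `fromList` has at most `length l` members.
  no-separator : ∀ l → length l < 4 → (P : Vertex H → Set) →
    (∀ {e u v} → Joins H e u v → u ∉ l → v ∉ l → P u → P v) →
    ∀ {p q} → p ∉ l → q ∉ l → P p → P q
  no-separator l l<4 P next {p} {q} p∉ q∉ = H.walk-invariant P allowed
      (proj₂ (proj₂ connected (fromList l) (ℕ.≤-<-trans (∣fromList∣≤length l) l<4)) p q (tt , p∉ ∘ ∈-fromList⁻) (tt
      , q∉ ∘ ∈-fromList⁻))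
    where
    allowed : ∀ {e u v} → E (deleteVertices H (fromList l)) e → Joins H e u v → P u → P v
    allowed (_ , e₁ , e₂) j@(inj₁ refl) = next j (e₁ ∘ ∈-fromList⁺) (e₂ ∘ ∈-fromList⁺)
    allowed (_ , e₁ , e₂) j@(inj₂ refl) = next j (e₂ ∘ ∈-fromList⁺) (e₁ ∘ ∈-fromList⁺)

  whole-connected : Connected (whole H)
  whole-connected with fresh {∣V∣ H} [] (ℕ.≤-trans (s≤s z≤n) (proj₁ connected))
  ... | v , _ = (v , tt) , λ a b _ _ → H.walk-mono (λ _ → tt)
      (proj₂ (proj₂ connected (fromList []) (ℕ.≤-<-trans (∣fromList∣≤length {∣V∣ H} []) (s≤s z≤n))) a b (tt
          , λ p → case ∈-fromList⁻ {l = []} p of λ ()) (tt , λ p → case ∈-fromList⁻ {l = []} p of λ ()))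

  -- For `p` not on `e` the value is `end₁ H e`, which still differs from `p`; this keeps `far-≢`
  -- free of an incidence hypothesis.
  far : Vertex H → Edge H → Vertex H
  far p e with p Fin.≟ end₁ H e
  ... | yes _ = end₂ H e
  ... | no  _ = end₁ H e

  far-≢ : ∀ p e → far p e ≢ p
  far-≢ p e eq with p Fin.≟ end₁ H e
  ... | yes refl = loopless H e (sym eq)
  ... | no ne    = ne (sym eq)

  far-≡ : ∀ {p q e} → Incident H p e → Incident H q e → p ≢ q → q ≡ far p e
  far-≡ {p} {q} {e} p-inc q-inc p≢q with p Fin.≟ end₁ H e
  ... | yes eq = two-ends H {e = e} p-inc q-inc (inj₂ refl) p≢q λ eq′ → loopless H e (trans (sym eq) eq′)
  ... | no ne  = two-ends H {e = e} p-inc q-inc (inj₁ refl) p≢q ne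

  -- Parallel edges would leave p with at most three neighbours, and these separate p from the rest.
  no-parallel : ∀ {p q e f} → p ≢ q → e ≢ f → Incident H p e → Incident H q e → Incident H p f → Incident H q f → ⊥
  no-parallel {p} {q} {e} {f} p≢q e≢f pe qe pf qf with H.degree-star p
  ... | star , len , _ , to , from with ∈-∃++ (to pf)
  -- Besides `p` and the three far ends there is a fifth vertex `r`. The invariant `_≡ p` cannot be
  -- passed on outside `l`, yet 4-connectivity carries it to `r`.
  ...   | as , bs , refl = case fresh (p ∷ l) (ℕ.≤-<-trans (ℕ.≤-reflexive (cong suc l≡3)) (proj₁ connected)) of λ
      (r , r∉) → r∉ (here (no-separator l (s≤s (ℕ.≤-reflexive l≡3)) (_≡ p)
        (λ { j u∉ v∉ refl → let u-inc , v-inc , u≢v = joins-incident H j in ⊥-elim (v∉ (neighbour u-inc v-inc u≢v)) })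
        (λ p∈ → case ∈-map⁻ (far p) p∈ of λ (e , _ , eq) → far-≢ p e (sym eq)) (r∉ ∘ there) refl))
    where
    l : List (Vertex H)
    l = map (far p) (as ++ bs)
    l≡3 : length l ≡ 3
    l≡3 = trans (List.length-map (far p) (as ++ bs))
            (ℕ.suc-injective (trans (sym (List.length-++-sucʳ as f bs)) (trans len (regular p))))
    e∈ : e ∈ as ++ bs
    e∈ with ∈-++⁻ as (to pe)
    ... | inj₁ e∈as = ∈-++⁺ˡ e∈as
    ... | inj₂ (here eq) = ⊥-elim (e≢f eq)
    ... | inj₂ (there e∈bs) = ∈-++⁺ʳ as e∈bs
    neighbour : ∀ {v g} → Incident H p g → Incident H v g → p ≢ v → v ∈ l
    neighbour {v} {g} pg vg p≢v with ∈-++⁻ as (to pg) | far-≡ pg vg p≢v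
    ... | inj₁ g∈ | refl = ∈-map⁺ (far p) (∈-++⁺ˡ g∈)
    ... | inj₂ (there g∈) | refl = ∈-map⁺ (far p) (∈-++⁺ʳ as g∈)
    -- The entry of `f` has been removed from the star, but its far end `q` is still listed through
    -- `e`.
    ... | inj₂ (here refl) | refl = subst (_∈ l) (trans (sym (far-≡ pe qe p≢q)) (far-≡ pf qf p≢q)) (∈-map⁺ (far p) e∈)

  module SmallCuts (T : TransitionSystem H) where

    open Ports H T

    -- An arbitrary union `S` of classes with boundary in `F`, so that the argument applies to a
    -- component and to its complement alike.
    module Sides (F : Subset (∣E∣ contracted)) (F<4 : ∣ F ∣ < 4)
      (S : Port → Set) (S? : Decidable S) (S-resp : ∀ {x y} → x ≈ y → S x → S y)
      (crossing : ∀ k {x y} → At x k → At y k → S x → ¬ S y → ∃ λ g → Outers.at g ≡ k × g ∈ₛ F) where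

      Interior : Vertex H → Set
      Interior v = S (v , false) × S (v , true)

      interior? : Decidable Interior
      interior? v = S? (v , false) ×-dec S? (v , true)

      interior-two : ∀ {x y} → proj₁ x ≡ proj₁ y → x ≢ y → S x → S y → Interior (proj₁ x)
      interior-two {v , false} {_ , true} refl _ s s′ = s , s′
      interior-two {v , true} {_ , false} refl _ s s′ = s′ , s
      interior-two {v , false} {_ , false} refl ne _ _ = ⊥-elim (ne refl)
      interior-two {v , true} {_ , true} refl ne _ _ = ⊥-elim (ne refl)

      own-crossing : ∀ x → S x → ¬ Interior (proj₁ x) → own (proj₁ x) ∈ₛ F
      own-crossing x s not-interior with other-end (inj₁ (proj₁ x)) (at-own x)
      ... | y , y-at , x≢y with crossing (inj₁ (proj₁ x)) (at-own x) y-at s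
          (λ s′ → not-interior (interior-two (sym (at-vertex y-at)) x≢y s s′))
      ...   | g , eq , g∈ = subst (_∈ₛ F) (Outers.at-injective (trans eq (sym (Outers.at-indexOf _ _)))) g∈

      module _ {c D} (chain : C.Chain c D c) (unique : Unique (map C.edge D)) (unique-tails : Unique (map C.tail D))
        (inS : ∀ {d} → d ∈ D → S (K.tail (raise d)) × S (K.head (raise d))) (none : ∀ v → ¬ Interior v) where

        open C.Trail chain unique

        data IsH (d : C.Dart) : Set where
          isH : ∀ e b → raise d ≡ (inj₂ e , b) → IsH d

        no-own : ∀ {d} → d ∈ D → IsH d
        no-own {g , b} d∈ with Outers.at g in eq
        no-own {g , b} d∈ | inj₂ e = isH e b (cong (_, b) eq)
        no-own {g , b} d∈ | inj₁ v with subst (λ k → S (K.tail (k , b)) × S (K.head (k , b))) eq (inS d∈)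
        no-own {g , true}  d∈ | inj₁ v | s , s′ = ⊥-elim (none v (s , s′))
        no-own {g , false} d∈ | inj₁ v | s , s′ = ⊥-elim (none v (s′ , s))

        raise-~ : ∀ {d} → d ∈ D → K.tail (raise d) ~ K.head (raise d)
        raise-~ {d} d∈ with no-own d∈
        ... | isH e b eq = subst (λ d → K.tail d ~ K.head d) (sym eq)
              (e , K.tail-at (inj₂ e , b) refl , K.head-at (inj₂ e , b) refl , K.Loopless.tail≢head src≢tgt (inj₂ e , b))

        tail-single : ∀ {d} → d ∈ D → ∀ {y} → K.tail (raise d) ≈ y → K.tail (raise d) ≡ y
        tail-single {d} d∈ {y} with no-own d∈
        ... | isH e b eq = subst (λ d → K.tail d ≈ y → K.tail d ≡ y) (sym eq)
              (outer-singleton (K.tail-at (inj₂ e , b) refl) (outer-≉ {proj₁ d} (cong proj₁ eq)))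

        -- Without interior vertices the cycle has only edges coming from `H`; the ports on it are
        -- then alone in their classes, and it is already a cycle of the uncontracted port graph.
        raise-linked : ∀ {d d′} → (d , d′) ∈ cyclicPairs D → K.tail (raise d′) ≡ K.head (raise d)
        raise-linked {d} {d′} p = tail-single (cyclicPairs-∈₂ p)
          (class-≈ (trans (sym (tail-raise d′)) (trans (sym (closed-linked p)) (head-raise d))))

        -- The own link at each port of the cycle leaves `S` and is thus in `F`. These links are
        -- distinct, because a vertex with both ports on the cycle would be interior.
        short : length D < 4
        short = ℕ.≤-<-trans (subst (_≤ ∣ F ∣) (List.length-map f D) (length≤∣∣ f-unique f∈)) F<4
          where
          f : C.Dart → Edge contracted
          f d = own (proj₁ (K.tail (raise d)))
          f-unique : Unique (map f D)
          f-unique = unique-map-on f (λ {d} {d′} d∈ d′∈ eq →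
            unique-map-injective C.tail unique-tails d∈ d′∈ (trans (tail-raise d) (trans
              (cong class (decidable-stable (K.tail (raise d) ≟ₚ K.tail (raise d′))
                λ ne → none _ (interior-two (Sum.inj₁-injective (Outers.indexOf-injective _ _ eq)) ne
                    (proj₁ (inS d∈)) (proj₁ (inS d′∈)))))
              (sym (tail-raise d′))))) unique-darts
          f∈ : ∀ {g} → g ∈ map f D → g ∈ₛ F
          f∈ p with ∈-map⁻ f p
          ... | d , d∈ , refl = own-crossing _ (proj₁ (inS d∈)) (none _)

      cycle-interior : ∀ {c D} → C.Chain c D c → D ≢ [] → Unique (map C.edge D) → Unique (map C.tail D) →
        (∀ {d} → d ∈ D → S (K.tail (raise d)) × S (K.head (raise d))) → ∃ Interior
      cycle-interior {D = D} chain D≢[] unique ut inS with Fin.any? interior?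
      ... | yes found = found
      ... | no none = ⊥-elim (bad D chain D≢[] unique ut inS)
        where
        none′ : ∀ v → ¬ Interior v
        none′ v i = none (v , i)
        -- Length one is a loop, length two a pair of parallel edges of `H`, length three a triangle
        -- whose ports form a single class, and all greater lengths contradict `short`.
        bad : ∀ {c} D → C.Chain c D c → D ≢ [] → Unique (map C.edge D) → Unique (map C.tail D) →
              (∀ {d} → d ∈ D → S (K.tail (raise d)) × S (K.head (raise d))) → ⊥
        bad [] _ ne _ _ _ = ne refl
        bad (d ∷ []) ch _ u _ _ = C.tail≢head d (sym (C.Closed.closed-linked ch {d} {d} (here refl)))
        bad (d₁ ∷ d₂ ∷ []) ch _ u ut inS
          with no-own ch u ut inS none′ (here refl) | no-own ch u ut inS none′ (there (here refl))
             | raise-linked ch u ut inS none′ (here refl) | raise-linked ch u ut inS none′ (there (here refl))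
        ... | isH e b eq | isH f b′ eq′ | l₁ | l₂ rewrite eq | eq′ =
          no-parallel (~-vertex (e , K.tail-at (inj₂ e , b) refl , K.head-at (inj₂ e , b) refl
              , K.Loopless.tail≢head src≢tgt (inj₂ e , b)))
            (λ { refl → All.head (AllPairs.head u) (Outers.at-injective (trans (cong proj₁ eq) (sym (cong proj₁ eq′)))) })
            (at-incident (K.tail-at (inj₂ e , b) refl)) (at-incident (K.head-at (inj₂ e , b) refl))
            (at-incident (K.head-at (inj₂ f , b′) (sym l₂))) (at-incident (K.tail-at (inj₂ f , b′) l₁))
        bad (d₁ ∷ d₂ ∷ d₃ ∷ []) ch _ u ut inS = C.tail≢head d₁ (trans (tail-raise d₁) (trans
            (class-≡ (inj₂ (K.head (raise d₂) , raise~ (here refl) , subst (_~ K.head (raise d₂)) l₃ (~-sym last) , second)))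
            (sym (head-raise d₁))))
          where
          raise~ : ∀ {d} → d ∈ d₁ ∷ d₂ ∷ d₃ ∷ [] → K.tail (raise d) ~ K.head (raise d)
          raise~ = raise-~ ch u ut inS none′
          l₁ : K.tail (raise d₂) ≡ K.head (raise d₁)
          l₁ = raise-linked ch u ut inS none′ (here refl)
          l₂ : K.tail (raise d₃) ≡ K.head (raise d₂)
          l₂ = raise-linked ch u ut inS none′ (there (here refl))
          l₃ : K.head (raise d₃) ≡ K.tail (raise d₁)
          l₃ = sym (raise-linked ch u ut inS none′ (there (there (here refl))))
          second : K.head (raise d₁) ~ K.head (raise d₂)
          second = subst (_~ K.head (raise d₂)) l₁ (raise~ (there (here refl)))
          last : K.head (raise d₂) ~ K.head (raise d₃)
          last = subst (_~ K.head (raise d₃)) l₂ (raise~ (there (there (here refl))))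
        bad (d₁ ∷ d₂ ∷ d₃ ∷ d₄ ∷ ds) ch _ u ut inS = case short ch u ut inS none′ of λ { (s≤s (s≤s (s≤s (s≤s ())))) }

module _ (H : Graph) (regular : Regular 4 H) (connected : KConnected H 4) (T : TransitionSystem H) where

  private
    module H = GraphDarts H

  open Ports H T
  open FourConnected H regular connected
  open SmallCuts T

  module Separation (F : Subset (∣E∣ contracted)) (F<4 : ∣ F ∣ < 4)
      (S : Port → Set) (S? : Decidable S) (S-resp : ∀ {x y} → x ≈ y → S x → S y)
      (crossing : ∀ k {x y} → At x k → At y k → S x → ¬ S y → ∃ λ g → Outers.at g ≡ k × g ∈ₛ F) where

    Inner Outer : Vertex H → Set
    Inner v = ∀ b → S (v , b)
    Outer v = ∀ b → ¬ S (v , b)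

    bool-all : {P : Bool → Set} → Decidable P → Dec (∀ b → P b)
    bool-all P? = map′ (λ { (f , t) false → f ; (f , t) true → t }) (λ f → f false , f true) (P? false ×-dec P? true)

    inner? : Decidable Inner
    inner? v = bool-all λ b → S? (v , b)

    outer? : Decidable Outer
    outer? v = bool-all λ b → ¬? (S? (v , b))

    inner≢outer : ∀ {p q} → Inner p → Outer q → p ≢ q
    inner≢outer i o refl = o true (i true)

    Adjacent : Vertex H → Vertex H → Set
    Adjacent p q = ∃ λ e → Incident H p e × Incident H q e

    adjacent? : ∀ p q → Dec (Adjacent p q)
    adjacent? p q = Fin.any? λ e → incident? H p e ×-dec incident? H q e

    mixed-crossing : ∀ {v} → ¬ Inner v → ¬ Outer v → ∃ λ g → Outers.at g ≡ inj₁ v × g ∈ₛ F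
    mixed-crossing {v} ¬i ¬o with S? (v , false) | S? (v , true)
    ... | yes s | yes s′ = ⊥-elim (¬i λ { false → s ; true → s′ })
    ... | yes s | no ¬s′ = crossing (inj₁ v) (inj₁ refl) (inj₂ refl) s ¬s′
    ... | no ¬s | yes s′ = crossing (inj₁ v) (inj₂ refl) (inj₁ refl) s′ ¬s
    ... | no ¬s | no ¬s′ = ⊥-elim (¬o λ { false → ¬s ; true → ¬s′ })

    module _ {p₀ q₀} (p₀-inner : Inner p₀) (q₀-outer : Outer q₀) where

      data Witness (v : Vertex H) : Link → Set where
        inner-edge : Inner v → ∀ {e} → Incident H v e → Incident H q₀ e → Witness v (inj₂ e)
        outer-edge : Outer v → ∀ {e} → Incident H p₀ e → Incident H v e → Witness v (inj₂ e)
        own-link   : Witness v (inj₁ v)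

      -- An edge between an inner and an outer vertex can witness both of its ends only if it joins
      -- `p₀` to `q₀`. Leaving out `p₀` removes this one collision.
      witness-injective : ∀ {v w k} → v ≢ p₀ → w ≢ p₀ → Witness v k → Witness w k → v ≡ w
      witness-injective {v} {w} _ _ (inner-edge i {e} p q) (inner-edge i′ p′ _) =
        two-ends H {e = e} q p p′ (inner≢outer i q₀-outer ∘ sym) (inner≢outer i′ q₀-outer ∘ sym)
      witness-injective v≢ w≢ (outer-edge _ {e} p q) (outer-edge _ _ q′) = two-ends H {e = e} p q q′ (v≢ ∘ sym) (w≢ ∘ sym)
      witness-injective v≢ w≢ (inner-edge i {e} p q) (outer-edge o p′ q′) =
        ⊥-elim (v≢ (two-ends H {e = e} q p p′ (inner≢outer i q₀-outer ∘ sym) (inner≢outer p₀-inner q₀-outer ∘ sym)))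
      witness-injective v≢ w≢ (outer-edge o {e} p q) (inner-edge i p′ q′) =
        ⊥-elim (w≢ (two-ends H {e = e} q′ p′ p (inner≢outer i q₀-outer ∘ sym) (inner≢outer p₀-inner q₀-outer ∘ sym)))
      witness-injective _ _ own-link own-link = refl

      -- If all inner vertices were adjacent to all outer ones, every vertex other than p₀ would have
      -- its own link in F, which has fewer than |V(H)| - 1 elements.
      nonadjacent-pair : ∃₂ λ p q → Inner p × Outer q × ¬ Adjacent p q
      nonadjacent-pair with Fin.any? (λ p → Fin.any? λ q → inner? p ×-dec (outer? q ×-dec ¬? (adjacent? p q)))
      ... | yes found = found
      ... | no none = ⊥-elim (ℕ.<⇒≱ (proj₁ connected) (ℕ.≤-trans V≤ (s≤s (ℕ.≤-trans l≤F (ℕ.≤-pred F<4)))))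
        where
        adjacent : ∀ {p q} → Inner p → Outer q → Adjacent p q
        adjacent {p} {q} i o = decidable-stable (adjacent? p q) λ ¬adj → none (p , q , i , o , ¬adj)
        cross : ∀ v → ∃ λ g → g ∈ₛ F × Witness v (Outers.at g)
        cross v with inner? v | outer? v
        ... | yes i | _ = let e , p , q = adjacent i q₀-outer
                              g , eq , g∈ = crossing (inj₂ e) (incident-at p) (incident-at q) (i _) (q₀-outer _)
                          in g , g∈ , subst (Witness v) (sym eq) (inner-edge i p q)
        ... | no _ | yes o = let e , p , q = adjacent p₀-inner o
                                 g , eq , g∈ = crossing (inj₂ e) (incident-at p) (incident-at q) (p₀-inner _) (o _)
                             in g , g∈ , subst (Witness v) (sym eq) (outer-edge o p q)
        ... | no ¬i | no ¬o = let g , eq , g∈ = mixed-crossing ¬i ¬o in g , g∈ , subst (Witness v) (sym eq) own-link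
        ≢p₀? : Decidable (_≢ p₀)
        ≢p₀? v = ¬? (v Fin.≟ p₀)
        l : List (Vertex H)
        l = filter ≢p₀? (allFin _)
        V≤ : ∣V∣ H ≤ suc (length l)
        V≤ = subst (_≤ suc (length l)) (List.length-tabulate {n = ∣V∣ H} id)
            (unique-⊆-length {ys = p₀ ∷ l} (Unique.allFin⁺ (∣V∣ H)) covered)
          where
          covered : ∀ {v} → v ∈ allFin (∣V∣ H) → v ∈ p₀ ∷ l
          covered {v} _ with v Fin.≟ p₀
          ... | yes eq = here eq
          ... | no ne  = there (∈-filter⁺ ≢p₀? (∈-allFin v) ne)
        l-≢ : ∀ {v} → v ∈ l → v ≢ p₀
        l-≢ v∈ = proj₂ (∈-filter⁻ ≢p₀? {xs = allFin _} v∈)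
        l≤F : length l ≤ ∣ F ∣
        l≤F = subst (_≤ ∣ F ∣) (List.length-map (proj₁ ∘ cross) l) (length≤∣∣
          (unique-map-on (proj₁ ∘ cross) (λ {v} {w} v∈ w∈ eq → witness-injective (l-≢ v∈) (l-≢ w∈) (proj₂ (proj₂ (cross v)))
            (subst (Witness w ∘ Outers.at) (sym eq) (proj₂ (proj₂ (cross w))))) (Unique.filter⁺ ≢p₀? (Unique.allFin⁺ _)))
          λ g∈ → case ∈-map⁻ (proj₁ ∘ cross) g∈ of λ { (v , _ , refl) → proj₁ (proj₂ (cross v)) })

      -- Choosing for each crossing link an end other than p and q separates p from q in H.
      module _ {p q} (p-inner : Inner p) (q-outer : Outer q) (¬adjacent : ¬ Adjacent p q) where

        pick : Link → Vertex H
        pick k with (proj₁ (src k) Fin.≟ p) ⊎-dec (proj₁ (src k) Fin.≟ q)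
        ... | yes _ = proj₁ (tgt k)
        ... | no  _ = proj₁ (src k)

        Crosses : Link → Set
        Crosses k = (S (src k) × ¬ S (tgt k)) ⊎ (¬ S (src k) × S (tgt k))

        crosses? : Decidable Crosses
        crosses? k = (S? (src k) ×-dec ¬? (S? (tgt k))) ⊎-dec (¬? (S? (src k)) ×-dec S? (tgt k))

        pick-end : ∀ k → pick k ≡ proj₁ (src k) ⊎ pick k ≡ proj₁ (tgt k)
        pick-end k with (proj₁ (src k) Fin.≟ p) ⊎-dec (proj₁ (src k) Fin.≟ q)
        ... | yes _ = inj₂ refl
        ... | no  _ = inj₁ refl

        inner-not-crossed : ∀ {v} → Inner v → ¬ Crosses (inj₁ v)
        inner-not-crossed i (inj₁ (_ , ¬s)) = ¬s (i true)
        inner-not-crossed i (inj₂ (¬s , _)) = ¬s (i false)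

        outer-not-crossed : ∀ {v} → Outer v → ¬ Crosses (inj₁ v)
        outer-not-crossed o (inj₁ (s , _)) = o false s
        outer-not-crossed o (inj₂ (_ , s)) = o true s

        -- The own links of `p` and `q` do not cross, as both ports lie on one side, and no edge
        -- joins `p` to `q`. So a crossing link has at most one of its ends at `p` or `q`.
        pick-avoids : ∀ k → Crosses k → pick k ≢ p × pick k ≢ q
        pick-avoids k cr with (proj₁ (src k) Fin.≟ p) ⊎-dec (proj₁ (src k) Fin.≟ q)
        ... | no ne = ne ∘ inj₁ , ne ∘ inj₂
        pick-avoids (inj₁ v) cr | yes (inj₁ refl) = ⊥-elim (inner-not-crossed p-inner cr)
        pick-avoids (inj₁ v) cr | yes (inj₂ refl) = ⊥-elim (outer-not-crossed q-outer cr)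
        pick-avoids (inj₂ e) cr | yes (inj₁ eq) = (λ eq′ → loopless H e (trans eq (sym eq′)))
            , λ eq′ → ¬adjacent (e , inj₁ (sym eq) , inj₂ (sym eq′))
        pick-avoids (inj₂ e) cr | yes (inj₂ eq) = (λ eq′ → ¬adjacent (e , inj₂ (sym eq′) , inj₁ (sym eq)))
            , λ eq′ → loopless H e (trans eq (sym eq′))

        separator : List (Vertex H)
        separator = map (pick ∘ Outers.at) (filter (crosses? ∘ Outers.at) (elements F))

        separator<4 : length separator < 4
        separator<4 = ℕ.≤-<-trans (ℕ.≤-trans (ℕ.≤-reflexive (List.length-map _ (filter (crosses? ∘ Outers.at) (elements F))))
          (ℕ.≤-trans (List.length-filter (crosses? ∘ Outers.at) (elements F)) (ℕ.≤-reflexive (length-elements {S = F})))) F<4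

        crossed-∈ : ∀ k {x y} → At x k → At y k → S x → ¬ S y → pick k ∈ separator
        crossed-∈ k a a′ s ¬s with crossing k a a′ s ¬s
        ... | g , refl , g∈ = ∈-map⁺ (pick ∘ Outers.at) (∈-filter⁺ (crosses? ∘ Outers.at) (∈-elements⁺ g∈) (crosses a a′))
          where
          crosses : At _ k → At _ k → Crosses k
          crosses (inj₁ refl) (inj₁ refl) = ⊥-elim (¬s s)
          crosses (inj₁ refl) (inj₂ refl) = inj₁ (s , ¬s)
          crosses (inj₂ refl) (inj₁ refl) = inj₂ (¬s , s)
          crosses (inj₂ refl) (inj₂ refl) = ⊥-elim (¬s s)

        ∈-separator : ∀ {v} → v ∈ separator → v ≢ p × v ≢ q
        ∈-separator v∈ with ∈-map⁻ (pick ∘ Outers.at) v∈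
        ... | g , g∈ , refl = pick-avoids (Outers.at g) (proj₂ (∈-filter⁻ (crosses? ∘ Outers.at) {xs = elements F} g∈))

        -- If `v` is not inner, then either `e` crosses, or the port of `e` at `v` is still in `S`
        -- and the own link of `v` crosses. The end picked for the crossing link is `u` or `v`.
        inner-next : ∀ {e u v} → Joins H e u v → u ∉ separator → v ∉ separator → Inner u → Inner v
        inner-next {e} {u} {v} j u∉ v∉ i = decidable-stable (inner? v) λ ¬i → case joins-incident H j of λ
          (u-inc , v-inc , u≢v) → case S? (port v e) of λ
            { (no ¬s) → case pick-end (inj₂ e) of λ
                { (inj₁ eq) → hit u-inc v-inc u≢v (inj₁ refl)
                    (subst (_∈ separator) eq (crossed-∈ (inj₂ e) (incident-at u-inc) (incident-at v-inc) (i _) ¬s))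
                ; (inj₂ eq) → hit u-inc v-inc u≢v (inj₂ refl)
                    (subst (_∈ separator) eq (crossed-∈ (inj₂ e) (incident-at u-inc) (incident-at v-inc) (i _) ¬s)) }
            ; (yes s) → let g , eq , g∈ = mixed-crossing ¬i (λ o → o _ s)
                        in v∉ (own-∈ ¬i s) }
          where
          hit : Incident H u e → Incident H v e → u ≢ v → ∀ {w} → Incident H w e → w ∈ separator → ⊥
          hit u-inc v-inc u≢v {w} w-inc w∈ with u Fin.≟ w
          ... | yes refl = u∉ w∈
          ... | no u≢w   = v∉ (subst (_∈ separator) (two-ends H {e = e} u-inc w-inc v-inc u≢w u≢v) w∈)
          own-∈ : ∀ {x} → ¬ Inner v → S (v , x) → v ∈ separator
          own-∈ {x} ¬i s with S? (v , not x)
          own-∈ {x} ¬i s | no ¬s = subst (_∈ separator) ([ id , id ]′ (pick-end (inj₁ v)))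
            (crossed-∈ (inj₁ v) (at-own (v , x)) (at-own (v , not x)) s ¬s)
          own-∈ {false} ¬i s | yes s′ = ⊥-elim (¬i λ { false → s ; true → s′ })
          own-∈ {true}  ¬i s | yes s′ = ⊥-elim (¬i λ { true → s ; false → s′ })

        separated : ⊥
        separated = q-outer true (no-separator separator separator<4 Inner inner-next
          (λ p∈ → proj₁ (∈-separator p∈) refl) (λ q∈ → proj₂ (∈-separator q∈) refl) p-inner true)

      no-small-cut : ⊥
      no-small-cut = let p , q , i , o , ¬adj = nonadjacent-pair in separated i o ¬adj

  -- A connected component that is not a tree has a cycle only up to double negation. That suffices
  -- for the decidable conclusion, and membership of a port in the side `S` is decided by `walk?`.
  contracted-cyclic-cuts : ∀ F → IsCyclicEdgeCut contracted F → 4 ≤ ∣ F ∣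
  contracted-cyclic-cuts F (_ , u , v , ¬uv , ¬tree-u , ¬tree-v) = decidable-stable (4 ℕ.≤? ∣ F ∣) λ ¬4≤F →
    let F<4 = ℕ.≰⇒> ¬4≤F in
    ¬tree-u (component-connected contracted D tt , λ (_ , w , cycle) →
    ¬tree-v (component-connected contracted D tt , λ (_ , w′ , cycle′) →
      let _ , ch , D≢[] , eu , tu , within = cycle-chain w cycle
          _ , ch′ , D′≢[] , eu′ , tu′ , within′ = cycle-chain w′ cycle′
          p , p-in = Sides.cycle-interior F F<4 S S? S-resp crossing ch D≢[] eu tu within
          q , q-out = Sides.cycle-interior F F<4 (¬_ ∘ S) (¬? ∘ S?) (λ x≈y → _∘ S-resp (≈-sym x≈y))
            (λ k a a′ ¬s ¬¬s → crossing k a′ a (decidable-stable (S? _) ¬¬s) ¬s)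
            ch′ D′≢[] eu′ tu′ (λ d∈ → let a , b = within′ d∈ in (λ s → ¬uv (C.walk-++ s (C.walk-reverse a))) , λ s → ¬uv (C.walk-++ s (C.walk-reverse b)))
      in Separation.no-small-cut F F<4 S S? S-resp crossing
           {p} {q} (λ { false → proj₁ p-in ; true → proj₂ p-in }) (λ { false → proj₁ q-out ; true → proj₂ q-out })))
    where
    D : Subgraph contracted
    D = deleteEdges contracted F
    S : Port → Set
    S x = Walk D u (class x)
    S? : Decidable S
    S? x = C.walk? (λ e → ¬? (e Subset.∈? F)) u (class x)
    S-resp : ∀ {x y} → x ≈ y → S x → S y
    S-resp x≈y = subst (Walk D u) (class-≡ x≈y)
    crossing : ∀ k {x y} → At x k → At y k → S x → ¬ S y → ∃ λ g → Outers.at g ≡ k × g ∈ₛ F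
    crossing k {x} {y} a a′ s ¬s = g , at-g , decidable-stable (g Subset.∈? F) λ g∉ →
        ¬s (C.walk-++ s (link-walk k a a′ λ g′ eq → subst (_∉ₛ F) (Outers.at-injective (trans at-g (sym eq))) g∉))
      where
      outer : class (src k) ≢ class (tgt k)
      outer = at-outer k a a′ λ eq → ¬s (subst (Walk D u) eq s)
      g : Edge contracted
      g = Outers.indexOf k outer
      at-g : Outers.at g ≡ k
      at-g = Outers.at-indexOf k outer
    cycle-chain : ∀ {u c} (w : Walk (component D u) c c) → IsCycle w → ∃ λ ds → C.Chain c ds c × ds ≢ []
        × Unique (map C.edge ds)
      × Unique (map C.tail ds) × (∀ {d} → d ∈ ds → Walk D u (class (K.tail (raise d))) × Walk D u (class (K.head (raise d))))
    cycle-chain {u} w (ne , eu , vu) with C.walk-chain w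
    ... | ds , ch , eqₑ , eqᵥ , ok = ds , ch , (λ { refl → ne (sym eqₑ) }) , subst Unique (sym eqₑ) eu
        , subst Unique (sym eqᵥ) vu
        , λ {d} d∈ → both d (proj₂ (All.lookup ok d∈))
      where
      both : ∀ d → Walk D u (end₁ contracted (C.edge d)) × Walk D u (end₂ contracted (C.edge d))
          → Walk D u (class (K.tail (raise d))) × Walk D u (class (K.head (raise d)))
      both (_ , true)  (a , b) = a , b
      both (_ , false) (a , b) = b , a

  contracted-cyclically-4-connected : CyclicallyEdgeConnected contracted 4
  contracted-cyclically-4-connected = contracted-connected whole-connected ,
    λ { l ((F , cut , refl) , _) → contracted-cyclic-cuts F cut }

-- From dominating cycles to T-trails

module LiftTrail (H : Graph) (T : TransitionSystem H) where

  open Ports H T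

  private
    module H = GraphDarts H
    module KL = K.Loopless src≢tgt

  -- Between the ports x and y of one class, a lifted cycle goes through all ports of the class.
  data Connection (x : Port) : Port → List K.Dart → Set where
    stay   : Connection x x []
    around : ∀ {y z} d₁ d₂ → Triangle x y z → K.tail d₁ ≡ x → K.head d₁ ≡ z → K.tail d₂ ≡ z → K.head d₂ ≡ y →
             Connection x y (d₁ ∷ d₂ ∷ [])

  ~-dart : ∀ {x y} → x ~ y → ∃ λ d → K.tail d ≡ x × K.head d ≡ y
  ~-dart {x} {y} (e , p , q , x≢y) with K.at-out {e = inj₂ e} p
  ... | d , refl , tl = d , tl , sym (at-two (inj₂ e) p q (K.head-at d refl) x≢y (λ eq → KL.tail≢head d (trans tl eq)))

  -- Total, so that it can be used under `concatMap`: for ports of different classes the list is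
  -- empty and the promise vacuous.
  connect : ∀ x y → ∃ λ l → x ≈ y → Connection x y l
  connect x y with x ≟ₚ y | triangle? x y
  ... | yes refl | _ = [] , λ _ → stay
  ... | no x≢y | no none = [] , λ { (inj₁ eq) → ⊥-elim (x≢y eq) ; (inj₂ t) → ⊥-elim (none t) }
  ... | no _ | yes (z , t@(_ , xz , yz)) with ~-dart xz | ~-dart (~-sym yz)
  ...   | d₁ , t₁ , h₁ | d₂ , t₂ , h₂ = d₁ ∷ d₂ ∷ [] , λ _ → around d₁ d₂ t t₁ h₁ t₂ h₂

  connection-chain : ∀ {x y l} → Connection x y l → K.Chain x l y
  connection-chain stay = refl
  connection-chain (around d₁ d₂ _ t₁ h₁ t₂ h₂) = t₁ , trans t₂ (sym h₁) , h₂

  Inside : Vertex contracted → Link → Set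
  Inside c k = class (src k) ≡ c × class (tgt k) ≡ c

  inside-dart : ∀ {c} d → class (K.tail d) ≡ c → class (K.head d) ≡ c → Inside c (K.edge d)
  inside-dart (k , true)  p q = p , q
  inside-dart (k , false) p q = q , p

  connection-inside : ∀ {x y l} → Connection x y l → ∀ {k} → k ∈ map K.edge l → Inside (class x) k
  connection-inside {x} (around {y} {z} d₁ d₂ (xy , xz , yz) t₁ h₁ t₂ h₂) = λ
    { (here refl)         → inside-dart d₁ (cong class t₁) (trans (cong class h₁) z-class)
    ; (there (here refl)) → inside-dart d₂ (trans (cong class t₂) z-class) (trans (cong class h₂) y-class) }
    where
    y-class : class y ≡ class x
    y-class = class-≡ (≈-sym (inj₂ (z , xy , xz , yz)))
    z-class : class z ≡ class x
    z-class = class-≡ (≈-sym (inj₂ (y , xz , xy , ~-sym yz)))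

  connection-unique : ∀ {x y l} → Connection x y l → Unique (map K.edge l)
  connection-unique stay = []
  connection-unique (around d₁ d₂ (xy , xz , yz) t₁ h₁ t₂ h₂) =
    ((λ eq → ~-≢ xy (at-two (K.edge d₁) (K.head-at d₁ h₁) (K.tail-at d₁ t₁) (subst (At _) (sym eq) (K.head-at d₂ h₂))
      (~-≢ xz ∘ sym) (~-≢ yz ∘ sym))) ∷ []) ∷ [] ∷ []

  module Lift {c d₀ ds} (chain : C.Chain c (d₀ ∷ ds) c) (unique : Unique (map C.edge (d₀ ∷ ds)))
              (unique-tails : Unique (map C.tail (d₀ ∷ ds))) where

    open C.Trail {c} {d₀ ∷ ds} chain unique

    D : List C.Dart
    D = d₀ ∷ ds

    entry exit : C.Dart → Port
    entry d = K.head (raise d)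
    exit d = K.tail (raise d)

    -- The detour precedes the dart `d′`, so that pieces run from entry to entry and each outer dart
    -- belongs to exactly one piece.
    piece : C.Dart × C.Dart → List K.Dart
    piece (d , d′) = proj₁ (connect (entry d) (exit d′)) ++ raise d′ ∷ []

    connection : ∀ {d d′} → (d , d′) ∈ cyclicPairs D → Connection (entry d) (exit d′) (proj₁ (connect (entry d) (exit d′)))
    connection {d} {d′} p = proj₂ (connect (entry d) (exit d′))
      (class-≈ (trans (sym (head-raise d)) (trans (closed-linked p) (tail-raise d′))))

    open K.Expansion entry piece

    pieces-ok : ∀ {d d′} → (d , d′) ∈ cyclicPairs D → K.Chain (entry d) (piece (d , d′)) (entry d′)
    pieces-ok {d} {d′} p = K.chain-++ (proj₁ (connect (entry d) (exit d′))) (connection-chain (connection p)) (refl , refl)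

    lifted : List K.Dart
    lifted = concatMap piece (cyclicPairs D)

    lifted-chain : K.Chain (entry d₀) lifted (entry d₀)
    lifted-chain = expand-closed pieces-ok

    piece-link : ∀ {d d′} → (d , d′) ∈ cyclicPairs D → ∀ {k} → k ∈ map K.edge (piece (d , d′)) →
                 Inside (C.tail d′) k ⊎ k ≡ Outers.at (C.edge d′)
    piece-link {d} {d′} p k∈ rewrite List.map-++ K.edge (proj₁ (connect (entry d) (exit d′))) (raise d′ ∷ [])
      with ∈-++⁻ (map K.edge (proj₁ (connect (entry d) (exit d′)))) k∈
    ... | inj₁ k∈l = inj₁ (subst (λ c → Inside c _) (trans (sym (head-raise d)) (closed-linked p))
        (connection-inside (connection p) k∈l))
    ... | inj₂ (here eq) = inj₂ eq

    not-inside : ∀ {c} g → ¬ Inside c (Outers.at g)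
    not-inside g (p , q) = Outers.at-sound g (trans p (sym q))

    -- Detours run inside a class and each class is visited once; the remaining links are the
    -- distinct edges of the cycle, and none of them lies inside a class.
    lifted-unique : Unique (map K.edge lifted)
    lifted-unique = subst Unique (sym (map-concatMap K.edge piece (cyclicPairs D)))
      (unique-concatMap (map K.edge ∘ piece) (cyclicPairs-unique unique-darts) each apart)
      where
      each : ∀ {p} → p ∈ cyclicPairs D → Unique (map K.edge (piece p))
      each {d , d′} p∈ = subst Unique (sym (List.map-++ K.edge (proj₁ (connect (entry d) (exit d′))) (raise d′ ∷ [])))
        (Unique.++⁺ (connection-unique (connection p∈)) ([] ∷ [])
          λ { (k∈ , here refl) → not-inside (C.edge d′) (connection-inside (connection p∈) k∈) })
      same : ∀ {d₁ d₁′ d₂ d₂′} → (d₁ , d₁′) ∈ cyclicPairs D → (d₂ , d₂′) ∈ cyclicPairs D → d₁′ ≡ d₂′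
          → (d₁ , d₁′) ≡ (d₂ , d₂′)
      same p q refl = cong (_, _) (cyclicPairs-pred-unique unique-darts p q)
      apart : ∀ {p q k} → p ∈ cyclicPairs D → q ∈ cyclicPairs D → k ∈ map K.edge (piece p) → k ∈ map K.edge (piece q) → p ≡ q
      apart {d₁ , d₁′} {d₂ , d₂′} p∈ q∈ k∈ k∈′ with piece-link p∈ k∈ | piece-link q∈ k∈′
      ... | inj₁ (a , _) | inj₁ (b , _) = same p∈ q∈
          (unique-map-injective C.tail unique-tails (cyclicPairs-∈₂ p∈) (cyclicPairs-∈₂ q∈) (trans (sym a) b))
      ... | inj₂ eq | inj₂ eq′ = same p∈ q∈
          (edge-injective (cyclicPairs-∈₂ p∈) (cyclicPairs-∈₂ q∈) (Outers.at-injective (trans (sym eq) eq′)))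
      ... | inj₁ i | inj₂ refl = ⊥-elim (not-inside (C.edge d₂′) i)
      ... | inj₂ refl | inj₁ i = ⊥-elim (not-inside (C.edge d₁′) i)

    piece-visited : ∀ {d d′} → (d , d′) ∈ cyclicPairs D → ∀ {k} → k ∈ piece (d , d′) → K.tail k ∈ map K.tail lifted
    piece-visited p k∈ = ∈-map⁺ K.tail (∈-concatMap⁺ piece p k∈)

    -- A port met without leaving its class lies on two outer links, so it is not in a triangle.
    stay-single : ∀ {d d′} → (d , d′) ∈ cyclicPairs D → entry d ≡ exit d′ → ∀ {x} → entry d ≈ x → entry d ≡ x
    stay-single {d} {d′} p eq {x} near = go _ _ refl refl (K.head-at (raise d) refl) (K.tail-at (raise d′) (sym eq))
      where
      go : ∀ k k′ → Outers.at (C.edge d) ≡ k → Outers.at (C.edge d′) ≡ k′ → At (entry d) k → At (entry d) k′ → entry d ≡ x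
      go (inj₂ e) _ e₁ _ a _ = outer-singleton a (outer-≉ {C.edge d} e₁) near
      go (inj₁ _) (inj₂ e) _ e₂ _ a = outer-singleton a (outer-≉ {C.edge d′} e₂) near
      -- A port has only one own link, and consecutive edges of the trail are different.
      go (inj₁ v) (inj₁ w) e₁ e₂ a b = ⊥-elim (passage-≢ p (Outers.at-injective (trans e₁
        (trans (cong inj₁ (trans (sym (at-vertex a)) (at-vertex b))) (sym e₂)))))

    lifted-visits : ∀ {x} → class x ∈ map C.tail D → x ∈ map K.tail lifted
    lifted-visits {x} c∈ with passage c∈
    ... | d , d′ , p , hd , _ = go (connection p) refl
      where
      entry≈x : entry d ≈ x
      entry≈x = class-≈ (trans (sym (head-raise d)) hd)
      exit-visited : exit d′ ∈ map K.tail lifted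
      exit-visited = piece-visited p (∈-++⁺ʳ (proj₁ (connect (entry d) (exit d′))) (here refl))
      go : ∀ {y l} → Connection (entry d) y l → (y , l) ≡ (exit d′ , proj₁ (connect (entry d) (exit d′)))
          → x ∈ map K.tail lifted
      go stay eq = subst (_∈ map K.tail lifted)
          (trans (sym (cong proj₁ eq)) (stay-single p (cong proj₁ eq) entry≈x)) exit-visited
      go (around d₁ d₂ t t₁ h₁ t₂ h₂) eq with triangle-class t entry≈x
      ... | inj₁ refl = subst (_∈ map K.tail lifted) t₁
          (piece-visited p (∈-++⁺ˡ (subst (d₁ ∈_) (cong proj₂ eq) (here refl))))
      ... | inj₂ (inj₂ refl) = subst (_∈ map K.tail lifted) t₂
          (piece-visited p (∈-++⁺ˡ (subst (d₂ ∈_) (cong proj₂ eq) (there (here refl)))))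
      ... | inj₂ (inj₁ refl) = subst (_∈ map K.tail lifted) (sym (cong proj₁ eq)) exit-visited

-- Projecting closed trails of the port graph to `H`

module ProjectTrail (H : Graph) (T : TransitionSystem H) where

  open Ports H T

  private
    module H = GraphDarts H
    module KL = K.Loopless src≢tgt

  isEdge : Link → Maybe (Edge H)
  isEdge (inj₁ _) = nothing
  isEdge (inj₂ e) = just e

  isEdge-injective : ∀ {k k′ e} → isEdge k ≡ just e → isEdge k′ ≡ just e → k ≡ k′
  isEdge-injective {inj₂ _} {inj₂ _} refl refl = refl

  project : K.Dart → Maybe H.Dart
  project (inj₁ _ , _) = nothing
  project (inj₂ e , b) = just (e , b)

  project-edges : ∀ L → map H.edge (mapMaybe project L) ≡ mapMaybe isEdge (map K.edge L)
  project-edges [] = refl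
  project-edges ((inj₁ _ , _) ∷ L) = project-edges L
  project-edges ((inj₂ e , _) ∷ L) = cong (e ∷_) (project-edges L)

  project-tail : ∀ e b → H.tail (e , b) ≡ proj₁ (K.tail (inj₂ e , b))
  project-tail e true  = refl
  project-tail e false = refl

  own-ends : ∀ v b → proj₁ (K.tail (inj₁ v , b)) ≡ v × proj₁ (K.head (inj₁ v , b)) ≡ v
  own-ends v true  = refl , refl
  own-ends v false = refl , refl

  project-chain : ∀ {x y} L → K.Chain x L y → H.Chain (proj₁ x) (mapMaybe project L) (proj₁ y)
  project-chain [] refl = refl
  project-chain ((inj₁ v , true) ∷ L)  (refl , c) = project-chain L c
  project-chain ((inj₁ v , false) ∷ L) (refl , c) = project-chain L c
  project-chain ((inj₂ e , true) ∷ L)  (refl , c) = refl , project-chain L c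
  project-chain ((inj₂ e , false) ∷ L) (refl , c) = refl , project-chain L c

  module _ {x₀ L} (chain : K.Chain x₀ L x₀) (unique : Unique (map K.edge L))
           (meets : ∀ v → ∃ λ x → x ∈ map K.tail L × proj₁ x ≡ v) where

    open KL.Trail {x₀} {L} chain unique
    open DegreeThree _≟ₖ_

    L-tails-unique : Unique (map K.tail L)
    L-tails-unique = unique-tails port-star

    R : List (Edge H)
    R = mapMaybe isEdge (map K.edge L)

    R-unique : Unique R
    R-unique = unique-mapMaybe isEdge isEdge-injective unique

    ∈-R : ∀ {e} → inj₂ e ∈ map K.edge L → e ∈ R
    ∈-R e∈ = ∈-mapMaybe isEdge e∈ refl

    R-∈ : ∀ {e} → e ∈ R → inj₂ e ∈ map K.edge L
    R-∈ e∈ with ∈-mapMaybe⁻ isEdge e∈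
    ... | inj₂ e , k∈ , refl = k∈

    link-visits : ∀ {k x} → k ∈ map K.edge L → At x k → x ∈ map K.tail L
    link-visits k∈ a with ∈-map⁻ K.edge k∈
    ... | d , d∈ , refl = at∈tails d∈ a

    link-pair : ∀ {d d′} → (d , d′) ∈ cyclicPairs L → (K.edge d , K.edge d′) ∈ cyclicPairs (map K.edge L)
    link-pair p rewrite cyclicPairs-map K.edge L = ∈-map⁺ (λ q → K.edge (proj₁ q) , K.edge (proj₂ q)) p

    edge-∈ : ∀ {d} → d ∈ L → K.edge d ∈ map K.edge L
    edge-∈ = ∈-map⁺ K.edge

    -- If the trail leaves `x` by the own link, it arrives at the other port of the same vertex and
    -- must leave that one by an edge of `H`, since the own link cannot be repeated.
    spans : ∀ v → v ∈ map H.tail (mapMaybe project L)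
    spans v with meets v
    ... | x , x∈ , refl with passage x∈
    ...   | d , (inj₂ e , b) , p , _ , tl = subst (_∈ map H.tail (mapMaybe project L))
        (trans (project-tail e b) (cong proj₁ tl))
              (∈-map⁺ H.tail (∈-mapMaybe project {xs = L} (cyclicPairs-∈₂ {xs = L} p) refl))
    ...   | d , (inj₁ w , b) , p , _ , tl with cyclicPairs-succ {xs = L} (cyclicPairs-∈₂ {xs = L} p)
    ...     | (inj₁ w′ , b′) , q = ⊥-elim (passage-≢ q (cong inj₁ (trans (sym (proj₂ (own-ends w b)))
                (trans (cong proj₁ (closed-linked q)) (proj₁ (own-ends w′ b′))))))
    ...     | (inj₂ e , b′) , q = subst (_∈ map H.tail (mapMaybe project L))
                (trans (project-tail e b′) (trans (cong proj₁ (sym (closed-linked q))) (trans (proj₂ (own-ends w b))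
                  (trans (sym (proj₁ (own-ends w b))) (cong proj₁ tl)))))
                (∈-map⁺ H.tail (∈-mapMaybe project {xs = L} (cyclicPairs-∈₂ {xs = L} q) refl))

    trail : Σ (Walk (whole H) (proj₁ x₀) (proj₁ x₀)) λ w → edges w ≡ map H.edge (mapMaybe project L)
        × vertices w ≡ map H.tail (mapMaybe project L)
    trail = H.chain-walk (mapMaybe project L) (project-chain L chain) (All.universal (λ _ → tt) _)

    W : Walk (whole H) (proj₁ x₀) (proj₁ x₀)
    W = proj₁ trail

    W-edges : edges W ≡ R
    W-edges = trans (proj₁ (proj₂ trail)) (project-edges L)

    Own-unused : Port → Set
    Own-unused x = inj₁ (proj₁ x) ∉ map K.edge L

    -- A passage through `x` without the own link uses both edges of the transition one after the
    -- other, and they remain consecutive when own links are deleted.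
    passed-follows : ∀ {x} → x ∈ map K.tail L → Own-unused x → Follows W (transition x) × (∀ {e} → At x (inj₂ e) → e ∈ R)
    passed-follows {x} x∈ own∉ with passage x∈
    ... | (inj₁ w , b) , d′ , p , hd , _ = ⊥-elim (own∉ (subst (λ z → inj₁ z ∈ map K.edge L)
            (trans (sym (proj₂ (own-ends w b))) (cong proj₁ hd)) (edge-∈ (cyclicPairs-∈₁ {xs = L} p))))
    ... | d@(inj₂ _ , _) , (inj₁ w , b) , p , _ , tl = ⊥-elim (own∉ (subst (λ z → inj₁ z ∈ map K.edge L)
            (trans (sym (proj₁ (own-ends w b))) (cong proj₁ tl)) (edge-∈ (cyclicPairs-∈₂ {xs = L} p))))
    ... | d@(inj₂ e , _) , d′@(inj₂ f , _) , p , hd , tl =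
          (e , f , subst (λ es → (e , f) ∈ cyclicPairs es) (sym W-edges)
              (cyclicPairs-mapMaybe isEdge {xs = map K.edge L} refl refl (link-pair p))
            , pair-≡ (at-transition e-at) (at-transition f-at) (only ∘ transition-at))
          , λ {g} a → [ (λ { refl → ∈-R (edge-∈ (cyclicPairs-∈₁ {xs = L} p)) })
              , (λ { refl → ∈-R (edge-∈ (cyclicPairs-∈₂ {xs = L} p)) }) ]′ (only a)
      where
      e-at : At x (inj₂ e)
      e-at = K.head-at d hd
      f-at : At x (inj₂ f)
      f-at = K.tail-at d′ tl
      only : ∀ {g} → At x (inj₂ g) → g ≡ e ⊎ g ≡ f
      only = at-third (λ { refl → passage-≢ p refl }) e-at f-at

    remaining : ∀ {x} d → d ∈ L → At x (K.edge d) → K.edge d ≢ inj₁ (proj₁ x) →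
                (∀ {d′} → d′ ∈ L → At x (K.edge d′) → K.edge d′ ≢ inj₁ (proj₁ x) → d′ ≡ d) →
                ∃ λ e → e ∈ R × At x (inj₂ e) × (∀ {f} → f ∈ R → At x (inj₂ f) → f ≡ e)
    remaining (inj₁ w , _) _ a ne _ = ⊥-elim (ne (cong inj₁ (sym (at-vertex a))))
    remaining {x} (inj₂ e , _) d∈ a _ only = e , ∈-R (edge-∈ d∈) , a , λ f∈ f-at → case ∈-map⁻ K.edge (R-∈ f∈) of λ
      { (d′ , d′∈ , eq) → Sum.inj₂-injective (trans eq (cong K.edge
          (only d′∈ (subst (At x) eq f-at) (λ eq′ → case trans eq eq′ of λ ())))) }

    -- The port graph is cubic, so a port is passed only once. One of the two links of this passage
    -- is the own link, which leaves exactly one edge of `H`.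
    own-used : ∀ {x} → inj₁ (proj₁ x) ∈ map K.edge L → ∃ λ e → e ∈ R × At x (inj₂ e)
        × (∀ {f} → f ∈ R → At x (inj₂ f) → f ≡ e)
    own-used {x} own∈ with passage (link-visits own∈ (at-own x)) | ∈-map⁻ K.edge own∈
    ... | d , d′ , p , hd , tl | m , m∈ , m≡ with edges-at L-tails-unique p hd tl m∈ (subst (At x) m≡ (at-own x))
    ...   | inj₁ refl = remaining d′ (cyclicPairs-∈₂ {xs = L} p) (K.tail-at d′ tl)
        (λ eq → passage-≢ p (trans (sym m≡) (sym eq)))
              λ d″∈ a ne → case edges-at L-tails-unique p hd tl d″∈ a of
                  λ { (inj₁ refl) → ⊥-elim (ne (sym m≡)) ; (inj₂ eq) → eq }
    ...   | inj₂ refl = remaining d (cyclicPairs-∈₁ {xs = L} p) (K.head-at d hd) (λ eq → passage-≢ p (trans eq m≡))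
              λ d″∈ a ne → case edges-at L-tails-unique p hd tl d″∈ a of
                  λ { (inj₂ refl) → ⊥-elim (ne (sym m≡)) ; (inj₁ eq) → eq }

    local-count : ∀ {v} e f → e ≢ f → e ∈ R → f ∈ R → Incident H v e → Incident H v f →
                  (∀ {g} → g ∈ R → Incident H v g → g ≡ e ⊎ g ≡ f) → ∣ edgeSet W ∩ E[_] H v ∣ ≡ 2
    local-count {v} e f e≢f e∈ f∈ e-inc f-inc only = ∣∣≡length {l = e ∷ f ∷ []} ((e≢f ∷ []) ∷ [] ∷ [])
      (λ { (here refl) → into e∈ e-inc ; (there (here refl)) → into f∈ f-inc })
      λ g∈ → let g∈W , g∈E = Subset.x∈p∩q⁻ (edgeSet W) (E[_] H v) g∈ in
             case only (subst (_ ∈_) W-edges (∈-fromList⁻ g∈W)) (H.∈-star⁻ g∈E) of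
                 λ { (inj₁ eq) → here eq ; (inj₂ eq) → there (here eq) }
      where
      into : ∀ {g} → g ∈ R → Incident H v g → g ∈ₛ edgeSet W ∩ E[_] H v
      into g∈ inc = Subset.x∈p∩q⁺ (∈-fromList⁺ (subst (_ ∈_) (sym W-edges) g∈) , H.∈-star⁺ inc)

    by-port : ∀ {v g} {P : Set} → (∀ b → At (v , b) (inj₂ g) → P) → Incident H v g → P
    by-port f inc = f _ (incident-at inc)

    local : ∀ v → ∣ edgeSet W ∩ E[_] H v ∣ ≡ 2 ⊎ (Follows W (P₁ (T v)) × Follows W (P₂ (T v)))
    local v with any? (inj₁ v ≟ₖ_) (map K.edge L) | any? ((v , false) ≟ₚ_) (map K.tail L) | any? ((v , true) ≟ₚ_)
        (map K.tail L)
    -- One edge from each port; they differ because no edge of `H` meets both ports of `v`.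
    ... | yes own∈ | _ | _ = inj₁ (local-count (proj₁ one) (proj₁ two)
            (λ eq → case at-same-vertex (subst (λ e → At (v , false) (inj₂ e)) eq (proj₁ (proj₂ (proj₂ one))))
                (proj₁ (proj₂ (proj₂ two))) refl of λ ())
            (proj₁ (proj₂ one)) (proj₁ (proj₂ two)) (at-incident (proj₁ (proj₂ (proj₂ one))))
                (at-incident (proj₁ (proj₂ (proj₂ two))))
            λ g∈ → by-port λ { false a → inj₁ (proj₂ (proj₂ (proj₂ one)) g∈ a) ; true a → inj₂
                (proj₂ (proj₂ (proj₂ two)) g∈ a) })
      where
      one = own-used {v , false} own∈
      two = own-used {v , true} own∈
    ... | no own∉ | yes f∈ | yes t∈ = inj₂ (proj₁ (passed-follows f∈ own∉) , proj₁ (passed-follows t∈ own∉))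
    ... | no own∉ | yes f∈ | no t∉ with port-edges (v , false)
    ...   | a , b , a≢b , a-at , b-at , only = inj₁
        (local-count a b a≢b (proj₂ (passed-follows f∈ own∉) a-at) (proj₂ (passed-follows f∈ own∉) b-at)
              (at-incident a-at) (at-incident b-at)
              λ g∈ → by-port λ { false g-at → only g-at ; true g-at → ⊥-elim (t∉ (link-visits (R-∈ g∈) g-at)) })
    local v | no own∉ | no f∉ | yes t∈ with port-edges (v , true)
    ...   | a , b , a≢b , a-at , b-at , only = inj₁
        (local-count a b a≢b (proj₂ (passed-follows t∈ own∉) a-at) (proj₂ (passed-follows t∈ own∉) b-at)
              (at-incident a-at) (at-incident b-at)
              λ g∈ → by-port λ { true g-at → only g-at ; false g-at → ⊥-elim (f∉ (link-visits (R-∈ g∈) g-at)) })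
    local v | no own∉ | no f∉ | no t∉ with meets v
    ... | (_ , false) , x∈ , refl = ⊥-elim (f∉ x∈)
    ... | (_ , true)  , x∈ , refl = ⊥-elim (t∉ x∈)

    project-T-trail : THamiltonian H T
    project-T-trail = proj₁ x₀ , W , subst Unique (sym W-edges) R-unique
      , (λ v → subst (v ∈_) (sym (proj₂ (proj₂ trail))) (spans v)) , local

DCC→NWC* : DCC → NWC*
DCC→NWC* dcc H regular connected T with dcc contracted contracted-cubic
    (contracted-cyclically-4-connected H regular connected T)
  where open Ports H T
... | c , w , (ne , eu , vu) , dominates = finish (C.walk-chain w)
  where
  open Ports H T
  finish : (∃ λ ds → C.Chain c ds c × map C.edge ds ≡ edges w × map C.tail ds ≡ vertices w
      × All (E (whole contracted) ∘ C.edge) ds) → THamiltonian H T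
  finish ([] , _ , eq , _) = ⊥-elim (ne (sym eq))
  finish (d₀ ∷ ds , chain , eqₑ , eqᵥ , _) = ProjectTrail.project-T-trail H T {L = lifted} lifted-chain lifted-unique meets
    where
    open LiftTrail.Lift H T {c} {d₀} {ds} chain (subst Unique (sym eqₑ) eu) (subst Unique (sym eqᵥ) vu)
    meets : ∀ v → ∃ λ x → x ∈ map K.tail lifted × proj₁ x ≡ v
    -- The end of `own v` on the cycle is a class containing a port of `v`, and the lift visits all
    -- ports of that class.
    meets v with dominates (own v)
    ... | u , u∈ , inc with incident-class {u} {own v} inc
    ...   | x , refl , a = x , lifted-visits (subst (class x ∈_) (sym eqᵥ) u∈)
        , at-vertex (subst (At x) (Outers.at-indexOf _ _) a)

-- Tree components in cubic graphs

unique-unrotate : {A : Set} {x : A} (xs : List A) → Unique (xs ++ x ∷ []) → Unique (x ∷ xs)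
unique-unrotate [] u = u
unique-unrotate {x = x} (y ∷ ys) (y∉ ∷ u) with unique-unrotate ys u
... | x∉ ∷ u′ = ((λ eq → All.lookup y∉ (∈-++⁺ʳ ys (here refl)) (sym eq)) ∷ x∉) ∷ All.++⁻ˡ ys y∉ ∷ u′

unique-prefix : {A : Set} (xs : List A) {ys : List A} → Unique (xs ++ ys) → Unique xs
unique-prefix [] _ = []
unique-prefix (x ∷ xs) (x∉ ∷ u) = All.++⁻ˡ xs x∉ ∷ unique-prefix xs u

unique-reverse : {A : Set} {xs : List A} → Unique xs → Unique (reverse xs)
unique-reverse [] = []
unique-reverse {xs = x ∷ xs} (x∉ ∷ u) = subst Unique (sym (List.unfold-reverse x xs))
  (Unique.++⁺ (unique-reverse u) ([] ∷ []) λ { (v∈ , here refl) → All.lookup x∉ (Any.reverse⁻ v∈) refl })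

module CubicCuts (G : Graph) (cubic : Cubic G) where

  open GraphDarts G

  module Acyclic (F : Subset (∣E∣ G)) (w : Vertex G)
      (acyclic : ¬ (∃ λ v → Σ (Walk (component (deleteEdges G F) w) v v) IsCycle)) where

    D : Subgraph G
    D = deleteEdges G F

    Reached : Vertex G → Set
    Reached = Walk D w

    -- Paths grow at their start `a`. Singling out the first dart guarantees an edge, and hence
    -- distinct ends.
    record Path (a b : Vertex G) : Set where
      constructor path
      field
        d₁           : Dart
        ds           : List Dart
        chain        : Chain a (d₁ ∷ ds) b
        distinct     : Unique (a ∷ map head (d₁ ∷ ds))
        edges-unique : Unique (map edge (d₁ ∷ ds))
        uncut        : ∀ {e} → e ∈ map edge (d₁ ∷ ds) → e ∉ₛ F
        reached      : Reached a

    Leaf : Vertex G → Set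
    Leaf a = ∀ {e e′} → Incident G a e → Incident G a e′ → e ∉ₛ F → e′ ∉ₛ F → e ≡ e′

    reached-edges : ∀ {u v} ds → Reached u → Chain u ds v → (∀ {e} → e ∈ map edge ds → e ∉ₛ F)
        → All (E (component D w) ∘ edge) ds
    reached-edges [] _ _ _ = []
    reached-edges (d ∷ ds) r (refl , c) uncut = (uncut (here refl) , both d r r′) ∷ reached-edges ds r′ c (uncut ∘ there)
      where
      r′ : Reached (head d)
      r′ = walk-++ r (step (edge d) (uncut (here refl)) (dart-joins d) [])
      both : ∀ d → Reached (tail d) → Reached (head d) → Reached (end₁ G (edge d)) × Reached (end₂ G (edge d))
      both (_ , true)  r r′ = r , r′
      both (_ , false) r r′ = r′ , r

    first-edge : ∀ {a b} d₁ ds → Chain a (d₁ ∷ ds) b → Unique (a ∷ map head (d₁ ∷ ds)) →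
                 ∀ {e} → Incident G a e → e ∈ map edge (d₁ ∷ ds) → e ≡ edge d₁
    first-edge d₁ ds _ _ _ (here eq) = eq
    first-edge {a} {b} d₁ ds (_ , c) u a-inc (there e∈) with ∈-map⁻ edge e∈
    ... | d , d∈ , refl with at-dart d a-inc
    ...   | inj₁ refl = ⊥-elim (unique-head u (subst (tail d ∈_) (sym (tails-heads ds c)) (∈-++⁺ˡ (∈-map⁺ tail d∈))))
    ...   | inj₂ refl = ⊥-elim (unique-head u (there (∈-map⁺ head d∈)))

    -- If the new dart `d` starts at the head of `dⱼ`, then `d` followed by the arc of the path from
    -- `a` to that head is a cycle.
    closes-cycle : ∀ {a b} (p : Path a b) d → head d ≡ a → edge d ∉ₛ F → edge d ∉ map edge (Path.d₁ p ∷ Path.ds p) →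
                   Reached (tail d) → tail d ∈ map head (Path.d₁ p ∷ Path.ds p) → ⊥
    closes-cycle {a} {b} p d hd d∉F d-new r t∈ with ∈-map⁻ head t∈
    ... | dⱼ , dⱼ∈ , t≡ with ∈-∃++ dⱼ∈
    ...   | as , bs , eq = acyclic (tail d , proj₁ cycle
            , (λ empty → case trans (sym (proj₁ (proj₂ cycle))) empty of λ ())
            , subst Unique (sym (proj₁ (proj₂ cycle))) cycle-edges
            , subst Unique (sym (proj₂ (proj₂ cycle))) cycle-tails)
      where
      open Path p
      arc : List Dart
      arc = as ++ dⱼ ∷ []
      split : d₁ ∷ ds ≡ arc ++ bs
      split = trans eq (sym (List.++-assoc as (dⱼ ∷ []) bs))
      arc-chain : Chain a arc (tail d)
      arc-chain with chain-++⁻ as (subst (λ l → Chain a l b) eq chain)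
      ... | v , c , (tl , _) = chain-++ as c (tl , sym t≡)
      edge-arc : map edge (d₁ ∷ ds) ≡ map edge arc ++ map edge bs
      edge-arc = trans (cong (map edge) split) (List.map-++ edge arc bs)
      head-arc : a ∷ map head (d₁ ∷ ds) ≡ (a ∷ map head arc) ++ map head bs
      head-arc = cong (a ∷_) (trans (cong (map head) split) (List.map-++ head arc bs))
      in-arc : ∀ {e} → e ∈ map edge arc → e ∈ map edge (d₁ ∷ ds)
      in-arc e∈ = subst (_ ∈_) (sym edge-arc) (∈-++⁺ˡ e∈)
      cycle-edges : Unique (map edge (d ∷ arc))
      cycle-edges = All.tabulate (λ { e∈ refl → d-new (in-arc e∈) }) ∷ unique-prefix (map edge arc)
          (subst Unique edge-arc edges-unique)
      cycle-tails : Unique (map tail (d ∷ arc))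
      cycle-tails = unique-unrotate (map tail arc)
        (subst Unique (tails-heads arc arc-chain) (unique-prefix (a ∷ map head arc) (subst Unique head-arc distinct)))
      cycle : Σ (Walk (component D w) (tail d) (tail d)) λ c → edges c ≡ map edge (d ∷ arc) × vertices c ≡ map tail (d ∷ arc)
      cycle = chain-walk (d ∷ arc) (refl , subst (λ x → Chain x arc (tail d)) (sym hd) arc-chain)
        (reached-edges (d ∷ arc) r (refl , subst (λ x → Chain x arc (tail d)) (sym hd) arc-chain)
          λ { (here refl) → d∉F ; (there e∈) → uncut (in-arc e∈) })

    path-length : ∀ {a b} → Path a b → ℕ
    path-length p = length (Path.ds p)

    -- A start that is not a leaf has a further uncut edge, whose other end is new by
    -- `closes-cycle`. The fuel `n` suffices because the path has `path-length p + 2` distinct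
    -- vertices.
    extend-to-leaf : ∀ n {a b} (p : Path a b) → ∣V∣ G ≤ n + path-length p → ∃ λ a′ → Path a′ b × Leaf a′
    extend-to-leaf n {a} {b} p bound with Fin.any?
        (λ e → incident? G a e ×-dec (¬? (e Subset.∈? F) ×-dec ¬? (e Fin.≟ edge (Path.d₁ p))))
    ... | no none = a , p , λ i i′ ∉ ∉′ → trans (is-first i ∉) (sym (is-first i′ ∉′))
      where
      is-first : ∀ {e} → Incident G a e → e ∉ₛ F → e ≡ edge (Path.d₁ p)
      is-first {e} i e∉ = decidable-stable (e Fin.≟ edge (Path.d₁ p)) λ ne → none (e , i , e∉ , ne)
    ... | yes (e , a-inc , e∉F , e≢) with at-out a-inc
    ...   | d⁻ , refl , tl = go n bound
      where
      open Path p
      d : Dart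
      d = flip d⁻
      hd : head d ≡ a
      hd = trans (head-flip d⁻) tl
      d-new : edge d ∉ map edge (d₁ ∷ ds)
      d-new e∈ = e≢ (first-edge d₁ ds chain distinct a-inc e∈)
      r : Reached (tail d)
      r = walk-++ reached (step (edge d) e∉F (joins-sym {H = D} (subst (Joins G (edge d) (tail d)) hd (dart-joins d))) [])
      t∉ : tail d ∉ a ∷ map head (d₁ ∷ ds)
      t∉ (here eq) = tail≢head d (trans eq (sym hd))
      t∉ (there t∈) = closes-cycle p d hd e∉F d-new r t∈
      longer : Path (tail d) b
      longer = path d (d₁ ∷ ds) (refl , subst (λ x → Chain x (d₁ ∷ ds) b) (sym hd) chain)
        (subst (λ x → Unique (tail d ∷ x ∷ map head (d₁ ∷ ds))) (sym hd) (All.tabulate (λ { x∈ refl → t∉ x∈ }) ∷ distinct))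
        (All.tabulate (λ { e∈ refl → d-new e∈ }) ∷ edges-unique)
        (λ { (here refl) → e∉F ; (there e∈) → uncut e∈ }) r
      go : ∀ n → ∣V∣ G ≤ n + length ds → ∃ λ a′ → Path a′ b × Leaf a′
      go (suc n) bound = extend-to-leaf n longer (subst (∣V∣ G ≤_) (sym (ℕ.+-suc n (length ds))) bound)
      go zero bound = ⊥-elim (ℕ.<⇒≱ (s≤s
          (ℕ.≤-trans bound (ℕ.≤-trans (ℕ.≤-reflexive (sym (List.length-map head ds))) (ℕ.n≤1+n _))))
        (subst (length (a ∷ map head (d₁ ∷ ds)) ≤_) (List.length-tabulate {n = ∣V∣ G} id)
            (unique-⊆-length distinct λ {v} _ → ∈-allFin v)))

    path-reverse : ∀ {a b} → Path a b → Path b a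
    path-reverse {a} {b} p with reverseChain (Path.d₁ p ∷ Path.ds p) (Path.chain p)
    ... | [] , _ , eq , _ = case subst (edge (Path.d₁ p) ∈_) (sym eq)
        (Any.reverse⁺ {xs = map edge (Path.d₁ p ∷ Path.ds p)} (here refl)) of λ ()
    ... | d ∷ ds′ , c , eqₑ , eqᵥ = path d ds′ c
      (subst Unique (sym eqᵥ) (unique-reverse distinct)) (subst Unique (sym eqₑ) (unique-reverse edges-unique)) uncut′
      (walk-++ reached (proj₁ (chain-walk (d₁ ∷ ds) chain (All.tabulate λ d∈ → uncut (∈-map⁺ edge d∈)))))
      where
      open Path p
      uncut′ : ∀ {e} → e ∈ map edge (d ∷ ds′) → e ∉ₛ F
      uncut′ e∈ = uncut (Any.reverse⁻ (subst (_ ∈_) eqₑ e∈))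

    last-head : ∀ {u v} d ds → Chain u (d ∷ ds) v → v ∈ map head (d ∷ ds)
    last-head d [] (_ , eq) = here (sym eq)
    last-head d (d′ ∷ ds) (_ , c) = there (last-head d′ ds c)

    path-ends-≢ : ∀ {a b} → Path a b → a ≢ b
    path-ends-≢ p refl = unique-head distinct (last-head d₁ ds chain)
      where open Path p

    leaf-cut-edges : ∀ {a} → Leaf a → ∃₂ λ f f′ → f ≢ f′ × f ∈ₛ F × f′ ∈ₛ F × Incident G a f × Incident G a f′
    leaf-cut-edges {a} leaf with degree-star a
    ... | l , len , u , _ , from with trans len (cubic a)
    leaf-cut-edges {a} leaf | x ∷ y ∷ z ∷ [] , _ , (x≢y ∷ x≢z ∷ []) ∷ (y≢z ∷ []) ∷ _ , _ , from | refl
      with x Subset.∈? F | y Subset.∈? F | z Subset.∈? F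
    ... | yes p | yes q | _     = x , y , x≢y , p , q , from (here refl) , from (there (here refl))
    ... | yes p | no _  | yes r = x , z , x≢z , p , r , from (here refl) , from (there (there (here refl)))
    ... | no _  | yes q | yes r = y , z , y≢z , q , r , from (there (here refl)) , from (there (there (here refl)))
    ... | no p  | no q  | _     = ⊥-elim (x≢y (leaf (from (here refl)) (from (there (here refl))) p q))
    ... | no p  | yes _ | no r  = ⊥-elim (x≢z (leaf (from (here refl)) (from (there (there (here refl)))) p r))
    ... | yes _ | no q  | no r  = ⊥-elim (y≢z (leaf (from (there (here refl))) (from (there (there (here refl)))) q r))

    -- A component that is a tree with an edge has two leaves, and two cut edges leave at each of them.
    four≤tree-cut : ∀ {e} → Incident G w e → e ∉ₛ F →
      (∀ {f} → f ∈ₛ F → Reached (end₁ G f) → ¬ Reached (end₂ G f)) → 4 ≤ ∣ F ∣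
    four≤tree-cut {e} w-inc e∉F leaves with at-out w-inc
    -- The path consisting of one edge is grown at its start, reversed, and grown again; the ends
    -- are then two different leaves.
    ... | d , refl , refl with extend-to-leaf (∣V∣ G)
        (path d [] (refl , refl) ((tail≢head d ∷ []) ∷ [] ∷ []) ([] ∷ []) (λ { (here refl) → e∉F }) []) (ℕ.m≤m+n _ _)
    ...   | a , p , a-leaf with extend-to-leaf (∣V∣ G) (path-reverse p) (ℕ.m≤m+n _ _)
    ...     | b , q , b-leaf with leaf-cut-edges a-leaf | leaf-cut-edges b-leaf
    ...       | f₁ , f₂ , f≢ , f₁∈ , f₂∈ , a₁ , a₂ | g₁ , g₂ , g≢ , g₁∈ , g₂∈ , b₁ , b₂ =
      length≤∣∣ {l = f₁ ∷ f₂ ∷ g₁ ∷ g₂ ∷ []}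
        ((f≢ ∷ apart f₁∈ a₁ b₁ ∷ apart f₁∈ a₁ b₂ ∷ []) ∷ (apart f₂∈ a₂ b₁ ∷ apart f₂∈ a₂ b₂ ∷ []) ∷ (g≢ ∷ []) ∷ [] ∷ [])
        λ { (here refl) → f₁∈ ; (there (here refl)) → f₂∈ ; (there (there (here refl))) → g₁∈ ;
            (there (there (there (here refl)))) → g₂∈ }
      where
      -- A cut edge joining both leaves would have its two ends in the component, against `leaves`.
      apart : ∀ {f g} → f ∈ₛ F → Incident G a f → Incident G b g → f ≢ g
      apart f∈ (inj₁ refl) (inj₁ eq) refl = path-ends-≢ q eq
      apart f∈ (inj₂ refl) (inj₂ eq) refl = path-ends-≢ q eq
      apart f∈ (inj₁ refl) (inj₂ refl) refl = leaves f∈ (Path.reached p) (Path.reached q)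
      apart f∈ (inj₂ refl) (inj₁ refl) refl = leaves f∈ (Path.reached q) (Path.reached p)

-- Line graphs of cubic graphs

next : Fin 3 → Fin 3
next zero             = suc zero
next (suc zero)       = suc (suc zero)
next (suc (suc zero)) = zero

next-≢ : ∀ i → next i ≢ i
next-≢ zero ()
next-≢ (suc zero) ()
next-≢ (suc (suc zero)) ()

next²-≢ : ∀ i → next (next i) ≢ i
next²-≢ zero ()
next²-≢ (suc zero) ()
next²-≢ (suc (suc zero)) ()

others : ∀ i j → j ≢ i → j ≡ next i ⊎ j ≡ next (next i)
others zero zero ne = ⊥-elim (ne refl)
others zero (suc zero) _ = inj₁ refl
others zero (suc (suc zero)) _ = inj₂ refl
others (suc zero) zero _ = inj₂ refl
others (suc zero) (suc zero) ne = ⊥-elim (ne refl)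
others (suc zero) (suc (suc zero)) _ = inj₁ refl
others (suc (suc zero)) zero _ = inj₁ refl
others (suc (suc zero)) (suc zero) _ = inj₂ refl
others (suc (suc zero)) (suc (suc zero)) ne = ⊥-elim (ne refl)

third-unique : ∀ {i j k k′ : Fin 3} → i ≢ j → i ≢ k → j ≢ k → i ≢ k′ → j ≢ k′ → k ≡ k′
third-unique {i} {j} {k} {k′} i≢j i≢k j≢k i≢k′ j≢k′ with others i j (i≢j ∘ sym) | others i k
    (i≢k ∘ sym) | others i k′ (i≢k′ ∘ sym)
... | inj₁ refl | inj₁ refl | _         = ⊥-elim (j≢k refl)
... | inj₂ refl | inj₂ refl | _         = ⊥-elim (j≢k refl)
... | inj₁ refl | inj₂ refl | inj₁ refl = ⊥-elim (j≢k′ refl)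
... | inj₁ refl | inj₂ refl | inj₂ refl = refl
... | inj₂ refl | inj₁ refl | inj₁ refl = refl
... | inj₂ refl | inj₁ refl | inj₂ refl = ⊥-elim (j≢k′ refl)

module LineGraph (G : Graph) (cubic : Cubic G) where

  module G = GraphDarts G

  corners : ∀ v → ∃ λ (f : Fin 3 → Edge G) → (∀ i j → f i ≡ f j → i ≡ j) × (∀ i → Incident G v (f i))
      × (∀ {e} → Incident G v e → ∃ λ i → f i ≡ e)
  corners v with G.degree-star v
  ... | l , len , u , to , from with trans len (cubic v)
  corners v | l@(_ ∷ _ ∷ _ ∷ []) , _ , u , to , from | refl =
    lookup l , unique-lookup-injective u , (λ i → from (∈-lookup i)) , λ inc → index (to inc)
        , sym (Any.lookup-index (to inc))

  abstract
   corner : Vertex G → Fin 3 → Edge G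
   corner v = proj₁ (corners v)

   corner-injective : ∀ v {i j} → corner v i ≡ corner v j → i ≡ j
   corner-injective v = proj₁ (proj₂ (corners v)) _ _

   corner-incident : ∀ v i → Incident G v (corner v i)
   corner-incident v = proj₁ (proj₂ (proj₂ (corners v)))

   corner-index : ∀ {v e} → Incident G v e → ∃ λ i → corner v i ≡ e
   corner-index {v} = proj₂ (proj₂ (proj₂ (corners v)))

   base : Fin (∣V∣ G * 3) → Vertex G
   base l = proj₁ (remQuot 3 l)

   omitted : Fin (∣V∣ G * 3) → Fin 3
   omitted l = proj₂ (remQuot {∣V∣ G} 3 l)

   link : Vertex G → Fin 3 → Fin (∣V∣ G * 3)
   link = combine

   base-link : ∀ v i → base (link v i) ≡ v
   base-link v i = cong proj₁ (Fin.remQuot-combine v i)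

   omitted-link : ∀ v i → omitted (link v i) ≡ i
   omitted-link v i = cong proj₂ (Fin.remQuot-combine v i)

   link-base : ∀ l → link (base l) (omitted l) ≡ l
   link-base l = Fin.combine-remQuot {∣V∣ G} 3 l

  -- Each vertex v of G contributes a triangle on the three edges at v; its edge link v i misses the edge corner v i.
  lineGraph : Graph
  lineGraph = record
    { ∣V∣ = ∣E∣ G
    ; ∣E∣ = ∣V∣ G * 3
    ; ends = λ l → corner (base l) (next (omitted l)) , corner (base l) (next (next (omitted l)))
    ; loopless = λ l eq → next-≢ _ (sym (corner-injective (base l) eq))
    }

  module L = GraphDarts lineGraph

  incident-base : ∀ {e l} → Incident lineGraph e l → Incident G (base l) e
  incident-base (inj₁ refl) = corner-incident _ _
  incident-base (inj₂ refl) = corner-incident _ _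

  incident-omitted : ∀ {e l} → Incident lineGraph e l → corner (base l) (omitted l) ≢ e
  incident-omitted {l = l} (inj₁ refl) eq = next-≢ _ (sym (corner-injective (base l) eq))
  incident-omitted {l = l} (inj₂ refl) eq = next²-≢ _ (sym (corner-injective (base l) eq))

  corner-incident-line : ∀ l j → j ≢ omitted l → Incident lineGraph (corner (base l) j) l
  corner-incident-line l j ne with others (omitted l) j ne
  ... | inj₁ eq = inj₁ (cong (corner (base l)) eq)
  ... | inj₂ eq = inj₂ (cong (corner (base l)) eq)

  link-incident : ∀ v i j → j ≢ i → Incident lineGraph (corner v j) (link v i)
  link-incident v i j ne = subst (λ w → Incident lineGraph (corner w j) (link v i)) (base-link v i)
    (corner-incident-line (link v i) j (λ eq → ne (trans eq (omitted-link v i))))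

  line-edges : ∀ {x e} → Incident G x e → ∃₂ λ l l′ → l ≢ l′ × (base l ≡ x × Incident lineGraph e l)
      × (base l′ ≡ x × Incident lineGraph e l′)
    × (∀ {m} → base m ≡ x → Incident lineGraph e m → m ≡ l ⊎ m ≡ l′)
  line-edges {x} x-inc with corner-index x-inc
  ... | j , refl = link x (next j) , link x (next (next j))
      , (λ eq → next-≢ (next j) (sym (trans (sym (omitted-link x (next j)))
          (trans (cong omitted eq) (omitted-link x (next (next j)))))))
      , (base-link x _ , link-incident x _ j (next-≢ j ∘ sym))
      , (base-link x _ , link-incident x _ j (next²-≢ j ∘ sym))
      , only
    where
    only : ∀ {m} → base m ≡ x → Incident lineGraph (corner x j) m → m ≡ link x (next j) ⊎ m ≡ link x (next (next j))
    only {m} refl inc with others j (omitted m) (λ eq → incident-omitted inc (cong (corner (base m)) eq))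
    ... | inj₁ eq = inj₁ (trans (sym (link-base m)) (cong (link (base m)) eq))
    ... | inj₂ eq = inj₂ (trans (sym (link-base m)) (cong (link (base m)) eq))

  AtBase : Edge G → Vertex G → Edge lineGraph → Set
  AtBase e x l = base l ≡ x × Incident lineGraph e l

  atBase? : ∀ e x → Decidable (AtBase e x)
  atBase? e x l = (base l Fin.≟ x) ×-dec incident? lineGraph e l

  lineTransition : Edge G → Vertex G → Subset (∣E∣ lineGraph)
  lineTransition e x = fromDecidable (atBase? e x)

  ∈-lineTransition⁺ : ∀ {e x l} → AtBase e x l → l ∈ₛ lineTransition e x
  ∈-lineTransition⁺ {e} {x} = ∈-fromDecidable⁺ (atBase? e x)

  ∈-lineTransition⁻ : ∀ {e x l} → l ∈ₛ lineTransition e x → AtBase e x l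
  ∈-lineTransition⁻ {e} {x} = ∈-fromDecidable⁻ (atBase? e x)

  ∣lineTransition∣ : ∀ {e x} → Incident G x e → ∣ lineTransition e x ∣ ≡ 2
  ∣lineTransition∣ {e} {x} inc with line-edges inc
  ... | l , l′ , l≢l′ , at , at′ , only = ∣∣≡length {l = l ∷ l′ ∷ []} ((l≢l′ ∷ []) ∷ [] ∷ [])
    (λ { (here refl) → ∈-lineTransition⁺ at ; (there (here refl)) → ∈-lineTransition⁺ at′ })
    λ m∈ → let b , i = ∈-lineTransition⁻ {e} {x} m∈ in [ here , there ∘ here ]′ (only b i)

  lineTransitions : TransitionSystem lineGraph
  lineTransitions e = record
    { P₁ = lineTransition e (end₁ G e)
    ; P₂ = lineTransition e (end₂ G e)
    ; size₁ = ∣lineTransition∣ (inj₁ refl)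
    ; size₂ = ∣lineTransition∣ (inj₂ refl)
    ; disjoint = λ (l , l∈) → let l∈₁ , l∈₂ = Subset.x∈p∩q⁻ (lineTransition e (end₁ G e)) (lineTransition e (end₂ G e)) l∈ in
        loopless G e (trans (sym (proj₁ (∈-lineTransition⁻ {e} {end₁ G e} l∈₁)))
            (proj₁ (∈-lineTransition⁻ {e} {end₂ G e} l∈₂)))
    ; cover = Subset.⊆-antisym
        (λ l∈ → L.∈-star⁺ ([ proj₂ ∘ ∈-lineTransition⁻ {e} {end₁ G e} , proj₂ ∘ ∈-lineTransition⁻ {e} {end₂ G e} ]′
          (Subset.x∈p∪q⁻ (lineTransition e (end₁ G e)) (lineTransition e (end₂ G e)) l∈)))
        λ l∈ → let inc = L.∈-star⁻ l∈ in Subset.x∈p∪q⁺ (case incident-base inc of λ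
          { (inj₁ eq) → inj₁ (∈-lineTransition⁺ (eq , inc)) ; (inj₂ eq) → inj₂ (∈-lineTransition⁺ (eq , inc)) })
    }

  lineGraph-regular : Regular 4 lineGraph
  lineGraph-regular e with line-edges {end₁ G e} {e} (inj₁ refl) | line-edges {end₂ G e} {e} (inj₂ refl)
  ... | a , b , a≢b , (ab , ai) , (bb , bi) , only | c , d , c≢d , (cb , ci) , (db , di) , only′ =
    L.degree-≡ (a ∷ b ∷ c ∷ d ∷ [])
      ((a≢b ∷ apart ab cb ∷ apart ab db ∷ []) ∷ (apart bb cb ∷ apart bb db ∷ []) ∷ (c≢d ∷ []) ∷ [] ∷ [])
      (λ { (here refl) → ai ; (there (here refl)) → bi ; (there (there (here refl))) → ci ;
          (there (there (there (here refl)))) → di })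
      λ {m} inc → case incident-base inc of λ
        { (inj₁ eq) → case only {m} eq inc of λ { (inj₁ refl) → here refl ; (inj₂ refl) → there (here refl) }
        ; (inj₂ eq) → case only′ {m} eq inc of
            λ { (inj₁ refl) → there (there (here refl)) ; (inj₂ refl) → there (there (there (here refl))) } }
    where
    apart : ∀ {l m} → base l ≡ end₁ G e → base m ≡ end₂ G e → l ≢ m
    apart p q refl = loopless G e (trans (sym p) q)

  -- The side of the triangle at `x` that misses the third edge. Its only ends are `e` and `f`, so
  -- it survives any deletion that spares them.
  shared-edge : ∀ {x e f} → e ≢ f → Incident G x e → Incident G x f → ∃ λ l → Incident lineGraph e l × Incident lineGraph f l
    × (∀ {X} → e ∉ₛ X → f ∉ₛ X → E (deleteVertices lineGraph X) l)
  shared-edge {x} e≢f x-e x-f with corner-index x-e | corner-index x-f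
  ... | i , refl | j , refl = l , e-inc , f-inc , λ e∉ f∉ → tt , avoid e∉ f∉ (inj₁ refl) , avoid e∉ f∉ (inj₂ refl)
    where
    third : ∃ λ k → i ≢ k × j ≢ k
    third with others i j (λ eq → e≢f (cong (corner x) (sym eq)))
    ... | inj₁ refl = next (next i) , (next²-≢ i ∘ sym) , (next-≢ (next i) ∘ sym)
    ... | inj₂ refl = next i , (next-≢ i ∘ sym) , next-≢ (next i)
    l : Edge lineGraph
    l = link x (proj₁ third)
    e-inc : Incident lineGraph (corner x i) l
    e-inc = link-incident x _ i (proj₁ (proj₂ third))
    f-inc : Incident lineGraph (corner x j) l
    f-inc = link-incident x _ j (proj₂ (proj₂ third))
    avoid : ∀ {X} → corner x i ∉ₛ X → corner x j ∉ₛ X → ∀ {g} → Incident lineGraph g l → g ∉ₛ X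
    avoid e∉ f∉ {g} inc with corner x i Fin.≟ g
    ... | yes refl = e∉
    ... | no ne    = subst (_∉ₛ _) (two-ends lineGraph {e = l} e-inc f-inc inc e≢f ne) f∉

  lift-walk : ∀ {X u v} → Walk (deleteEdges G X) u v → ∀ {e f} → Incident G u e → e ∉ₛ X → Incident G v f → f ∉ₛ X →
              Walk (deleteVertices lineGraph X) e f
  lift-walk [] {e} {f} ue e∉ vf f∉ with e Fin.≟ f
  ... | yes refl = []
  ... | no e≢f = let l , e-inc , f-inc , ok = shared-edge e≢f ue vf in L.walk-along (ok e∉ f∉) e-inc f-inc
  lift-walk (step g g∉ j w) {e} ue e∉ vf f∉ with joins-incident G j
  ... | ug , vg , _ = L.walk-++ (lift-walk [] ue e∉ ug g∉) (lift-walk w vg g∉ vf f∉)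

  lineGraph-4-connected : (∀ F → IsCyclicEdgeCut G F → 4 ≤ ∣ F ∣) → 4 < ∣E∣ G → KConnected lineGraph 4
  lineGraph-4-connected cuts≥4 E>4 = E>4 , λ X X<4 →
    (let e , e∉ = fresh (elements X) (ℕ.<-trans (ℕ.≤-<-trans (ℕ.≤-reflexive (length-elements {S = X})) X<4) E>4)
     in e , tt , e∉ ∘ ∈-elements⁺) ,
    λ e f (_ , e∉) (_ , f∉) → connect X X<4 e∉ f∉
    where
    module _ (X : Subset (∣E∣ G)) (X<4 : ∣ X ∣ < 4) where
      connect : ∀ {e f} → e ∉ₛ X → f ∉ₛ X → Walk (deleteVertices lineGraph X) e f
      connect {e} {f} e∉ f∉ with G.walk? {deleteEdges G X} (λ g → ¬? (g Subset.∈? X)) (end₁ G e) (end₁ G f)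
      ... | yes w = lift-walk w (inj₁ refl) e∉ (inj₁ refl) f∉
      ... | no ¬w = ⊥-elim (ℕ.<⇒≱ X<4 (ℕ.≤-trans (cuts≥4 F cut) (Subset.p⊆q⇒∣p∣≤∣q∣ F⊆X)))
        where
        u v : Vertex G
        u = end₁ G e
        v = end₁ G f
        A : Vertex G → Set
        A = Walk (deleteEdges G X) u
        A? : Decidable A
        A? = G.walk? (λ g → ¬? (g Subset.∈? X)) u
        Crosses : Edge G → Set
        Crosses g = (A (end₁ G g) × ¬ A (end₂ G g)) ⊎ (¬ A (end₁ G g) × A (end₂ G g))
        crosses? : Decidable Crosses
        crosses? g = (A? (end₁ G g) ×-dec ¬? (A? (end₂ G g))) ⊎-dec (¬? (A? (end₁ G g)) ×-dec A? (end₂ G g))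
        -- `X` may contain edges inside a component. Restricting to the boundary of `A` makes every
        -- cut edge leave its side, as `four≤tree-cut` demands.
        F : Subset (∣E∣ G)
        F = fromDecidable crosses?
        crossed∈X : ∀ {g} → Crosses g → g ∈ₛ X
        crossed∈X {g} cr = decidable-stable (g Subset.∈? X) λ g∉ → case cr of λ
          { (inj₁ (a , ¬b)) → ¬b (G.walk-++ a (step g g∉ (inj₁ refl) []))
          ; (inj₂ (¬a , b)) → ¬a (G.walk-++ b (step g g∉ (inj₂ refl) [])) }
        F⊆X : ∀ {g} → g ∈ₛ F → g ∈ₛ X
        F⊆X g∈ = crossed∈X (∈-fromDecidable⁻ crosses? g∈)
        uncrossed : ∀ {g a b} → g ∉ₛ F → Joins G g a b → A a → A b
        uncrossed g∉ (inj₁ refl) a = decidable-stable (A? _) λ ¬b → g∉ (∈-fromDecidable⁺ crosses? (inj₁ (a , ¬b)))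
        uncrossed g∉ (inj₂ refl) a = decidable-stable (A? _) λ ¬b → g∉ (∈-fromDecidable⁺ crosses? (inj₂ (¬b , a)))
        stays : ∀ {a b} → Walk (deleteEdges G F) a b → A a → A b
        stays = G.walk-invariant A uncrossed
        -- The edge `g` outside `X` keeps the component from being a single vertex, which three cut
        -- edges could isolate.
        not-tree : ∀ {w g} → Incident G w g → g ∉ₛ X
            → (∀ {h} → h ∈ₛ F → Walk (deleteEdges G F) w (end₁ G h) → ¬ Walk (deleteEdges G F) w (end₂ G h)) →
                   ¬ Tree (component (deleteEdges G F) w)
        not-tree inc g∉ leaves (_ , acyclic) = ℕ.<⇒≱ X<4 (ℕ.≤-trans
          (CubicCuts.Acyclic.four≤tree-cut G cubic F _ acyclic inc (g∉ ∘ F⊆X) leaves) (Subset.p⊆q⇒∣p∣≤∣q∣ F⊆X))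
        cut : IsCyclicEdgeCut G F
        cut = (λ (_ , walk) → ¬w (stays (walk u v tt tt) [])) , u , v , (λ w → ¬w (stays w []))
          , not-tree {u} {e} (inj₁ refl) e∉ (λ h∈ a b → case ∈-fromDecidable⁻ crosses? h∈ of λ
              { (inj₁ (_ , ¬b)) → ¬b (stays b []) ; (inj₂ (¬a , _)) → ¬a (stays a []) })
          , not-tree {v} {f} (inj₁ refl) f∉ λ h∈ a b → case ∈-fromDecidable⁻ crosses? h∈ of λ
              { (inj₁ (sa , _)) → ¬w (stays (G.walk-reverse a) sa) ; (inj₂ (_ , sb)) → ¬w (stays (G.walk-reverse b) sb) }

-- From T-trails to dominating cycles

module DominatingCycle (G : Graph) (cubic : Cubic G) where

  open LineGraph G cubic

  private
    star : ∀ x → ∃ λ l → length l ≤ 3 × (∀ {e} → Incident G x e → e ∈ l)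
    star x with G.degree-star x
    ... | l , len , _ , to , _ = l , ℕ.≤-reflexive (trans len (cubic x)) , to

  hop : Vertex G → Vertex G → Edge G → List G.Dart
  hop x y e with x Fin.≟ y | x Fin.≟ end₁ G e
  ... | yes _ | _     = []
  ... | no _  | yes _ = (e , true) ∷ []
  ... | no _  | no _  = (e , false) ∷ []

  hop-chain : ∀ {x y e} → Incident G x e → Incident G y e → G.Chain x (hop x y e) y
  hop-chain {x} {y} {e} xe ye with x Fin.≟ y | x Fin.≟ end₁ G e
  ... | yes eq | _       = eq
  ... | no x≢y | yes eq = sym eq , two-ends G {e = e} xe (inj₂ refl) ye (λ eq′ → loopless G e (trans (sym eq) eq′)) x≢y
  ... | no x≢y | no ne  = [ (λ eq → ⊥-elim (ne eq)) , sym ]′ xe , two-ends G {e = e} xe (inj₁ refl) ye ne x≢y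

  hop-edges : ∀ {x y e f} → f ∈ map G.edge (hop x y e) → f ≡ e × x ≢ y
  hop-edges {x} {y} {e} p with x Fin.≟ y | x Fin.≟ end₁ G e
  hop-edges (here refl) | no x≢y | yes _ = refl , x≢y
  hop-edges (here refl) | no x≢y | no _  = refl , x≢y

  hop-unique : ∀ x y e → Unique (map G.edge (hop x y e))
  hop-unique x y e with x Fin.≟ y | x Fin.≟ end₁ G e
  ... | yes _ | _     = []
  ... | no _  | yes _ = [] ∷ []
  ... | no _  | no _  = [] ∷ []

  -- The edges of G at which the trail changes its base vertex form a closed trail of G.
  module FromTrail (E>4 : 4 < ∣E∣ G) {e₀} (w : Walk (whole lineGraph) e₀ e₀)
      (w-unique : Unique (edges w)) (w-spans : ∀ e → e ∈ vertices w)
      (w-local : ∀ e → ∣ edgeSet w ∩ E[_] lineGraph e ∣ ≡ 2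
                     ⊎ (Follows w (P₁ (lineTransitions e)) × Follows w (P₂ (lineTransitions e)))) where

    module _ {d₀ ds} (chain : L.Chain e₀ (d₀ ∷ ds) e₀) (eqₑ : map L.edge (d₀ ∷ ds) ≡ edges w)
        (eqᵥ : map L.tail (d₀ ∷ ds) ≡ vertices w) where

      private
        D : List L.Dart
        D = d₀ ∷ ds

      open L.Trail {e₀} {D} chain (subst Unique (sym eqₑ) w-unique)

      pt : L.Dart → Vertex G
      pt d = base (L.edge d)

      piece : L.Dart × L.Dart → List G.Dart
      piece (d , d′) = hop (pt d) (pt d′) (L.tail d′)

      open G.Expansion pt piece

      head-incident : ∀ d → Incident G (pt d) (L.head d)
      head-incident d = incident-base (L.head-at d refl)

      tail-incident : ∀ d → Incident G (pt d) (L.tail d)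
      tail-incident d = incident-base (L.tail-at d refl)

      pieces-ok : ∀ {d d′} → (d , d′) ∈ cyclicPairs D → G.Chain (pt d) (piece (d , d′)) (pt d′)
      pieces-ok {d} {d′} p = hop-chain (subst (Incident G (pt d)) (closed-linked p) (head-incident d)) (tail-incident d′)

      C : List G.Dart
      C = concatMap piece (cyclicPairs D)

      C-chain : G.Chain (pt d₀) C (pt d₀)
      C-chain = expand-closed pieces-ok

      -- A change of base at `e` has one edge in each of the two triangles at `e`, hence one in
      -- `P₁`. Both edges of `P₁` are taken by the passage that follows it, which stays in its
      -- triangle.
      followed-no-change : ∀ {e} → Follows w (P₁ (lineTransitions e)) → ∀ {d d′} → (d , d′) ∈ cyclicPairs D
          → L.tail d′ ≡ e → pt d ≡ pt d′
      followed-no-change {e} (a , b , ab∈ , P≡) {d} {d′} p td′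
        with ∈-map⁻ (λ q → L.edge (proj₁ q)
            , L.edge (proj₂ q)) (subst ((a , b) ∈_) (cyclicPairs-map L.edge D)
            (subst (λ l → (a , b) ∈ cyclicPairs l) (sym eqₑ) ab∈))
      ... | (da , db) , q , refl = decidable-stable (pt d Fin.≟ pt d′) clash
        where
        x : Vertex G
        x = end₁ G e
        a∈ : AtBase e x (L.edge da)
        a∈ = ∈-lineTransition⁻ {e} {x} (subst (L.edge da ∈ₛ_) (sym P≡) (∈-pair⁺ (inj₁ refl)))
        b∈ : AtBase e x (L.edge db)
        b∈ = ∈-lineTransition⁻ {e} {x} (subst (L.edge db ∈ₛ_) (sym P≡) (∈-pair⁺ (inj₂ refl)))
        da∈ : da ∈ D
        da∈ = cyclicPairs-∈₁ {xs = D} q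
        db∈ : db ∈ D
        db∈ = cyclicPairs-∈₂ {xs = D} q
        d∈ : d ∈ D
        d∈ = cyclicPairs-∈₁ {xs = D} p
        d′∈ : d′ ∈ D
        d′∈ = cyclicPairs-∈₂ {xs = D} p
        hd : L.head d ≡ e
        hd = trans (closed-linked p) td′
        -- Two edges of the triangle at x have only one end in common.
        head-da : L.head da ≡ e
        head-da = common (proj₁ b∈) (proj₁ a∈) (passage-≢ q) (L.head-at da refl) (proj₂ a∈)
            (L.tail-at db (sym (closed-linked q))) (proj₂ b∈)
          where
          common : ∀ {l m g h} → base m ≡ x → base l ≡ x → l ≢ m → Incident lineGraph g l → Incident lineGraph h l →
                   Incident lineGraph g m → Incident lineGraph h m → g ≡ h
          common {l} {m} {g} {h} bm bl l≢m gl hl gm hm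
            with corner-index (subst (λ z → Incident G z g) bl (incident-base gl)) | corner-index
                (subst (λ z → Incident G z h) bl (incident-base hl))
          ... | i , refl | j , refl = cong (corner x) (third-unique {omitted l} {omitted m}
                (λ eq → l≢m (trans (sym (link-base l)) (trans (cong₂ link (trans bl (sym bm)) eq) (link-base m))))
                (missing bl gl) (missing bm gm) (missing bl hl) (missing bm hm))
            where
            missing : ∀ {l k} → base l ≡ x → Incident lineGraph (corner x k) l → omitted l ≢ k
            missing bl inc eq = incident-omitted inc (cong₂ corner bl eq)
        tail-db : L.tail db ≡ e
        tail-db = trans (sym (closed-linked q)) head-da
        both : ∀ {g} → AtBase e x g → g ≡ L.edge da ⊎ g ≡ L.edge db
        both g∈ = ∈-pair⁻ (subst (_ ∈ₛ_) P≡ (∈-lineTransition⁺ g∈))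
        same-base : pt da ≡ pt db
        same-base = trans (proj₁ a∈) (sym (proj₁ b∈))
        clash : ¬ (pt d ≢ pt d′)
        clash ne with subst (Incident G (pt d)) hd (head-incident d) | subst (Incident G (pt d′)) td′ (tail-incident d′)
        ... | inj₁ eq | _ = case both (eq , L.head-at d hd) of λ
          { (inj₁ e≡) → case edge-injective d∈ da∈ e≡ of
              λ { refl → case cyclicPairs-succ-unique unique-darts p q of λ { refl → ne same-base } }
          ; (inj₂ e≡) → in≢out d∈ db∈ hd tail-db e≡ }
        ... | inj₂ _ | inj₁ eq = case both (eq , L.tail-at d′ td′) of λ
          { (inj₁ e≡) → in≢out da∈ d′∈ head-da td′ (sym e≡)
          ; (inj₂ e≡) → case edge-injective d′∈ db∈ e≡ of
              λ { refl → case cyclicPairs-pred-unique unique-darts p q of λ { refl → ne same-base } } }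
        ... | inj₂ eq | inj₂ eq′ = ne (trans eq (sym eq′))

      -- A change of base rules out followed transitions, so the trail has just two edges at this
      -- vertex of the line graph, while two visits would use four.
      changes-once : ∀ {d₁ d₁′ d₂ d₂′} → (d₁ , d₁′) ∈ cyclicPairs D → (d₂ , d₂′) ∈ cyclicPairs D →
                     L.tail d₁′ ≡ L.tail d₂′ → pt d₁ ≢ pt d₁′ → d₁′ ≡ d₂′
      changes-once {d₁} {d₁′} {d₂} {d₂′} p q t≡ ne with w-local (L.tail d₁′)
      ... | inj₂ (f , _) = ⊥-elim (ne (followed-no-change f p refl))
      ... | inj₁ two with L.edge d₁′ Fin.≟ L.edge d₂′
      ...   | yes eq = edge-injective (cyclicPairs-∈₂ {xs = D} p) (cyclicPairs-∈₂ {xs = D} q) eq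
      ...   | no d₁′≢d₂′ = ⊥-elim (ℕ.<⇒≱ (s≤s (s≤s (s≤s z≤n)))
          (subst (4 ≤_) two (length≤∣∣ {l = L.edge d₁ ∷ L.edge d₂ ∷ L.edge d₁′ ∷ L.edge d₂′ ∷ []}
            ((d₁≢d₂ ∷ in≢out d₁∈ d₁′∈ h₁ refl ∷ in≢out d₁∈ d₂′∈ h₁ (sym t≡) ∷ [])
              ∷ (in≢out d₂∈ d₁′∈ h₂ refl ∷ in≢out d₂∈ d₂′∈ h₂ (sym t≡) ∷ []) ∷ (d₁′≢d₂′ ∷ []) ∷ [] ∷ [])
            λ { (here refl) → into d₁∈ (L.head-at d₁ h₁) ; (there (here refl)) → into d₂∈ (L.head-at d₂ h₂)
              ; (there (there (here refl))) → into d₁′∈ (L.tail-at d₁′ refl) ;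
                  (there (there (there (here refl)))) → into d₂′∈ (L.tail-at d₂′ (sym t≡)) })))
        where
        d₁∈ : d₁ ∈ D
        d₁∈ = cyclicPairs-∈₁ {xs = D} p
        d₁′∈ : d₁′ ∈ D
        d₁′∈ = cyclicPairs-∈₂ {xs = D} p
        d₂∈ : d₂ ∈ D
        d₂∈ = cyclicPairs-∈₁ {xs = D} q
        d₂′∈ : d₂′ ∈ D
        d₂′∈ = cyclicPairs-∈₂ {xs = D} q
        h₁ : L.head d₁ ≡ L.tail d₁′
        h₁ = closed-linked p
        h₂ : L.head d₂ ≡ L.tail d₁′
        h₂ = trans (closed-linked q) (sym t≡)
        d₁≢d₂ : L.edge d₁ ≢ L.edge d₂
        d₁≢d₂ eq with edge-injective d₁∈ d₂∈ eq
        ... | refl = d₁′≢d₂′ (cong L.edge (cyclicPairs-succ-unique unique-darts p q))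
        into : ∀ {d} → d ∈ D → Incident lineGraph (L.tail d₁′) (L.edge d)
            → L.edge d ∈ₛ edgeSet w ∩ E[_] lineGraph (L.tail d₁′)
        into d∈ inc = Subset.x∈p∩q⁺ (∈-fromList⁺ (subst (_ ∈_) eqₑ (∈-map⁺ L.edge d∈)) , L.∈-star⁺ inc)

      C-unique : Unique (map G.edge C)
      C-unique = subst Unique (sym (map-concatMap G.edge piece (cyclicPairs D)))
        (unique-concatMap (map G.edge ∘ piece) (cyclicPairs-unique unique-darts)
            (λ { {d , d′} _ → hop-unique (pt d) (pt d′) (L.tail d′) }) apart)
        where
        apart : ∀ {p q f} → p ∈ cyclicPairs D → q ∈ cyclicPairs D → f ∈ map G.edge (piece p)
            → f ∈ map G.edge (piece q) → p ≡ q
        apart {d₁ , d₁′} {d₂ , d₂′} p∈ q∈ f∈ f∈′ with hop-edges {pt d₁} f∈ | hop-edges {pt d₂} f∈′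
        ... | eq , ne | eq′ , _ with changes-once p∈ q∈ (trans (sym eq) eq′) ne
        ...   | refl = cong (_, d₁′) (cyclicPairs-pred-unique unique-darts p∈ q∈)

      arrives : ∀ e → ∃ λ d → d ∈ D × Incident G (pt d) e
      arrives e with passage (subst (e ∈_) (sym eqᵥ) (w-spans e))
      ... | d , _ , p , refl , _ = d , cyclicPairs-∈₁ {xs = D} p , head-incident d

      -- If the base never changed, all edges of `G` would lie at a single vertex, which has only
      -- three.
      C≢[] : C ≢ []
      C≢[] empty with star (pt d₀)
      ... | l , ≤3 , to = ℕ.<⇒≱ E>4 (ℕ.≤-trans (subst (_≤ length l) (List.length-tabulate {n = ∣E∣ G} id)
            (unique-⊆-length (Unique.allFin⁺ (∣E∣ G)) λ {e} _ → let d , d∈ , inc = arrives e in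
              to (subst (λ z → Incident G z e) (point-constant {d₀} {ds} pieces-ok empty d∈) inc)))
            (ℕ.≤-trans ≤3 (ℕ.n≤1+n 3)))

      dominating : HasDominatingCycle G
      dominating with G.chain-walk {H = whole G} C C-chain (All.universal (λ _ → tt) C)
      ... | cycle , eₑ , eᵥ = pt d₀ , cycle
        , ( (λ empty → C≢[] (no-edges C (trans (sym eₑ) empty)))
          , subst Unique (sym eₑ) C-unique
          , subst Unique (sym eᵥ) (G.Trail.DegreeThree.unique-tails {ds = C} C-chain C-unique Fin._≟_ star))
        , λ e → let d , d∈ , inc = arrives e in
            pt d , subst (pt d ∈_) (sym eᵥ) (point-visited {d₀} {ds} pieces-ok C≢[] d∈) , inc
        where
        no-edges : ∀ (l : List G.Dart) → map G.edge l ≡ [] → l ≡ []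
        no-edges [] _ = refl

    dominating-cycle : HasDominatingCycle G
    dominating-cycle with L.walk-chain w
    ... | [] , _ , _ , eqᵥ , _ = case subst (e₀ ∈_) (sym eqᵥ) (w-spans e₀) of λ ()
    ... | d₀ ∷ ds , chain , eqₑ , eqᵥ , _ = dominating {d₀} {ds} chain eqₑ eqᵥ

  -- Cubic graphs with at most four edges

  out : Vertex G → Edge G → G.Dart
  out x e with x Fin.≟ end₁ G e
  ... | yes _ = e , true
  ... | no _  = e , false

  out-edge : ∀ x e → G.edge (out x e) ≡ e
  out-edge x e with x Fin.≟ end₁ G e
  ... | yes _ = refl
  ... | no _  = refl

  out-tail : ∀ {x e} → Incident G x e → G.tail (out x e) ≡ x
  out-tail {x} {e} inc with x Fin.≟ end₁ G e
  ... | yes eq = sym eq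
  ... | no ne  = [ (λ eq → ⊥-elim (ne eq)) , sym ]′ inc

  -- A count of darts: three leave each vertex, and there are two for each edge.
  handshake : ∣V∣ G * 3 ≤ ∣E∣ G + ∣E∣ G
  handshake = ℕ.≤-trans (ℕ.≤-reflexive
      (sym (trans (outs-length (allFin (∣V∣ G))) (cong (_* 3) (List.length-tabulate {n = ∣V∣ G} id)))))
    (ℕ.≤-trans (unique-⊆-length unique all-darts)
      (ℕ.≤-reflexive (trans (List.length-++ (map (_, true) (allFin (∣E∣ G)))) (cong₂ _+_ (half true) (half false)))))
    where
    half : ∀ b → length (map (_, b) (allFin (∣E∣ G))) ≡ ∣E∣ G
    half b = trans (List.length-map (_, b) (allFin (∣E∣ G))) (List.length-tabulate {n = ∣E∣ G} id)
    outs : Vertex G → List G.Dart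
    outs x = map (out x) (proj₁ (G.degree-star x))
    outs-length : ∀ xs → length (concatMap outs xs) ≡ length xs * 3
    outs-length [] = refl
    outs-length (x ∷ xs) = trans (List.length-++ (outs x)) (cong₂ _+_
      (trans (List.length-map (out x) (proj₁ (G.degree-star x)))
          (trans (proj₁ (proj₂ (G.degree-star x))) (cubic x))) (outs-length xs))
    outs-tail : ∀ {x d} → d ∈ outs x → G.tail d ≡ x
    outs-tail {x} d∈ with ∈-map⁻ (out x) d∈
    ... | e , e∈ , refl = out-tail (proj₂ (proj₂ (proj₂ (proj₂ (G.degree-star x)))) e∈)
    unique : Unique (concatMap outs (allFin (∣V∣ G)))
    unique = unique-concatMap outs (Unique.allFin⁺ _)
      (λ {x} _ → Unique.map⁺ (λ {e} {f} eq → trans (sym (out-edge x e)) (trans (cong G.edge eq) (out-edge x f)))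
          (proj₁ (proj₂ (proj₂ (G.degree-star x)))))
      (λ _ _ p q → trans (sym (outs-tail p)) (outs-tail q))
    all-darts : ∀ {d} → d ∈ concatMap outs (allFin (∣V∣ G))
        → d ∈ map (_, true) (allFin (∣E∣ G)) ++ map (_, false) (allFin (∣E∣ G))
    all-darts {e , true}  _ = ∈-++⁺ˡ (∈-map⁺ (_, true) (∈-allFin e))
    all-darts {e , false} _ = ∈-++⁺ʳ (map (_, true) (allFin (∣E∣ G))) (∈-map⁺ (_, false) (∈-allFin e))

  -- By `handshake` three times the number of vertices is at most 8, hence below 9.
  two-vertices : ∣E∣ G ≤ 4 → ∣V∣ G ≤ 2
  two-vertices E≤4 = ℕ.≤-pred (ℕ.*-cancelʳ-< 3 (∣V∣ G) 3 (s≤s (ℕ.≤-trans handshake (ℕ.+-mono-≤ E≤4 E≤4))))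

  same-other : ∣V∣ G ≤ 2 → ∀ {x y z : Vertex G} → x ≢ y → x ≢ z → y ≡ z
  same-other V≤2 {x} {y} {z} x≢y x≢z = decidable-stable (y Fin.≟ z) λ y≢z → ℕ.<⇒≱ (s≤s V≤2)
    (subst (3 ≤_) (List.length-tabulate {n = ∣V∣ G} id)
      (unique-⊆-length {xs = x ∷ y ∷ z ∷ []} ((x≢y ∷ x≢z ∷ []) ∷ (y≢z ∷ []) ∷ [] ∷ []) λ {a} _ → ∈-allFin a))

  -- With at most four edges the line graph has too few vertices to be 4-connected. The graph then
  -- consists of three parallel edges, and two of them form a cycle through both vertices.
  small-dominating-cycle : ∣V∣ G ≤ 2 → Vertex G → HasDominatingCycle G
  small-dominating-cycle V≤2 v with G.degree-star v
  ... | l , len , u , _ , from with trans len (cubic v)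
  small-dominating-cycle V≤2 v | e ∷ f ∷ _ ∷ [] , _ , (e≢f ∷ _) ∷ _ , _ , from | refl
    with G.at-out (from (here refl)) | G.at-out (from (there (here refl)))
  ... | d , refl , refl | d′ , refl , t′
    with G.chain-walk {H = whole G} (d ∷ G.flip d′ ∷ [])
           (refl , trans (G.tail-flip d′) (same-other V≤2 (λ eq → G.tail≢head d′ (trans t′ eq)) (G.tail≢head d))
               , trans (G.head-flip d′) t′)
           (tt ∷ tt ∷ [])
  ... | w , eₑ , eᵥ = G.tail d , w
    , ( (λ empty → case trans (sym eₑ) empty of λ ())
      , subst Unique (sym eₑ) ((e≢f ∷ []) ∷ [] ∷ [])
      , subst Unique (sym eᵥ) ((tails-≢ ∷ []) ∷ [] ∷ []))
    , λ g → end₁ G g , subst (end₁ G g ∈_) (sym eᵥ) (met (end₁ G g)) , inj₁ refl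
    where
    tails-≢ : G.tail d ≢ G.tail (G.flip d′)
    tails-≢ eq = G.tail≢head d′ (trans t′ (trans eq (G.tail-flip d′)))
    met : ∀ x → x ∈ G.tail d ∷ G.tail (G.flip d′) ∷ []
    met x with x Fin.≟ G.tail d
    ... | yes eq = here eq
    ... | no ne  = there (here (same-other V≤2 (ne ∘ sym) tails-≢))

NWC*→DCC : NWC* → DCC
NWC*→DCC nwc G cubic cyclic with 4 ℕ.<? ∣E∣ G
... | no E≤4 = small-dominating-cycle (two-vertices (ℕ.≮⇒≥ E≤4)) (proj₁ (proj₁ (proj₁ cyclic)))
  where open DominatingCycle G cubic
... | yes E>4 with nwc (LineGraph.lineGraph G cubic) (LineGraph.lineGraph-regular G cubic)
                       (LineGraph.lineGraph-4-connected G cubic (four≤cyclic-cut G cyclic) E>4)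
                           (LineGraph.lineTransitions G cubic)
...   | _ , w , unique , spans , local = DominatingCycle.FromTrail.dominating-cycle G cubic E>4 w unique spans local

theorem1p2 : DCC ⇔ NWC*
theorem1p2 = mk⇔ DCC→NWC* NWC*→DCC
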